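{- Fix an integer $k\ge1$. Let $q\in[1,k]$ and $j\in[1,q]$ be integers with $\gcd(j,q)=1$, and let $f,m,M,s,t,\eta,c$ be as defined in the context. Then for each $w\in[1,f]$, $c(0)\to c(1)\to\cdots\to c(q)=c(0)$ is a cycle of $G(\eta(q,j),k)$, and these $f$ cycles (for $w=1,\dots,f$) are distinct cycles of length $q$; consequently $N(\eta(q,j),k)=f$ and $\eta(q,j)$ is a local peak. Moreover, the local peaks are exactly the integers $\eta(q,j)$ with $1\le q\le k$, $1\le j\le q$, $\gcd(j,q)=1$; i.e. the set of points $(n,N(n,k))$ with $n$ a local peak is exactly $\{(\eta(q,j),\lfloor k/q\rfloor): 1\le q\le k,\ 1\le j\le q,\ \gcd(j,q)=1\}$.
   Context: For integers $\ell$ and $p\ge1$, $(\ell)_p$ (also $\ell_p$) denotes the least nonnegative residue of $\ell$ modulo $p$. $G(n,k)$ is the directed graph on vertices $0,\dots,k$ with exactly the $k$ edges $(i+n-2)_{k+1}\to(i+n-1)_k$, $1\le i\le k$ (a loop $a\to a$ counts as a cycle of length $1$). For $n>k$, $N(n,k)$ is the nullity of the $n\times n$ skew-symmetric Toeplitz matrix $A(n,k)$ whose first $k$ superdiagonals are all $1$ and remaining superdiagonals all $0$; this nullity depends only on $n \bmod (k^2+k)$, and $N(n,k)$ is defined for every integer $n$ as $N(n',k)$ for any $n'>k$ with $n'\equiv n\pmod{k^2+k}$. An integer $n$ with $0<n<k^2+k$ is a local peak if $N(n-1,k)<N(n,k)$ and $N(n+1,k)<N(n,k)$. Notation: $f=\lfloor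 k/q\rfloor$, $m=k-fq$, $M=m+1$; $s(q,j)=|\{a\in[1,m]:(aj)_q\le(Mj)_q\}|$; for $r\in[1,q-1]$, $t(r,q,j)=|\{a\in[0,m]:(aj)_q<(rj)_q\}|$; $\eta(q,j)=k\lfloor (k+1)j/q\rfloor-k+(Mj)_q f+s(q,j)$; for $w\in[1,f]$, $c(r)=-1-w+(rj)_q f+t(r,q,j)$ for $1\le r\le q-1$ and $c(0)=c(q)=k-w$. -}

module Defs where

open import Data.Bool.Base using (if_then_else_)
open import Data.Fin.Base as Fin using (Fin; zero; suc; toℕ; punchIn)
open import Data.Fin.Properties as Fin using (any?; punchInᵢ≢i)
open import Data.Integer.Base as ℤ using (ℤ; +_)
open import Data.Integer.DivMod using (_%ℕ_)
open import Data.List.Base using (List; length; filter; map; upTo)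
open import Data.Nat.Base as ℕ using (ℕ; zero; suc; NonZero)
open import Data.Nat.DivMod using (_/_; _%_)
import Data.Nat.Properties as ℕ
open import Data.Product.Base using (∃-syntax; _×_; _,_; proj₁; proj₂)
open import Data.Rational.Base using (ℚ; 0ℚ; 1ℚ; _+_; _*_; _-_; -_; 1/_; ≢-nonZero)
open import Data.Rational.Properties
open import Data.Vec.Functional using (Vector; insertAt; removeAt)
open import Data.Vec.Functional.Properties using (insertAt-lookup; insertAt-punchIn)
open import Algebra.Bundles using (CommutativeRing)
open import Algebra.Solver.Ring.AlmostCommutativeRing using (fromCommutativeRing)
import Algebra.Solver.Ring.Simple
open import Algebra.Properties.Semiring.Sum (CommutativeRing.semiring +-*-commutativeRing)
open import Function.Bundles using (_⇔_)
open import Relation.Binary.PropositionalEquality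
open import Relation.Nullary.Decidable
  using (Dec; does; yes; no; ¬?; _×-dec_; decidable-stable; dec-yes; dec-no)

Matrix : ℕ → ℕ → Set
Matrix m n = Fin m → Fin n → ℚ

infixl 7 _·_

_·_ : ∀ {n} → Vector ℚ n → Vector ℚ n → ℚ
_·_ {n} a u = ∑[ x < n ] (a x * u x)

Kernel : ∀ {m n} → Matrix m n → Vector ℚ n → Set
Kernel A u = ∀ i → A i · u ≡ 0ℚ

combine : ∀ {d n} → Vector ℚ d → (Fin d → Vector ℚ n) → Vector ℚ n
combine {d} c v x = ∑[ i < d ] (c i * v i x)

record IsBasis {d n} (W : Vector ℚ n → Set) (v : Fin d → Vector ℚ n) : Set where
  field
    member      : ∀ i → W (v i)
    independent : ∀ c → (∀ x → combine c v x ≡ 0ℚ) → ∀ i → c i ≡ 0ℚ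
    spanning    : ∀ u → W u → ∃[ c ] (∀ x → u x ≡ combine c v x)

IsNullity : ∀ {m n} → Matrix m n → ℕ → Set
IsNullity {n = n} A d = ∃[ v ] IsBasis {d} {n} (Kernel A) v

private

  module Solver =
    Algebra.Solver.Ring.Simple (fromCommutativeRing +-*-commutativeRing) _≟_
  open Solver using (solve; con; _:=_; _:+_; _:*_; _:-_; :-_)

  δ : ∀ {n} → Fin n → Vector ℚ n
  δ i x = if does (i Fin.≟ x) then 1ℚ else 0ℚ

  δ-refl : ∀ {n} (x : Fin n) → δ x x ≡ 1ℚ
  δ-refl x rewrite proj₂ (dec-yes (x Fin.≟ x) refl) = refl

  δ-≢ : ∀ {n} {i x : Fin n} → i ≢ x → δ i x ≡ 0ℚ
  δ-≢ {i = i} {x} i≢x rewrite dec-no (i Fin.≟ x) i≢x = refl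

  sum-0 : ∀ {n} (f : Vector ℚ n) → (∀ i → f i ≡ 0ℚ) → sum f ≡ 0ℚ
  sum-0 {n} f f≡0 = trans (sum-cong-≗ f≡0) (sum-replicate-zero n)

  combine-δ : ∀ {n} (c : Vector ℚ n) x → combine c δ x ≡ c x
  combine-δ {suc n} c x = begin
    combine c δ x                                              ≡⟨ sum-remove {i = x} (λ i → c i * δ i x) ⟩
    c x * δ x x + sum (removeAt (λ i → c i * δ i x) x)          ≡⟨ cong₂ _+_ (cong (c x *_) (δ-refl x)) (sum-0 _ off) ⟩
    c x * 1ℚ + 0ℚ                                              ≡⟨ +-identityʳ _ ⟩
    c x * 1ℚ                                                   ≡⟨ *-identityʳ _ ⟩
    c x                                                        ∎
    where
    open ≡-Reasoning
    off : ∀ i → c (punchIn x i) * δ (punchIn x i) x ≡ 0ℚ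
    off i = trans (cong (c (punchIn x i) *_) (δ-≢ (punchInᵢ≢i x i))) (*-zeroʳ (c (punchIn x i)))

  ·-combine : ∀ {d n} (φ : Vector ℚ n) (c : Vector ℚ d) (v : Fin d → Vector ℚ n) →
              φ · combine c v ≡ ∑[ i < d ] (c i * (φ · v i))
  ·-combine {d} {n} φ c v = begin
    ∑[ x < n ] (φ x * ∑[ i < d ] (c i * v i x))   ≡⟨ sum-cong-≗ (λ x → *-distribˡ-sum (φ x) (λ i → c i * v i x)) ⟩
    ∑[ x < n ] ∑[ i < d ] (φ x * (c i * v i x))   ≡⟨ ∑-comm (λ x i → φ x * (c i * v i x)) ⟩
    ∑[ i < d ] ∑[ x < n ] (φ x * (c i * v i x))   ≡⟨ sum-cong-≗ (λ i → sum-cong-≗ (λ x → swap (φ x) (c i) (v i x))) ⟩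
    ∑[ i < d ] ∑[ x < n ] (c i * (φ x * v i x))   ≡⟨ sum-cong-≗ (λ i → *-distribˡ-sum (c i) (λ x → φ x * v i x)) ⟨
    ∑[ i < d ] (c i * (φ · v i))                  ∎
    where
    open ≡-Reasoning
    swap : ∀ a b c → a * (b * c) ≡ b * (a * c)
    swap = solve 3 (λ a b c → a :* (b :* c) := b :* (a :* c)) refl

  ·-shear : ∀ {n} (φ u w : Vector ℚ n) b →
            φ · (λ x → u x - b * w x) ≡ φ · u - b * (φ · w)
  ·-shear {n} φ u w b = begin
    ∑[ x < n ] (φ x * (u x - b * w x))                  ≡⟨ sum-cong-≗ (λ x → distr (φ x) (u x) b (w x)) ⟩
    ∑[ x < n ] (φ x * u x + (- b) * (φ x * w x))        ≡⟨ ∑-distrib-+ (λ x → φ x * u x) _ ⟩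
    φ · u + ∑[ x < n ] ((- b) * (φ x * w x))            ≡⟨ cong (λ z → φ · u + z) (*-distribˡ-sum (- b) (λ x → φ x * w x)) ⟨
    φ · u + (- b) * (φ · w)                             ≡⟨ cong (λ z → φ · u + z) (neg-distribˡ-* b (φ · w)) ⟨
    φ · u - b * (φ · w)                                 ∎
    where
    open ≡-Reasoning
    distr : ∀ p u b w → p * (u - b * w) ≡ p * u + (- b) * (p * w)
    distr = solve 4 (λ p u b w → p :* (u :- b :* w) := p :* u :+ (:- b) :* (p :* w)) refl

  combine-shear : ∀ {d n} (c b : Vector ℚ d) (v : Fin d → Vector ℚ n) (w : Vector ℚ n) x →
                  combine c (λ i y → v i y - b i * w y) x ≡ (- (c · b)) * w x + combine c v x
  combine-shear {d} c b v w x = begin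
    ∑[ i < d ] (c i * (v i x - b i * w x))                        ≡⟨ sum-cong-≗ (λ i → distr (c i) (v i x) (b i) (w x)) ⟩
    ∑[ i < d ] ((c i * b i) * (- w x) + c i * v i x)              ≡⟨ ∑-distrib-+ (λ i → (c i * b i) * (- w x)) _ ⟩
    ∑[ i < d ] ((c i * b i) * (- w x)) + combine c v x            ≡⟨ cong (_+ combine c v x) (*-distribʳ-sum (- w x) (λ i → c i * b i)) ⟨
    (c · b) * (- w x) + combine c v x                             ≡⟨ cong (_+ combine c v x) (neg (c · b) (w x)) ⟩
    (- (c · b)) * w x + combine c v x                             ∎
    where
    open ≡-Reasoning
    distr : ∀ c v b w → c * (v - b * w) ≡ (c * b) * (- w) + c * v
    distr = solve 4 (λ c v b w → c :* (v :- b :* w) := (c :* b) :* (:- w) :+ c :* v) refl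
    neg : ∀ a b → a * (- b) ≡ (- a) * b
    neg = solve 2 (λ a b → a :* (:- b) := (:- a) :* b) refl

  -- v is a basis of the common kernel of the rows after the first, and the
  -- first row does not vanish at v p; subtracting multiples of v p from the
  -- other basis vectors gives a basis of the kernel of A.
  module Pivot {m n d} (A : Matrix (suc m) n) (v : Fin (suc d) → Vector ℚ n)
               (basis : IsBasis (Kernel (λ i → A (suc i))) v)
               (p : Fin (suc d)) (pivot≢0 : A zero · v p ≢ 0ℚ) where
    open ≡-Reasoning
    open IsBasis basis

    φ : Vector ℚ n
    φ = A zero

    instance _ = ≢-nonZero pivot≢0

    π : ℚ
    π = φ · v p

    rest : Fin d → Vector ℚ n
    rest i = v (punchIn p i)

    β : Vector ℚ d
    β i = (φ · rest i) * 1/ π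

    β-π : ∀ i → β i * π ≡ φ · rest i
    β-π i = begin
      (φ · rest i) * 1/ π * π    ≡⟨ *-assoc (φ · rest i) (1/ π) π ⟩
      (φ · rest i) * (1/ π * π)  ≡⟨ cong ((φ · rest i) *_) (*-inverseˡ π) ⟩
      (φ · rest i) * 1ℚ          ≡⟨ *-identityʳ _ ⟩
      φ · rest i                 ∎

    v′ : Fin d → Vector ℚ n
    v′ i x = rest i x - β i * v p x

    member′ : ∀ i → Kernel A (v′ i)
    member′ i zero = begin
      φ · v′ i                  ≡⟨ ·-shear φ (rest i) (v p) (β i) ⟩
      φ · rest i - β i * π      ≡⟨ cong (λ z → φ · rest i - z) (β-π i) ⟩
      φ · rest i - φ · rest i   ≡⟨ +-inverseʳ (φ · rest i) ⟩
      0ℚ                        ∎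
    member′ i (suc r) = begin
      A (suc r) · v′ i                                ≡⟨ ·-shear (A (suc r)) (rest i) (v p) (β i) ⟩
      A (suc r) · rest i - β i * (A (suc r) · v p)    ≡⟨ cong₂ (λ y z → y - β i * z) (member (punchIn p i) r) (member p r) ⟩
      0ℚ - β i * 0ℚ                                   ≡⟨ zero-shear (β i) ⟩
      0ℚ                                              ∎
      where
      zero-shear : ∀ b → 0ℚ - b * 0ℚ ≡ 0ℚ
      zero-shear = solve 1 (λ b → con 0ℚ :- b :* con 0ℚ := con 0ℚ) refl

    combine-split : ∀ c x → combine c v x ≡ c p * v p x + combine (removeAt c p) rest x
    combine-split c x = sum-remove {i = p} (λ i → c i * v i x)

    independent′ : ∀ c → (∀ x → combine c v′ x ≡ 0ℚ) → ∀ i → c i ≡ 0ℚ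
    independent′ c c≡0 i = trans (sym (insertAt-punchIn c p (- (c · β)) i))
                                 (independent ĉ ĉ≡0 (punchIn p i))
      where
      ĉ : Vector ℚ (suc d)
      ĉ = insertAt c p (- (c · β))
      ĉ≡0 : ∀ x → combine ĉ v x ≡ 0ℚ
      ĉ≡0 x = begin
        combine ĉ v x                                  ≡⟨ combine-split ĉ x ⟩
        ĉ p * v p x + combine (removeAt ĉ p) rest x    ≡⟨ cong₂ _+_ (cong (_* v p x) (insertAt-lookup c p _))
                                                            (sum-cong-≗ (λ i → cong (_* rest i x) (insertAt-punchIn c p _ i))) ⟩
        (- (c · β)) * v p x + combine c rest x         ≡⟨ combine-shear c β rest (v p) x ⟨
        combine c v′ x                                 ≡⟨ c≡0 x ⟩
        0ℚ                                             ∎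

    spanning′ : ∀ u → Kernel A u → ∃[ c ] (∀ x → u x ≡ combine c v′ x)
    spanning′ u u∈K with spanning u (λ i → u∈K (suc i))
    ... | c , u≡ = ć , λ x → begin
        u x                                      ≡⟨ u≡ x ⟩
        combine c v x                            ≡⟨ combine-split c x ⟩
        c p * v p x + combine ć rest x           ≡⟨ cong (λ z → z * v p x + combine ć rest x) cp≡ ⟩
        (- (ć · β)) * v p x + combine ć rest x   ≡⟨ combine-shear ć β rest (v p) x ⟨
        combine ć v′ x                           ∎
      where
      ć : Vector ℚ d
      ć = removeAt c p
      Σ≡ : ∑[ i < d ] (ć i * (φ · rest i)) ≡ (ć · β) * π
      Σ≡ = begin
        ∑[ i < d ] (ć i * (φ · rest i))  ≡⟨ sum-cong-≗ (λ i → cong (ć i *_) (β-π i)) ⟨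
        ∑[ i < d ] (ć i * (β i * π))     ≡⟨ sum-cong-≗ (λ i → *-assoc (ć i) (β i) π) ⟨
        ∑[ i < d ] (ć i * β i * π)       ≡⟨ *-distribʳ-sum π (λ i → ć i * β i) ⟨
        (ć · β) * π                      ∎
      vanish : (c p + ć · β) * π ≡ 0ℚ
      vanish = begin
        (c p + ć · β) * π                          ≡⟨ *-distribʳ-+ π (c p) (ć · β) ⟩
        c p * π + (ć · β) * π                      ≡⟨ cong (λ z → c p * π + z) Σ≡ ⟨
        c p * π + ∑[ i < d ] (ć i * (φ · rest i))  ≡⟨ sum-remove {i = p} (λ i → c i * (φ · v i)) ⟨
        ∑[ i < suc d ] (c i * (φ · v i))           ≡⟨ ·-combine φ c v ⟨
        φ · combine c v                            ≡⟨ sum-cong-≗ (λ x → cong (φ x *_) (u≡ x)) ⟨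
        φ · u                                      ≡⟨ u∈K zero ⟩
        0ℚ                                         ∎
      cp≡ : c p ≡ - (ć · β)
      cp≡ = begin
        c p                                              ≡⟨ *-identityʳ (c p) ⟨
        c p * 1ℚ                                         ≡⟨ cong (c p *_) (*-inverseʳ π) ⟨
        c p * (π * 1/ π)                                 ≡⟨ expand (c p) (ć · β) π (1/ π) ⟩
        (c p + ć · β) * π * 1/ π - (ć · β) * (π * 1/ π)  ≡⟨ cong₂ (λ y z → y * 1/ π - (ć · β) * z) vanish (*-inverseʳ π) ⟩
        0ℚ * 1/ π - (ć · β) * 1ℚ                         ≡⟨ collapse (1/ π) (ć · β) ⟩
        - (ć · β)                                        ∎
        where
        expand : ∀ a b p q → a * (p * q) ≡ (a + b) * p * q - b * (p * q)
        expand = solve 4 (λ a b p q → a :* (p :* q) := (a :+ b) :* p :* q :- b :* (p :* q)) refl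
        collapse : ∀ q b → 0ℚ * q - b * 1ℚ ≡ - b
        collapse = solve 2 (λ q b → con 0ℚ :* q :- b :* con 1ℚ := :- b) refl

    basis′ : IsBasis (Kernel A) v′
    basis′ = record { member = member′ ; independent = independent′ ; spanning = spanning′ }

hasNullity : ∀ {m n} (A : Matrix m n) → ∃[ d ] IsNullity A d
hasNullity {zero} {n} A = n , δ , record
  { member      = λ _ ()
  ; independent = λ c c≡0 i → trans (sym (combine-δ c i)) (c≡0 i)
  ; spanning    = λ u _ → u , λ x → sym (combine-δ u x)
  }
hasNullity {suc m} A with hasNullity (λ i → A (suc i))
... | d , v , basis with any? (λ p → ¬? (A zero · v p ≟ 0ℚ))
... | no ∄p = d , v , record
  { member      = λ { i zero    → decidable-stable (A zero · v i ≟ 0ℚ) (λ ≢0 → ∄p (i , ≢0))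
                    ; i (suc r) → IsBasis.member basis i r }
  ; independent = IsBasis.independent basis
  ; spanning    = λ u u∈K → IsBasis.spanning basis u (λ i → u∈K (suc i))
  }
hasNullity {suc m} A | suc d , v , basis | yes (p , ≢0) =
  d , Pivot.v′ A v basis p ≢0 , Pivot.basis′ A v basis p ≢0

nullity : ∀ {m n} → Matrix m n → ℕ
nullity A = proj₁ (hasNullity A)

nullity-isNullity : ∀ {m n} (A : Matrix m n) → IsNullity A (nullity A)
nullity-isNullity A = proj₂ (hasNullity A)

-- Rank and nullity of an integer matrix do not depend on the field of
-- characteristic 0, so ℚ serves as the field of scalars.
A : (n k : ℕ) → Matrix n n
A n k i j =
  if does (InBand? (toℕ i) (toℕ j)) then 1ℚ else
  if does (InBand? (toℕ j) (toℕ i)) then - 1ℚ else 0ℚ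
  where
  InBand? : ∀ a b → Dec (a ℕ.< b × b ℕ.≤ a ℕ.+ k)
  InBand? a b = a ℕ.<? b ×-dec b ℕ.≤? a ℕ.+ k

period : ℕ → ℕ
period k = k ℕ.* k ℕ.+ k

period-nonZero : ∀ k .{{_ : NonZero k}} → NonZero (period k)
period-nonZero (suc k) = _

-- The nullity of A n′ k for n′ > k depends only on n′ modulo k²+k; N is
-- evaluated at the member of the residue class of n in [k²+k, 2(k²+k)).
representative : (n : ℤ) (k : ℕ) .{{_ : NonZero k}} → ℕ
representative n k = (n %ℕ period k) {{period-nonZero k}} ℕ.+ period k

N : (n : ℤ) (k : ℕ) .{{_ : NonZero k}} → ℕ
N n k = nullity (A (representative n k) k)

record LocalPeak (k : ℕ) .{{_ : NonZero k}} (n : ℤ) : Set where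
  field
    positive    : + 0 ℤ.< n
    belowPeriod : n ℤ.< + period k
    left        : N (n ℤ.- + 1) k ℕ.< N n k
    right       : N (n ℤ.+ + 1) k ℕ.< N n k

-- Vertices are kept as integers so that the integer formula c below can be
-- used directly.
Vertex : ℕ → ℤ → Set
Vertex k a = + 0 ℤ.≤ a × a ℤ.≤ + k

Edge : (n : ℤ) (k : ℕ) .{{_ : NonZero k}} → ℤ → ℤ → Set
Edge n k a b = ∃[ i ] (1 ℕ.≤ i × i ℕ.≤ k
  × a ≡ + ((+ i ℤ.+ n ℤ.- + 2) %ℕ suc k)
  × b ≡ + ((+ i ℤ.+ n ℤ.- + 1) %ℕ k))

-- Only the values γ 0 , … , γ q of the sequence matter.
record IsCycle (n : ℤ) (k : ℕ) .{{_ : NonZero k}} (q : ℕ) (γ : ℕ → ℤ) : Set where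
  field
    nonempty : 1 ℕ.≤ q
    vertices : ∀ r → r ℕ.≤ q → Vertex k (γ r)
    edges    : ∀ r → r ℕ.< q → Edge n k (γ r) (γ (suc r))
    closed   : γ q ≡ γ 0
    simple   : ∀ r s → r ℕ.< q → s ℕ.< q → γ r ≡ γ s → r ≡ s

Traverses : (q : ℕ) (γ : ℕ → ℤ) → ℤ → ℤ → Set
Traverses q γ a b = ∃[ r ] (r ℕ.< q × γ r ≡ a × γ (suc r) ≡ b)

-- Cycles are compared as subgraphs, so the choice of starting vertex is
-- immaterial.
SameCycle : (q : ℕ) (γ γ′ : ℕ → ℤ) → Set
SameCycle q γ γ′ = ∀ a b → Traverses q γ a b ⇔ Traverses q γ′ a b

module _ (k q : ℕ) .{{_ : NonZero q}} where

  f m M : ℕ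
  f = k / q
  m = k ℕ.∸ f ℕ.* q
  M = suc m

  s : (j : ℕ) → ℕ
  s j = length (filter (λ a → (a ℕ.* j) % q ℕ.≤? (M ℕ.* j) % q) (map suc (upTo m)))

  t : (r j : ℕ) → ℕ
  t r j = length (filter (λ a → (a ℕ.* j) % q ℕ.<? (r ℕ.* j) % q) (upTo (suc m)))

  η : (j : ℕ) → ℤ
  η j = + (k ℕ.* ((suc k ℕ.* j) / q)) ℤ.- + k
        ℤ.+ + ((M ℕ.* j) % q ℕ.* f) ℤ.+ + s j

  c : (j w : ℕ) → ℕ → ℤ
  c j w zero = + k ℤ.- + w
  c j w r@(suc _) with r ℕ.≟ q
  ... | yes _ = + k ℤ.- + w
  ... | no  _ = ℤ.- + 1 ℤ.- + w ℤ.+ + ((r ℕ.* j) % q ℕ.* f) ℤ.+ + t r j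

{-# OPTIONS --safe #-}
-- Let S be the sequence of partial sums of a vector u.  Row i of A(n,k) u = 0 reads
-- S(i+k+1) − S(i+1) = S(i) − S(i−k): sums of k consecutive entries of u have period k + 1,
-- and sums of k + 1 consecutive entries have period k.  So u is determined by S(0), …, S(k),
-- which may be any function on the vertices of G(n,k) that is constant along the edges and
-- vanishes on the path beginning at vertex k; N(n,k) is thus the number of cycles of G(n,k).
--
-- Placed on a circle of k + 1 points, the edges of G(n,k) preserve the cyclic order.  Lifted to
-- ℤ, a cycle becomes an increasing sequence V with V(e+q) = V(e) + k in which the successor of
-- place e is place e + J, and all cycles of G(n,k) have the same type (q, J).  Comparing V with
-- the explicit sequence D(e) = f e + Σ_{1≤a≤m} (⌊(e−aJ)/q⌋ − ⌊−aJ/q⌋), whose value at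
-- (k+1)J − q is η, shows V(e) = D(e) + y up to the numbering, with 0 ≤ y < f and
-- y + η − f < n ≤ y + η.
--
-- G(n,k) and G(n±1,k) differ in the source of one edge only, which opens or closes a cycle.
-- At a local peak both circle neighbours of the vertex without outgoing edge lie on cycles,
-- and these two cycles make the bounds on n extreme from either side, so n = η.
module Submission where

-- `G(n,k)` is a partial bijection: vertex `k` alone has no incoming edge, vertex `n − 2` modulo
-- `k + 1` alone has no outgoing one. So it is one path plus disjoint cycles. The obstacle is that
-- the two ends of an edge are reduced by different moduli, `k + 1` and `k`. Lifted to ℤ, both ends
-- become increasing functions of the edge number, and all comparisons of edges become linear
-- inequalities.
--
-- The sequence `D` is forced. In an orbit of type `(q, J)`, numbered so that it crosses 0 at place
-- 0 and `n` at place `E`, the edge equation makes the gap before place `e` equal to the gap before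
-- `e − J`, plus one if `e ≡ J` and minus one if `e ≡ E` modulo `q`. The gaps therefore rise at `J`
-- and stay raised along `2J`, `3J`, ... until `E` is reached. The `q` gaps of a turn add up to
-- `k = f q + m`, so the common value is `f`, exactly `m` places are raised, and `E ≡ (m + 1) J`.
-- What remains free is a vertical shift `y` that moves neither crossing; the gap before each of the
-- two crossings of `D` is `f`, which is why `f` values of `y` are possible.

module Circle where

  open import Data.Empty using (⊥; ⊥-elim)
  open import Data.Fin.Base using (toℕ; fromℕ<)
  import Data.Fin.Properties as Fin
  open import Data.Integer.Base hiding (NonZero; suc; _%_; _/_)
  open import Data.Integer.DivMod using (_/ℕ_; _%ℕ_; a≡a%ℕn+[a/ℕn]*n; n%ℕd<d; [n/ℕd]*d≤n; n<s[n/ℕd]*d)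
  open import Data.Integer.Properties
  open import Data.Integer.Tactic.RingSolver using (solve; solve-∀)
  open import Data.List.Base using (_∷_; [])
  open import Data.Nat.Base as ℕ using (ℕ; zero; suc; NonZero; z≤n; s≤s)
  open import Data.Nat.Divisibility using (divides; _∣_; ∣-antisym)
  open import Data.Nat.DivMod using (m<n⇒m%n≡m; m/n*n≤m; m%n<n; m≥n⇒m/n>0; m%n≡m∸m/n*n)
  open import Data.Nat.GCD using (gcd; gcd-GCD; gcd[m,n]∣m; gcd[m,n]∣n; module Bézout)
  import Data.Nat.Properties as ℕ
  open import Data.Product.Base using (Σ-syntax; ∃-syntax; _×_; _,_; proj₁; proj₂)
  open import Data.Sum.Base using (_⊎_; inj₁; inj₂)
  import Defs
  open import Relation.Binary.PropositionalEquality
  open import Relation.Nullary.Decidable using (yes; no)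

  -- Linear inequalities over the integers

  -- Inequalities are derived Farkas style: the difference of the two sides of
  -- the goal is shown to be a sum of differences known to be nonnegative.
  infixl 6 _⊕_

  _⊕_ : ∀ {a b} → 0ℤ ≤ a → 0ℤ ≤ b → 0ℤ ≤ a + b
  _⊕_ = +-mono-≤

  ⟨_⟩ : ∀ {a b} → a ≤ b → 0ℤ ≤ b - a
  ⟨_⟩ = i≤j⇒0≤j-i

  infixr 7 _⊛_

  _⊛_ : ∀ {a} n → 0ℤ ≤ a → 0ℤ ≤ + n * a
  n ⊛ a≥0 = subst (_≤ + n * _) (*-zeroʳ (+ n)) (*-monoˡ-≤-nonNeg (+ n) a≥0)

  infix 4 _∴_

  _∴_ : ∀ {a b c} → 0ℤ ≤ c → b - a ≡ c → a ≤ b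
  c≥0 ∴ eq = 0≤i-j⇒j≤i (subst (0ℤ ≤_) (sym eq) c≥0)

  linear-⊥ : ∀ {c} → 0ℤ ≤ c → c ≡ -1ℤ → ⊥
  linear-⊥ c≥0 refl with c≥0
  ... | ()

  ≤⊎> : ∀ a b → a ≤ b ⊎ 1ℤ + b ≤ a
  ≤⊎> a b with ≤-total a b
  ... | inj₁ a≤b = inj₁ a≤b
  ... | inj₂ b≤a with b ≟ a
  ...   | yes refl = inj₁ ≤-refl

  ...   | no b≢a = inj₂ (i<j⇒suc[i]≤j (≤∧≢⇒< b≤a b≢a))



  -- Floor division and residues

  /ℕ-upper : ∀ a d .{{_ : NonZero d}} → 1ℤ + a ≤ (a /ℕ d) * + d + + d
  /ℕ-upper a d = subst (1ℤ + a ≤_) (expand (a /ℕ d) (+ d)) (i<j⇒suc[i]≤j (n<s[n/ℕd]*d a d))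
    where
    expand : ∀ z κ → (1ℤ + z) * κ ≡ z * κ + κ
    expand = solve-∀

  /ℕ-≥ : ∀ {a d z} .{{_ : NonZero d}} → z * + d ≤ a → z ≤ a /ℕ d
  /ℕ-≥ {a} {d} {z} zd≤a with ≤⊎> z (a /ℕ d)
  ... | inj₁ z≤ = z≤
  ... | inj₂ >z = ⊥-elim (impossible a (+ d) (a /ℕ d) z zd≤a (*-monoʳ-≤-nonNeg (+ d) >z) (/ℕ-upper a d))
    where
    impossible : ∀ a κ g z → z * κ ≤ a → (1ℤ + g) * κ ≤ z * κ → 1ℤ + a ≤ g * κ + κ → ⊥
    impossible a κ g z h₁ h₂ h₃ =
      linear-⊥ (⟨ h₁ ⟩ ⊕ ⟨ h₂ ⟩ ⊕ ⟨ h₃ ⟩) (solve (a ∷ κ ∷ g ∷ z ∷ []))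

  /ℕ-≤ : ∀ {a d z} .{{_ : NonZero d}} → 1ℤ + a ≤ z * + d + + d → a /ℕ d ≤ z
  /ℕ-≤ {a} {d} {z} a<zd+d with ≤⊎> (a /ℕ d) z
  ... | inj₁ ≤z = ≤z
  ... | inj₂ z< = ⊥-elim (impossible a (+ d) (a /ℕ d) z a<zd+d (*-monoʳ-≤-nonNeg (+ d) z<) ([n/ℕd]*d≤n a d))
    where
    impossible : ∀ a κ g z → 1ℤ + a ≤ z * κ + κ → (1ℤ + z) * κ ≤ g * κ → g * κ ≤ a → ⊥
    impossible a κ g z h₁ h₂ h₃ =
      linear-⊥ (⟨ h₁ ⟩ ⊕ ⟨ h₂ ⟩ ⊕ ⟨ h₃ ⟩) (solve (a ∷ κ ∷ g ∷ z ∷ []))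

  /ℕ-unique : ∀ {a d z} .{{_ : NonZero d}} → z * + d ≤ a → 1ℤ + a ≤ z * + d + + d → a /ℕ d ≡ z
  /ℕ-unique {a} lower upper = ≤-antisym (/ℕ-≤ {a} upper) (/ℕ-≥ {a} lower)

  /ℕ-shift : ∀ a z d .{{_ : NonZero d}} → (a + z * + d) /ℕ d ≡ a /ℕ d + z
  /ℕ-shift a z d = /ℕ-unique (lower a (+ d) (a /ℕ d) z ([n/ℕd]*d≤n a d))
      (upper a (+ d) (a /ℕ d) z (/ℕ-upper a d))
    where
    lower : ∀ a κ g z → g * κ ≤ a → (g + z) * κ ≤ a + z * κ
    lower a κ g z h = ⟨ h ⟩ ∴ solve (a ∷ κ ∷ g ∷ z ∷ [])
    upper : ∀ a κ g z → 1ℤ + a ≤ g * κ + κ → 1ℤ + (a + z * κ) ≤ (g + z) * κ + κ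
    upper a κ g z h = ⟨ h ⟩ ∴ solve (a ∷ κ ∷ g ∷ z ∷ [])

  /ℕ-mono : ∀ {a b} d .{{_ : NonZero d}} → a ≤ b → a /ℕ d ≤ b /ℕ d
  /ℕ-mono d a≤b = /ℕ-≥ (≤-trans ([n/ℕd]*d≤n _ d) a≤b)

  %ℕ-def : ∀ a d .{{_ : NonZero d}} → + (a %ℕ d) ≡ a - (a /ℕ d) * + d
  %ℕ-def a d = trans (undo (+ (a %ℕ d)) (a /ℕ d) (+ d)) (cong (_- (a /ℕ d) * + d) (sym (a≡a%ℕn+[a/ℕn]*n a d)))
    where
    undo : ∀ r g κ → r ≡ r + g * κ - g * κ
    undo = solve-∀

  %ℕ-shift : ∀ a z d .{{_ : NonZero d}} → (a + z * + d) %ℕ d ≡ a %ℕ d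
  %ℕ-shift a z d = +-injective (begin
    + ((a + z * + d) %ℕ d)                          ≡⟨ %ℕ-def (a + z * + d) d ⟩
    a + z * + d - ((a + z * + d) /ℕ d) * + d        ≡⟨ cong (λ g → a + z * + d - g * + d) (/ℕ-shift a z d) ⟩
    a + z * + d - (a /ℕ d + z) * + d                ≡⟨ cancel a z (+ d) (a /ℕ d) ⟩
    a - (a /ℕ d) * + d                              ≡⟨ %ℕ-def a d ⟨
    + (a %ℕ d)                                      ∎)
    where
    open ≡-Reasoning
    cancel : ∀ a z κ g → a + z * κ - (g + z) * κ ≡ a - g * κ
    cancel = solve-∀

  %ℕ-≡⇒ : ∀ a b d .{{_ : NonZero d}} → a %ℕ d ≡ b %ℕ d → ∃[ z ] a ≡ b + z * + d
  %ℕ-≡⇒ a b d eq = a /ℕ d - b /ℕ d , (begin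
    a                                                       ≡⟨ a≡a%ℕn+[a/ℕn]*n a d ⟩
    + (a %ℕ d) + (a /ℕ d) * + d                             ≡⟨ cong (λ r → + r + (a /ℕ d) * + d) eq ⟩
    + (b %ℕ d) + (a /ℕ d) * + d                             ≡⟨ regroup (+ (b %ℕ d)) (a /ℕ d) (b /ℕ d) (+ d) ⟩
    + (b %ℕ d) + (b /ℕ d) * + d + (a /ℕ d - b /ℕ d) * + d   ≡⟨ cong (_+ (a /ℕ d - b /ℕ d) * + d)
        (a≡a%ℕn+[a/ℕn]*n b d) ⟨
    b + (a /ℕ d - b /ℕ d) * + d                             ∎)
    where
    open ≡-Reasoning
    regroup : ∀ r g h κ → r + g * κ ≡ r + h * κ + (g - h) * κ
    regroup = solve-∀

  i≤∣i∣ : ∀ i → i ≤ + ∣ i ∣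
  i≤∣i∣ (+ n)    = ≤-refl
  i≤∣i∣ -[1+ n ] = -≤+

  -- The inequality c + a ≤ b reads a ≤ b for slack 0 and a < b for slack 1.
  Slack : ℤ → Set
  Slack c = c ≡ 0ℤ ⊎ c ≡ 1ℤ

  slack-≥0 : ∀ {c} → Slack c → 0ℤ ≤ c
  slack-≥0 (inj₁ refl) = +≤+ z≤n
  slack-≥0 (inj₂ refl) = +≤+ z≤n

  slack-*-cancel : ∀ {c} → Slack c → ∀ a b d .{{_ : NonZero d}} → c + a * + d ≤ b * + d → c + a ≤ b
  slack-*-cancel (inj₁ refl) a b d@(suc _) h =
    subst (_≤ b) (sym (+-identityˡ a))
        (*-cancelʳ-≤-pos a b (+ d) (subst (_≤ b * + d) (+-identityˡ (a * + d)) h))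
  slack-*-cancel (inj₂ refl) a b d h = i<j⇒suc[i]≤j {a} (*-cancelʳ-<-nonNeg {a} (+ d) (suc[i]≤j⇒i<j h))

  -- Increasing maps of circles and the places where they cross a value

  -- A lift of a strictly increasing map ℤ/p → ℤ/d of circles.
  record Lift (p d : ℕ) (V : ℤ → ℤ) : Set where
    field
      strict : ∀ {a b} → 1ℤ + a ≤ b → 1ℤ + V a ≤ V b
      shift  : ∀ a z → V (a + z * + p) ≡ V a + z * + d

    mono : ∀ {a b} → a ≤ b → V a ≤ V b
    mono {a} {b} a≤b with ≤⊎> b a
    ... | inj₁ b≤a = ≤-reflexive (cong V (≤-antisym a≤b b≤a))
    ... | inj₂ a<b = ≤-trans (i≤suc[i] (V a)) (strict a<b)

    cancel-≤ : ∀ {a b} → V a ≤ V b → a ≤ b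
    cancel-≤ {a} {b} h with ≤⊎> a b
    ... | inj₁ a≤b = a≤b
    ... | inj₂ b<a = ⊥-elim (<⇒≱ (suc[i]≤j⇒i<j (strict b<a)) h)

    cancel-< : ∀ {a b} → 1ℤ + V a ≤ V b → 1ℤ + a ≤ b
    cancel-< {a} {b} h with ≤⊎> b a
    ... | inj₁ b≤a = ⊥-elim (<⇒≱ (suc[i]≤j⇒i<j h) (mono b≤a))
    ... | inj₂ a<b = a<b

    injective : ∀ {a b} → V a ≡ V b → a ≡ b
    injective eq = ≤-antisym (cancel-≤ (≤-reflexive eq)) (cancel-≤ (≤-reflexive (sym eq)))

    slack-mono : ∀ {c a b} → Slack c → c + a ≤ b → c + V a ≤ V b
    slack-mono (inj₁ refl) h = subst (_≤ _) (sym (+-identityˡ _)) (mono (subst (_≤ _) (+-identityˡ _) h))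
    slack-mono (inj₂ refl) h = strict h

    slack-cancel : ∀ {c a b} → Slack c → c + V a ≤ V b → c + a ≤ b
    slack-cancel (inj₁ refl) h = subst (_≤ _) (sym (+-identityˡ _)) (cancel-≤ (subst (_≤ _) (+-identityˡ _) h))
    slack-cancel (inj₂ refl) h = cancel-< h

    expanding : ∀ a n → V a + + n ≤ V (a + + n)
    expanding a zero    = ≤-reflexive (trans (+-identityʳ (V a)) (cong V (sym (+-identityʳ a))))
    expanding a (suc n) = step (V a) (+ n) (V (a + + n)) (V (a + + suc n)) (expanding a n)
                            (strict (≤-reflexive (next a (+ n))))
      where
      next : ∀ a n → 1ℤ + (a + n) ≡ a + (1ℤ + n)
      next = solve-∀
      step : ∀ v n w x → v + n ≤ w → 1ℤ + w ≤ x → v + (1ℤ + n) ≤ x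
      step v n w x h₁ h₂ = ⟨ h₁ ⟩ ⊕ ⟨ h₂ ⟩ ∴ solve (v ∷ n ∷ w ∷ x ∷ [])

  record Crossing (V : ℤ → ℤ) (c E : ℤ) : Set where
    field
      above : ∀ {e} → E ≤ e → c ≤ V e
      below : ∀ {e} → 1ℤ + e ≤ E → 1ℤ + V e ≤ c

  module _ {p d : ℕ} {V : ℤ → ℤ} (L : Lift p d V) where
    open Lift L

    crossing-at : ∀ {c E} → c ≤ V E → 1ℤ + V (-1ℤ + E) ≤ c → Crossing V c E
    crossing-at {c} {E} at before = record
      { above = λ E≤e → ≤-trans at (mono E≤e)
      ; below = λ {e} e<E → ≤-trans (+-monoʳ-≤ 1ℤ (mono (pred-≤ e E e<E))) before
      }
      where
      pred-≤ : ∀ e E → 1ℤ + e ≤ E → e ≤ -1ℤ + E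
      pred-≤ e E h = ⟨ h ⟩ ∴ solve (e ∷ E ∷ [])

    private
      search : ∀ c a n → 1ℤ + V a ≤ c → c ≤ V (a + + n) → ∃[ E ] Crossing V c E
      search c a zero    lo hi =
        ⊥-elim (<⇒≱ (suc[i]≤j⇒i<j lo) (subst (λ x → c ≤ V x) (+-identityʳ a) hi))
      search c a (suc n) lo hi with ≤⊎> c (V (1ℤ + a))
      ... | inj₁ at = 1ℤ + a , crossing-at at (subst (λ x → 1ℤ + V x ≤ c) (sym (pred-suc a)) lo)
      ... | inj₂ lo′ = search c (1ℤ + a) n lo′ (subst (λ x → c ≤ V x) (next a (+ n)) hi)
        where
        next : ∀ a n → a + (1ℤ + n) ≡ 1ℤ + a + n
        next = solve-∀

    -- `V` gains at least one per place, so it passes `c` within a window around 0 whose half-width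
    -- exceeds the distance from `V 0ℤ` to `c`.
    crossing : ∀ c → ∃[ E ] Crossing V c E
    crossing c = search c (0ℤ - + N) (N ℕ.+ N)
      (lo c (V 0ℤ) (+ N′) (V (0ℤ - + N)) (≤-trans (i≤∣i∣ (V 0ℤ - c)) (+≤+ (ℕ.m≤n+m _ _)))
        (subst (λ x → V (0ℤ - + N) + + N ≤ V x) (back (+ N)) (expanding (0ℤ - + N) N)))
      (hi c (V 0ℤ) (+ N′) (V (0ℤ - + N + + (N ℕ.+ N))) (≤-trans (i≤∣i∣ (c - V 0ℤ)) (+≤+ (ℕ.m≤m+n _ _)))
        (subst (λ x → V 0ℤ + + N ≤ V x) (forth (+ N)) (expanding 0ℤ N)))
      where
      N′ N : ℕ
      N′ = ∣ c - V 0ℤ ∣ ℕ.+ ∣ V 0ℤ - c ∣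
      N = suc N′
      back : ∀ n → 0ℤ - n + n ≡ 0ℤ
      back = solve-∀
      forth : ∀ n → 0ℤ + n ≡ 0ℤ - n + (n + n)
      forth = solve-∀
      lo : ∀ c v n w → v - c ≤ n → w + (1ℤ + n) ≤ v → 1ℤ + w ≤ c
      lo c v n w h₁ h₂ = ⟨ h₁ ⟩ ⊕ ⟨ h₂ ⟩ ∴ solve (c ∷ v ∷ n ∷ w ∷ [])
      hi : ∀ c v n w → c - v ≤ n → v + (1ℤ + n) ≤ w → c ≤ w
      hi c v n w h₁ h₂ = ⟨ h₁ ⟩ ⊕ ⟨ h₂ ⟩ ⊕ +≤+ {0} {1} z≤n ∴ solve (c ∷ v ∷ n ∷ w ∷ [])

    -- By equivariance `V` crosses `c + z d` at `E + z p`, so counting turns among values is the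
    -- same as counting turns among places. This is what removes the unknown `V` from under the
    -- floors of the edge equation.
    crossing-/ℕ : .{{_ : NonZero p}} .{{_ : NonZero d}} → ∀ {c E} → Crossing V c E →
                  ∀ e → (V e - c) /ℕ d ≡ (e - E) /ℕ p
    crossing-/ℕ {c} {E} cr e = /ℕ-unique {V e - c} {d}
      (lower c (V e) (g * + d) (subst (c ≤_) (loEq (V e) g (+ d))
          (subst (c ≤_) (shift e (- g)) (above (eLower e E g (+ p) ([n/ℕd]*d≤n (e - E) p))))))
      (upper c (V e) (g * + d) (+ d)
          (subst (λ x → 1ℤ + x ≤ c) (upEq (V e) g (+ d)) (subst (λ x → 1ℤ + x ≤ c) (shift e (- (1ℤ + g)))
        (below (eUpper e E g (+ p) (/ℕ-upper (e - E) p))))))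
      where
      open Crossing cr
      g : ℤ
      g = (e - E) /ℕ p
      eLower : ∀ e E g κ → g * κ ≤ e - E → E ≤ e + (- g) * κ
      eLower e E g κ h = ⟨ h ⟩ ∴ solve (e ∷ E ∷ g ∷ κ ∷ [])
      loEq : ∀ v g κ → v + (- g) * κ ≡ v - g * κ
      loEq = solve-∀
      eUpper : ∀ e E g κ → 1ℤ + (e - E) ≤ g * κ + κ → 1ℤ + (e + (- (1ℤ + g)) * κ) ≤ E
      eUpper e E g κ h = ⟨ h ⟩ ∴ solve (e ∷ E ∷ g ∷ κ ∷ [])
      lower : ∀ c v z → c ≤ v - z → z ≤ v - c
      lower c v z h = ⟨ h ⟩ ∴ solve (c ∷ v ∷ z ∷ [])
      upEq : ∀ v g κ → v + (- (1ℤ + g)) * κ ≡ v - g * κ - κ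
      upEq = solve-∀
      upper : ∀ c v z κ → 1ℤ + (v - z - κ) ≤ c → 1ℤ + (v - c) ≤ z + κ
      upper c v z κ h = ⟨ h ⟩ ∴ solve (c ∷ v ∷ z ∷ κ ∷ [])

  -- Bézout coefficients and lowest terms

  bézout : ∀ m n → ∃[ u ] ∃[ w ] u * + m + w * + n ≡ + gcd m n
  bézout m n with Bézout.identity (gcd-GCD m n)
  ... | Bézout.+- x y eq = + x , - + y , (begin
    + x * + m + (- + y) * + n                  ≡⟨ cong (_+ (- + y) * + n)
        (trans (sym (pos-* x m)) (trans (cong +_ (sym eq)) (pos-+ d (y ℕ.* n)))) ⟩
    + d + + (y ℕ.* n) + (- + y) * + n          ≡⟨ cong (λ z → + d + z + (- + y) * + n) (pos-* y n) ⟩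
    + d + + y * + n + (- + y) * + n            ≡⟨ cancel (+ d) (+ y) (+ n) ⟩
    + d                                        ∎)
    where
    open ≡-Reasoning
    d = gcd m n
    cancel : ∀ d y n → d + y * n + (- y) * n ≡ d
    cancel = solve-∀
  ... | Bézout.-+ x y eq = - + x , + y , (begin
    (- + x) * + m + + y * + n                  ≡⟨ cong (λ z → (- + x) * + m + z)
        (trans (sym (pos-* y n)) (trans (cong +_ (sym eq)) (pos-+ d (x ℕ.* m)))) ⟩
    (- + x) * + m + (+ d + + (x ℕ.* m))        ≡⟨ cong (λ z → (- + x) * + m + (+ d + z)) (pos-* x m) ⟩
    (- + x) * + m + (+ d + + x * + m)          ≡⟨ cancel (+ d) (+ x) (+ m) ⟩
    + d                                        ∎)
    where
    open ≡-Reasoning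
    d = gcd m n
    cancel : ∀ d x m → (- x) * m + (d + x * m) ≡ d
    cancel = solve-∀

  -- Coprimality for an integer `J`, with the coefficients kept: they write every place as a
  -- combination of `J`-steps and turns.
  Unimodular : ℤ → ℕ → Set
  Unimodular J q = ∃[ u ] ∃[ w ] u * J + w * + q ≡ 1ℤ

  unimodular-neg : ∀ {J q} → Unimodular J q → Unimodular (- J) q
  unimodular-neg {J} {q} (u , w , eq) = - u , w , trans (negs u J (w * + q)) eq
    where
    negs : ∀ u J x → (- u) * (- J) + x ≡ u * J + x
    negs = solve-∀

  -- Meant for the quotient of turns by steps of a closed walk; its reduced form `J / q` is the
  -- rotation number, even if the walk runs through its cycle several times.
  lowest-terms : ∀ ζ p .{{_ : NonZero p}} →
    ∃[ J ] ∃[ q ] ∃[ d ] NonZero q × NonZero d × ζ ≡ J * + d × + p ≡ + q * + d × Unimodular J q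
  lowest-terms ζ p@(suc _) with gcd ∣ ζ ∣ p | gcd[m,n]∣m ∣ ζ ∣ p | gcd[m,n]∣n ∣ ζ ∣ p | bézout ∣ ζ ∣ p
  ... | zero  | _ | divides q eq | _ = ⊥-elim (absurd (trans eq (ℕ.*-zeroʳ q)))
    where
    absurd : p ≡ 0 → ⊥
    absurd ()
  ... | suc d′ | divides _ _ | divides zero () | _
  ... | suc d′ | divides a ∣ζ∣≡ | divides q@(suc _) p≡ | u , w , eq with ζ
  ...   | + n = + a , q , d , _ , _ , trans (cong +_ ∣ζ∣≡) (pos-* a d) , trans (cong +_ p≡) (pos-* q d) ,
        u , w , *-cancelʳ-≡ _ 1ℤ (+ d) (begin
          (u * + a + w * + q) * + d            ≡⟨ distr u (+ a) w (+ q) (+ d) ⟩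
          u * (+ a * + d) + w * (+ q * + d)    ≡⟨ cong₂ (λ x y → u * x + w * y) (pos-* a d) (pos-* q d) ⟨
          u * + (a ℕ.* d) + w * + (q ℕ.* d)    ≡⟨ cong₂ (λ x y → u * + x + w * + y) ∣ζ∣≡ p≡ ⟨
          u * + n + w * + p                    ≡⟨ eq ⟩
          + d                                  ≡⟨ *-identityˡ (+ d) ⟨
          1ℤ * + d                             ∎)
    where
    open ≡-Reasoning
    d : ℕ
    d = suc d′
    distr : ∀ u a w q d → (u * a + w * q) * d ≡ u * (a * d) + w * (q * d)
    distr = solve-∀
  ...   | -[1+ n ] = - + a , q , d , _ , _ ,
        trans (cong -_ (trans (cong +_ ∣ζ∣≡) (pos-* a d))) (neg-distribˡ-* (+ a) (+ d)) , trans (cong +_ p≡)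
            (pos-* q d) ,
        - u , w , *-cancelʳ-≡ _ 1ℤ (+ d) (begin
          ((- u) * (- + a) + w * + q) * + d    ≡⟨ distr u (+ a) w (+ q) (+ d) ⟩
          u * (+ a * + d) + w * (+ q * + d)    ≡⟨ cong₂ (λ x y → u * x + w * y) (pos-* a d) (pos-* q d) ⟨
          u * + (a ℕ.* d) + w * + (q ℕ.* d)    ≡⟨ cong₂ (λ x y → u * + x + w * + y) ∣ζ∣≡ p≡ ⟨
          u * + suc n + w * + p                ≡⟨ eq ⟩
          + d                                  ≡⟨ *-identityˡ (+ d) ⟨
          1ℤ * + d                             ∎)
    where
    open ≡-Reasoning
    d : ℕ
    d = suc d′
    distr : ∀ u a w q d → ((- u) * (- a) + w * q) * d ≡ u * (a * d) + w * (q * d)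
    distr = solve-∀

  -- The graph `G(n,k)` unrolled on the line

  -- The edges of G(n,k), indexed by ℤ: edge v runs from position X n v to
  -- position Y v, where position P stands for the vertex P − 1 modulo k + 1.
  -- The edge i of the paper is v = i + n − 1, and v + k is the same edge as v.
  module Dynamics (k : ℕ) .{{k≢0 : NonZero k}} where

    -- A turn has `k` edges but `k + 1` positions, so each end of the edges skips one position per
    -- turn; the floors count the skips. Sources skip `n − 1`, the hole, and targets skip 0, which
    -- is vertex `k`.
    X : ℤ → ℤ → ℤ
    X n v = v + (v - n) /ℕ k

    Y : ℤ → ℤ
    Y v = 1ℤ + v + v /ℕ k

    X-lift : ∀ n → Lift k (suc k) (X n)
    X-lift n = record
      { strict = λ {a} {b} a<b → step a b ((a - n) /ℕ k) ((b - n) /ℕ k) a<b (/ℕ-mono k (drop a b n a<b))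
      ; shift  = λ a z → trans (cong (λ g → a + z * + k + g)
          (trans (cong (_/ℕ k) (swap a (z * + k) n)) (/ℕ-shift (a - n) z k)))
                               (collect a z (+ k) ((a - n) /ℕ k))
      }
      where
      step : ∀ a b g h → 1ℤ + a ≤ b → g ≤ h → 1ℤ + (a + g) ≤ b + h
      step a b g h h₁ h₂ = ⟨ h₁ ⟩ ⊕ ⟨ h₂ ⟩ ∴ solve (a ∷ b ∷ g ∷ h ∷ [])
      drop : ∀ a b n → 1ℤ + a ≤ b → a - n ≤ b - n
      drop a b n h = ⟨ h ⟩ ⊕ +≤+ {0} {1} z≤n ∴ solve (a ∷ b ∷ n ∷ [])
      swap : ∀ a x n → a + x - n ≡ a - n + x
      swap = solve-∀
      collect : ∀ a z κ g → a + z * κ + (g + z) ≡ a + g + z * (1ℤ + κ)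
      collect = solve-∀

    Y-lift : Lift k (suc k) Y
    Y-lift = record
      { strict = λ {a} {b} a<b → step a b (a /ℕ k) (b /ℕ k) a<b (/ℕ-mono k (drop a b a<b))
      ; shift  = λ a z → trans (cong (λ g → 1ℤ + (a + z * + k) + g) (/ℕ-shift a z k))
          (collect a z (+ k) (a /ℕ k))
      }
      where
      step : ∀ a b g h → 1ℤ + a ≤ b → g ≤ h → 1ℤ + (1ℤ + a + g) ≤ 1ℤ + b + h
      step a b g h h₁ h₂ = ⟨ h₁ ⟩ ⊕ ⟨ h₂ ⟩ ∴ solve (a ∷ b ∷ g ∷ h ∷ [])
      drop : ∀ a b → 1ℤ + a ≤ b → a ≤ b
      drop a b h = ⟨ h ⟩ ⊕ +≤+ {0} {1} z≤n ∴ solve (a ∷ b ∷ [])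
      collect : ∀ a z κ g → 1ℤ + (a + z * κ) + (g + z) ≡ 1ℤ + a + g + z * (1ℤ + κ)
      collect = solve-∀

    module X n = Lift (X-lift n)
    module Y = Lift Y-lift

    0/ℕk : 0ℤ /ℕ k ≡ 0ℤ
    0/ℕk = /ℕ-unique {0ℤ} {k} {0ℤ} ≤-refl (subst (1ℤ ≤_) (sym (+-identityˡ (+ k))) (+≤+ (ℕ.>-nonZero⁻¹ k)))

    -1/ℕk : -1ℤ /ℕ k ≡ -1ℤ
    -1/ℕk = /ℕ-unique { -1ℤ} {k} { -1ℤ} (lower (+ k) (+≤+ (ℕ.>-nonZero⁻¹ k))) (≤-reflexive (upper (+ k)))
      where
      lower : ∀ κ → 1ℤ ≤ κ → -1ℤ * κ ≤ -1ℤ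
      lower κ h = ⟨ h ⟩ ∴ solve (κ ∷ [])
      upper : ∀ κ → 0ℤ ≡ -1ℤ * κ + κ
      upper = solve-∀

    X-at : ∀ n → X n n ≡ n
    X-at n = trans (cong (λ z → n + z /ℕ k) (+-inverseʳ n)) (trans (cong (λ z → n + z) 0/ℕk) (+-identityʳ n))

    X-before : ∀ n → X n (-1ℤ + n) ≡ - + 2 + n
    X-before n = trans (cong (λ z → -1ℤ + n + z /ℕ k) (cancel n))
        (trans (cong (λ z → -1ℤ + n + z) -1/ℕk) (collect n))
      where
      cancel : ∀ n → -1ℤ + n - n ≡ -1ℤ
      cancel = solve-∀
      collect : ∀ n → -1ℤ + n + -1ℤ ≡ - + 2 + n
      collect = solve-∀

    private
      between : ∀ {a b c d} → a ≡ - + 2 + b → c ≡ -1ℤ + b → d ≡ b → 1ℤ + a ≤ c × 1ℤ + c ≤ d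
      between {b = b} refl refl refl = ≤-reflexive (eq₁ b) , ≤-reflexive (eq₂ b)
        where
        eq₁ : ∀ b → 1ℤ + (- + 2 + b) ≡ -1ℤ + b
        eq₁ = solve-∀
        eq₂ : ∀ b → 1ℤ + (-1ℤ + b) ≡ b
        eq₂ = solve-∀

      squeezed : ∀ a b c → 1ℤ + (-1ℤ + a + c) ≤ b → 1ℤ + b ≤ a + c → ⊥
      squeezed a b c h₁ h₂ = linear-⊥ (⟨ h₁ ⟩ ⊕ ⟨ h₂ ⟩) (solve (a ∷ b ∷ c ∷ []))

    -- The consecutive edges `n − 1` and `n` leave positions `n − 2` and `n`, and `X` is strictly
    -- increasing, so nothing leaves from between.
    X-misses-hole : ∀ n v z → X n v ≢ -1ℤ + n + z * + suc k
    X-misses-hole n v z eq = squeezed n v (z * + k) (X.cancel-< n { -1ℤ + n + z * + k} {v} (proj₁ bounds))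
        (X.cancel-< n {v} {n + z * + k} (proj₂ bounds))
      where
      bounds = between {b = n + z * + suc k}
        (trans (X.shift n (-1ℤ + n) z) (trans (cong (_+ z * + suc k) (X-before n)) (+-assoc (- + 2) n _)))
        (trans eq (+-assoc -1ℤ n _)) (trans (X.shift n n z) (cong (_+ z * + suc k) (X-at n)))

    Y-misses-start : ∀ v z → Y v ≢ z * + suc k
    Y-misses-start v z eq = squeezed 0ℤ v (z * + k) (Y.cancel-< { -1ℤ + z * + k} {v} (proj₁ bounds))
        (Y.cancel-< {v} {0ℤ + z * + k} (proj₂ bounds))
      where
      fold : ∀ s → 0ℤ - 1ℤ + s ≡ - + 2 + (1ℤ + s)
      fold = solve-∀
      fold′ : ∀ s → s ≡ -1ℤ + (1ℤ + s)
      fold′ = solve-∀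
      bounds = between {b = 1ℤ + z * + suc k}
        (trans (Y.shift -1ℤ z) (trans (cong (λ g → 0ℤ + g + z * + suc k) -1/ℕk) (fold (z * + suc k))))
        (trans eq (fold′ (z * + suc k))) (trans (Y.shift 0ℤ z) (cong (λ g → 1ℤ + g + z * + suc k) 0/ℕk))

    -- The edge into a position; meaningful unless the position is divisible by k + 1.
    into : ℤ → ℤ
    into P = P - 1ℤ - P /ℕ suc k

    OffStart : ℤ → Set
    OffStart P = P %ℕ suc k ≢ 0

    Y-into : ∀ P → OffStart P → Y (into P) ≡ P
    Y-into P off = trans (cong (λ z → 1ℤ + into P + z) quotient) (regroup P (P /ℕ suc k))
      where
      g r : ℤ
      g = P /ℕ suc k
      r = + (P %ℕ suc k)
      P≡ : P ≡ r + g * + suc k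
      P≡ = a≡a%ℕn+[a/ℕn]*n P (suc k)
      into≡ : into P ≡ r + g * (1ℤ + + k) - 1ℤ - g
      into≡ = cong (λ p → p - 1ℤ - g) P≡
      lower : ∀ r g κ → 1ℤ ≤ r → g * κ ≤ r + g * (1ℤ + κ) - 1ℤ - g
      lower r g κ h = ⟨ h ⟩ ∴ solve (r ∷ g ∷ κ ∷ [])
      upper : ∀ r g κ → 1ℤ + r ≤ 1ℤ + κ → 1ℤ + (r + g * (1ℤ + κ) - 1ℤ - g) ≤ g * κ + κ
      upper r g κ h = ⟨ h ⟩ ∴ solve (r ∷ g ∷ κ ∷ [])
      quotient : into P /ℕ k ≡ g
      quotient = trans (cong (_/ℕ k) into≡) (/ℕ-unique {r + g * (1ℤ + + k) - 1ℤ - g} {k}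
        (lower r g (+ k) (+≤+ (ℕ.n≢0⇒n>0 off))) (upper r g (+ k) (+≤+ (n%ℕd<d P (suc k)))))
      regroup : ∀ P g → 1ℤ + (P - 1ℤ - g) + g ≡ P
      regroup = solve-∀

    into-shift : ∀ P z → into (P + z * + suc k) ≡ into P + z * + k
    into-shift P z = trans (cong (λ g → P + z * + suc k - 1ℤ - g) (/ℕ-shift P z (suc k)))
        (collect P z (+ k) (P /ℕ suc k))
      where
      collect : ∀ P z κ g → P + z * (1ℤ + κ) - 1ℤ - (g + z) ≡ P - 1ℤ - g + z * κ
      collect = solve-∀

    module _ (n : ℤ) where

      -- The positions lying on the path of G(n,k) that begins at vertex k.
      data Path : ℤ → Set where
        start : ∀ z → Path (z * + suc k)
        step  : ∀ v → Path (X n v) → Path (Y v)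

      back : ℕ → ℤ → ℤ
      back zero    P = P
      back (suc i) P = back i (X n (into P))

      back-+ : ∀ i j P → back (i ℕ.+ j) P ≡ back j (back i P)
      back-+ zero    j P = refl
      back-+ (suc i) j P = back-+ i j (X n (into P))

      back-shift : ∀ i P z → back i (P + z * + suc k) ≡ back i P + z * + suc k
      back-shift zero    P z = refl
      back-shift (suc i) P z = trans
          (cong (back i) (trans (cong (X n) (into-shift P z)) (X.shift n (into P) z)))
                                     (back-shift i (X n (into P)) z)

      trace : ∀ i P → Path P ⊎ (∀ j → j ℕ.< i → OffStart (back j P))
      trace zero    P = inj₂ λ _ ()
      trace (suc i) P with P %ℕ suc k ℕ.≟ 0
      ... | yes on = inj₁ (subst Path (sym P≡) (start (P /ℕ suc k)))
        where
        P≡ : P ≡ (P /ℕ suc k) * + suc k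
        P≡ = trans (a≡a%ℕn+[a/ℕn]*n P (suc k))
            (trans (cong (λ r → + r + (P /ℕ suc k) * + suc k) on) (+-identityˡ _))
      ... | no off with trace i (X n (into P))
      ...   | inj₁ path = inj₁ (subst Path (Y-into P off) (step (into P) path))
      ...   | inj₂ offs = inj₂ λ { zero _ → off ; (suc j) (s≤s j<i) → offs j j<i }

      back-injective : ∀ i P Q z → (∀ j → j ℕ.< i → OffStart (back j P)) →
          (∀ j → j ℕ.< i → OffStart (back j Q)) →
                       back i P ≡ back i Q + z * + suc k → P ≡ Q + z * + suc k
      back-injective zero    P Q z _ _ eq = eq
      back-injective (suc i) P Q z offP offQ eq = begin
        P                          ≡⟨ Y-into P (offP 0 (s≤s z≤n)) ⟨
        Y (into P)                 ≡⟨ cong Y into-eq ⟩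
        Y (into Q + z * + k)       ≡⟨ Y.shift (into Q) z ⟩
        Y (into Q) + z * + suc k   ≡⟨ cong (_+ z * + suc k) (Y-into Q (offQ 0 (s≤s z≤n))) ⟩
        Q + z * + suc k            ∎
        where
        open ≡-Reasoning
        into-eq : into P ≡ into Q + z * + k
        into-eq = X.injective n (trans
          (back-injective i _ _ z (λ j j<i → offP (suc j) (s≤s j<i)) (λ j j<i → offQ (suc j) (s≤s j<i)) eq)
          (sym (X.shift n (into Q) z)))

      -- The walk goes against the arrows because it can then stop only at multiples of `k + 1`.
      -- `size` is some period of the walk, not necessarily the least one.
      record BackwardCycle (P : ℤ) : Set where
        field
          edge       : ℕ → ℤ
          ends       : Y (edge 0) ≡ P
          link       : ∀ r → X n (edge r) ≡ Y (edge (suc r))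
          size     : ℕ
          size≢0   : NonZero size
          turns      : ℤ
          periodic   : ∀ r → edge (size ℕ.+ r) ≡ edge r + turns * + k

      -- Of `k + 2` positions met on the way back, two agree modulo `k + 1` unless the start of the
      -- path has been reached.
      path-or-cycle : ∀ P → Path P ⊎ BackwardCycle P
      path-or-cycle P with trace (suc (suc k)) P
      ... | inj₁ path = inj₁ path
      ... | inj₂ off with Fin.pigeonhole (ℕ.n<1+n (suc k)) (λ i → fromℕ< (n%ℕd<d (back (toℕ i) P) (suc k)))
      ...   | i , j , i<j , same = inj₂ record
        { edge     = λ r → into (back r P)
        ; ends     = Y-into P (off 0 (s≤s z≤n))
        ; link     = λ r → trans (back-suc r P) (sym (Y-into (back (suc r) P) (all-off r)))
        ; size   = p
        ; size≢0 = ℕ.>-nonZero (ℕ.m<n⇒0<n∸m i<j)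
        ; turns    = - z
        ; periodic = λ r → trans (cong into (around r)) (into-shift (back r P) (- z))
        }
        where
        a b p : ℕ
        a = toℕ i
        b = toℕ j
        p = b ℕ.∸ a
        p+a≡b : p ℕ.+ a ≡ b
        p+a≡b = ℕ.m∸n+n≡m (ℕ.<⇒≤ i<j)
        b<2+k : b ℕ.< suc (suc k)
        b<2+k = Fin.toℕ<n j
        res-≡ : back a P %ℕ suc k ≡ back b P %ℕ suc k
        res-≡ = Fin.fromℕ<-injective _ _ _ _ same
        z : ℤ
        z = proj₁ (%ℕ-≡⇒ (back a P) (back b P) (suc k) res-≡)
        -- The repetition was found between times `a` and `b`. Backward steps are injective, so the
        -- common `a` of them cancel and `P` itself recurs after `p` steps.
        P≡ : P ≡ back p P + z * + suc k
        P≡ = back-injective a P (back p P) z (λ j j<a → off j (ℕ.<-trans j<a (ℕ.<-trans i<j b<2+k)))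
          (λ j j<a → subst OffStart (back-+ p j P)
            (off (p ℕ.+ j) (ℕ.<-trans (subst (p ℕ.+ j ℕ.<_) p+a≡b (ℕ.+-monoʳ-< p j<a)) b<2+k)))
          (trans (proj₂ (%ℕ-≡⇒ (back a P) (back b P) (suc k) res-≡))
                 (cong (_+ z * + suc k) (trans (cong (λ x → back x P) (sym p+a≡b)) (back-+ p a P))))
        turn : ∀ P Q z κ → P ≡ Q + z * κ → Q ≡ P + (- z) * κ
        turn P Q z κ refl = undo Q z κ
          where
          undo : ∀ Q z κ → Q ≡ Q + z * κ + (- z) * κ
          undo = solve-∀
        around : ∀ r → back (p ℕ.+ r) P ≡ back r P + (- z) * + suc k
        around r = trans (back-+ p r P) (trans (cong (back r) (turn P _ z (+ suc k) P≡)) (back-shift r P (- z)))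
        -- The trace covers only `k + 2` positions; later ones are reduced to it by subtracting the
        -- period. `N` bounds `r` for the induction.
        all-off′ : ∀ N r → r ℕ.< N → OffStart (back r P)
        all-off′ (suc N) r (s≤s r≤N) with p ℕ.≤? r
        ... | no p≰r = off r (ℕ.<-trans (ℕ.<-≤-trans (ℕ.≰⇒> p≰r) (ℕ.m∸n≤m b a)) b<2+k)
        ... | yes p≤r = λ on → all-off′ N (r ℕ.∸ p) (ℕ.<-≤-trans (ℕ.∸-monoʳ-< (ℕ.m<n⇒0<n∸m i<j) p≤r) r≤N) (begin
          back (r ℕ.∸ p) P %ℕ suc k                          ≡⟨ %ℕ-shift (back (r ℕ.∸ p) P) (- z) (suc k) ⟨
          (back (r ℕ.∸ p) P + (- z) * + suc k) %ℕ suc k      ≡⟨ cong (_%ℕ suc k) (around (r ℕ.∸ p)) ⟨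
          back (p ℕ.+ (r ℕ.∸ p)) P %ℕ suc k                  ≡⟨ cong (λ x → back x P %ℕ suc k)
              (ℕ.m+[n∸m]≡n p≤r) ⟩
          back r P %ℕ suc k                                  ≡⟨ on ⟩
          0                                                  ∎)
          where open ≡-Reasoning
        all-off : ∀ r → OffStart (back (suc r) P)
        all-off r = all-off′ (suc (suc r)) (suc r) ℕ.≤-refl
        back-suc : ∀ r P → X n (into (back r P)) ≡ back (suc r) P
        back-suc zero    P = refl
        back-suc (suc r) P = back-suc r (X n (into P))

  -- From cycles to orbits: numbering the edges in increasing order

  module Orbits (k : ℕ) .{{k≢0 : NonZero k}} where

    open Dynamics k

    -- The edges of a cycle of G(n,k), lifted and numbered in increasing order:
    -- there are q of them per turn, and the cycle advances J places per step.
    record Orbit (n : ℤ) (q : ℕ) (J : ℤ) : Set where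
      field
        V    : ℤ → ℤ
        lift : Lift q k V
        link : ∀ e → X n (V e) ≡ Y (V (e - J))

    -- Since X and Y are increasing, moving two edges of the cycle forward preserves
    -- their order; hence edge r + z k is ordered like the number r * turns + z * size.
    module _ {n P : ℤ} (C : BackwardCycle n P) where
      open BackwardCycle C renaming (edge to v; size to p; size≢0 to p≢0; turns to ζ)

      private
        instance _ = p≢0

        advance : ∀ {c} → Slack c → ∀ a b z → c + v a ≤ v b + z * + k → c + v (suc a) ≤ v (suc b) + z * + k
        advance {c} s a b z h = Y.slack-cancel s
          (subst₂ (λ x y → c + x ≤ y) (link a)
            (trans (X.shift n (v b) z) (trans (cong (_+ z * + suc k) (link b)) (sym (Y.shift (v (suc b)) z))))
            (X.slack-mono n s h))

        advance* : ∀ {c} → Slack c → ∀ i a b z → c + v a ≤ v b + z * + k → c + v (i ℕ.+ a) ≤ v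
            (i ℕ.+ b) + z * + k
        advance* s zero    a b z h = h
        advance* s (suc i) a b z h = advance s (i ℕ.+ a) (i ℕ.+ b) z (advance* s i a b z h)

        repeat : ∀ {c} → Slack c → ∀ i s b z → c + v (s ℕ.+ b) ≤ v b + z * + k →
                 c + v (suc i ℕ.* s ℕ.+ b) ≤ v b + (+ suc i * z) * + k
        repeat {c} sl zero s b z h =
          subst₂ (λ x y → c + v (x ℕ.+ b) ≤ v b + y * + k) (sym (ℕ.+-identityʳ s)) (sym (*-identityˡ z)) h
        repeat {c} sl (suc i) s b z h = subst (λ x → c + v x ≤ v b + (+ suc (suc i) * z) * + k) reindex
          (combine c (v (suc i ℕ.* s ℕ.+ (s ℕ.+ b))) (v (suc i ℕ.* s ℕ.+ b)) (v b) (+ suc i) z (+ k)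
              (slack-≥0 sl)
            (advance* sl (suc i ℕ.* s) (s ℕ.+ b) b z h) (repeat sl i s b z h))
          where
          reindex : suc i ℕ.* s ℕ.+ (s ℕ.+ b) ≡ suc (suc i) ℕ.* s ℕ.+ b
          reindex = trans (sym (ℕ.+-assoc (suc i ℕ.* s) s b)) (cong (ℕ._+ b) (ℕ.+-comm (suc i ℕ.* s) s))
          combine : ∀ c x y w i z κ → 0ℤ ≤ c → c + x ≤ y + z * κ → c + y ≤ w + (i * z) * κ → c + x ≤ w +
              ((1ℤ + i) * z) * κ
          combine c x y w i z κ h₀ h₁ h₂ = h₀ ⊕ ⟨ h₁ ⟩ ⊕ ⟨ h₂ ⟩ ∴ solve (c ∷ x ∷ y ∷ w ∷ i ∷ z ∷ κ ∷ [])

        periodic* : ∀ s b → v (s ℕ.* p ℕ.+ b) ≡ v b + (+ s * ζ) * + k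
        periodic* zero    b = sym (+-identityʳ (v b))
        periodic* (suc s) b = trans (cong v (ℕ.+-assoc p (s ℕ.* p) b))
          (trans (periodic (s ℕ.* p ℕ.+ b))
              (trans (cong (_+ ζ * + k) (periodic* s b)) (collect (v b) (+ s) ζ (+ k))))
          where
          collect : ∀ w s ζ κ → w + (s * ζ) * κ + ζ * κ ≡ w + ((1ℤ + s) * ζ) * κ
          collect = solve-∀

        -- Repeating the comparison `p` times compares edges `p s + b` and `b`, whose exact distance
        -- is known from running through the period `s` times. Only the numbers of turns survive.
        compare-above : ∀ {c} → Slack c → ∀ s b z → c + v (s ℕ.+ b) ≤ v b + z * + k → c + + s * ζ ≤ + p * z
        compare-above {c} sl s b z h = slack-*-cancel sl (+ s * ζ) (+ p * z) k
          (strip c (v b) ((+ s * ζ) * + k) ((+ p * z) * + k)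
            (subst (λ x → c + x ≤ v b + (+ p * z) * + k)
                (trans (cong (λ x → v (x ℕ.+ b)) (ℕ.*-comm p s)) (periodic* s b)) whole))
          where
          whole : c + v (p ℕ.* s ℕ.+ b) ≤ v b + (+ p * z) * + k
          whole = subst (λ x → c + v (x ℕ.* s ℕ.+ b) ≤ v b + (+ x * z) * + k) (ℕ.suc-pred p)
              (repeat sl (ℕ.pred p) s b z h)
          strip : ∀ c w x y → c + (w + x) ≤ w + y → c + x ≤ y
          strip c w x y h = ⟨ h ⟩ ∴ solve (c ∷ w ∷ x ∷ y ∷ [])

        compare : ∀ {c} → Slack c → ∀ a z b z′ → c + (v a + z * + k) ≤ v b + z′ * + k →
                  c + (+ a * ζ + z * + p) ≤ + b * ζ + z′ * + p
        compare {c} sl a z b z′ h = conclude c (+ a) (+ b) z z′ (+ p) ζ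
            (subst (λ x → c + x * ζ ≤ + p * z″) s≡ (compare-above sl s b z″
          (subst (λ x → c + x ≤ v b + z″ * + k) (sym (trans (cong v s+b) (periodic* b a)))
            (reshape c (v a) (v b) z z′ (+ b) ζ (+ k) h))))
          where
          z″ : ℤ
          z″ = z′ - z + + b * ζ
          s : ℕ
          -- Adding `b` whole periods to `a` makes the index at least `b`, as `p ≥ 1`, at the price
          -- of `b * ζ` extra turns, which `z″` accounts for.
          s = b ℕ.* p ℕ.+ a ℕ.∸ b
          b≤ : b ℕ.≤ b ℕ.* p ℕ.+ a
          b≤ = ℕ.≤-trans (ℕ.m≤m*n b p) (ℕ.m≤m+n (b ℕ.* p) a)
          s+b : s ℕ.+ b ≡ b ℕ.* p ℕ.+ a
          s+b = ℕ.m∸n+n≡m b≤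
          s≡ : + s ≡ + b * + p + + a - + b
          s≡ = trans (undo (+ s) (+ b)) (cong (_- + b) (trans (sym (pos-+ s b)) (trans (cong +_ s+b)
                 (trans (pos-+ (b ℕ.* p) a) (cong (_+ + a) (pos-* b p))))))
            where
            undo : ∀ s b → s ≡ s + b - b
            undo = solve-∀
          reshape : ∀ c x y z z′ b ζ κ → c + (x + z * κ) ≤ y + z′ * κ → c + (x + (b * ζ) * κ) ≤ y +
              (z′ - z + b * ζ) * κ
          reshape c x y z z′ b ζ κ h = ⟨ h ⟩ ∴ solve (c ∷ x ∷ y ∷ z ∷ z′ ∷ b ∷ ζ ∷ κ ∷ [])
          conclude : ∀ c a b z z′ p ζ → c + (b * p + a - b) * ζ ≤ p * (z′ - z + b * ζ) → c +
              (a * ζ + z * p) ≤ b * ζ + z′ * p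
          conclude c a b z z′ p ζ h = ⟨ h ⟩ ∴ solve (c ∷ a ∷ b ∷ z ∷ z′ ∷ p ∷ ζ ∷ [])

      -- With `J′ / q` the reduced form of `ζ / p`, edge number `r` of the walk, moved by `z` turns,
      -- gets place `r J′ + z q`. The comparisons show that the order of edges is the order of
      -- places, and coprimality that every integer is a place.
      cycle⇒orbit : ∃[ q ] ∃[ J ] Σ[ q≢0 ∈ NonZero q ] Unimodular J q × Σ[ O ∈ Orbit n q J ] Y
          (Orbit.V O 0ℤ) ≡ P
      cycle⇒orbit with lowest-terms ζ p
      ... | J′ , q , d , q≢0 , d≢0 , ζ≡ , p≡ , unimod@(u , w , unit) =
        -- The walk runs against the edges, hence the sign.
        q , - J′ , q≢0 , unimodular-neg unimod ,
        record { V = V ; lift = lift ; link = link′ } , trans (cong Y (sym (V-unique 0 0ℤ refl)))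
            (trans (cong Y (+-identityʳ (v 0))) ends)
        where
        instance
          _ = q≢0
          _ = d≢0

        compare′ : ∀ {c} → Slack c → ∀ a z b z′ → c + (v a + z * + k) ≤ v b + z′ * + k →
                   c + (+ a * J′ + z * + q) ≤ + b * J′ + z′ * + q
        compare′ {c} sl a z b z′ h = slack-*-cancel sl (+ a * J′ + z * + q) (+ b * J′ + z′ * + q) d
          (subst₂ (λ x y → c + x ≤ y) (factor a z) (factor b z′) (compare sl a z b z′ h))
          where
          factor : ∀ a z → + a * ζ + z * + p ≡ (+ a * J′ + z * + q) * + d
          factor a z = trans (cong₂ (λ x y → + a * x + z * y) ζ≡ p≡) (distr (+ a) J′ z (+ q) (+ d))
            where
            distr : ∀ a J z q d → a * (J * d) + z * (q * d) ≡ (a * J + z * q) * d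
            distr = solve-∀

        -- Multiplying `u J′ + w q = 1` by `e` gives one representation of the place `e`; reducing
        -- the coefficient of `J′` modulo `q` makes it a natural number, as the index of an edge
        -- must be.
        r : ℤ → ℕ
        r e = (e * u) %ℕ q

        t : ℤ → ℤ
        t e = (e * u) /ℕ q * J′ + e * w

        V : ℤ → ℤ
        V e = v (r e) + t e * + k

        place : ∀ e → + r e * J′ + t e * + q ≡ e
        place e = trans (regroup (+ r e) ((e * u) /ℕ q) J′ e w (+ q))
          (trans (cong (λ x → x * J′ + e * w * + q) (sym (a≡a%ℕn+[a/ℕn]*n (e * u) q)))
            (trans (pull e u w J′ (+ q)) (trans (cong (e *_) unit) (*-identityʳ e))))
          where
          regroup : ∀ r g J e w q → r * J + (g * J + e * w) * q ≡ (r + g * q) * J + e * w * q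
          regroup = solve-∀
          pull : ∀ e u w J q → e * u * J + e * w * q ≡ e * (u * J + w * q)
          pull = solve-∀

        squeeze : ∀ x y e → 1ℤ + x ≤ y → x ≡ e → y ≡ e → ⊥
        squeeze x .x .x h refl refl = <-irrefl refl (suc[i]≤j⇒i<j h)

        -- Every representation of a place yields the same edge: a strict comparison in either
        -- direction would make the place smaller than itself.
        V-unique : ∀ a z {e} → + a * J′ + z * + q ≡ e → v a + z * + k ≡ V e
        V-unique a z {e} eq with ≤⊎> (v a + z * + k) (V e) | ≤⊎> (V e) (v a + z * + k)
        ... | inj₁ le | inj₁ ge = ≤-antisym le ge
        ... | inj₂ gt | _      = ⊥-elim (squeeze _ _ e (compare′ (inj₂ refl) (r e) (t e) a z gt) (place e) eq)
        ... | inj₁ _ | inj₂ lt = ⊥-elim (squeeze _ _ e (compare′ (inj₂ refl) a z (r e) (t e) lt) eq (place e))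

        V-strict : ∀ {a b} → 1ℤ + a ≤ b → 1ℤ + V a ≤ V b
        V-strict {a} {b} a<b with ≤⊎> (V b) (V a)
        ... | inj₂ lt = lt
        ... | inj₁ ge = ⊥-elim (<⇒≱ (suc[i]≤j⇒i<j a<b) (subst₂ _≤_ (place b) (place a)
                (subst (_≤ _) (+-identityˡ _)
                    (compare′ (inj₁ refl) (r b) (t b) (r a) (t a)
                    (subst (_≤ V a) (sym (+-identityˡ (V b))) ge)))))

        lift : Lift q k V
        lift = record
          { strict = λ {a} {b} → V-strict {a} {b}
          ; shift  = λ e z → sym (trans (collect (v (r e)) (t e) z (+ k)) (V-unique (r e) (t e + z)
                       (trans (spread (+ r e) J′ (t e) z (+ q)) (cong (_+ z * + q) (place e)))))
          }
          where
          collect : ∀ x t z κ → x + t * κ + z * κ ≡ x + (t + z) * κ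
          collect = solve-∀
          spread : ∀ r J t z q → r * J + (t + z) * q ≡ r * J + t * q + z * q
          spread = solve-∀

        link′ : ∀ e → X n (V e) ≡ Y (V (e - - J′))
        link′ e = begin
          X n (v (r e) + t e * + k)              ≡⟨ X.shift n (v (r e)) (t e) ⟩
          X n (v (r e)) + t e * + suc k          ≡⟨ cong (_+ t e * + suc k) (link (r e)) ⟩
          Y (v (suc (r e))) + t e * + suc k      ≡⟨ Y.shift (v (suc (r e))) (t e) ⟨
          Y (v (suc (r e)) + t e * + k)          ≡⟨ cong Y
              (V-unique (suc (r e)) (t e) (trans (next (+ r e) J′ (t e * + q)) (cong (_- - J′) (place e)))) ⟩
          Y (V (e - - J′))                       ∎
          where
          open ≡-Reasoning
          next : ∀ r J x → (1ℤ + r) * J + x ≡ r * J + x - - J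
          next = solve-∀

  -- Functions on places that are constant or monotone along `J`-steps

  module _ {A : Set} (g : ℤ → A) (J : ℤ) (same : ∀ e → g e ≡ g (e - J)) where

    shift-invariant : ∀ z e → g (e + z * J) ≡ g e
    shift-invariant (+ zero)    e = cong g (+-identityʳ e)
    shift-invariant (+ suc n)   e = trans (same (e + + suc n * J))
        (trans (cong g (drop e (+ n) J)) (shift-invariant (+ n) e))
      where
      drop : ∀ e n J → e + (1ℤ + n) * J - J ≡ e + n * J
      drop = solve-∀
    shift-invariant -[1+ zero ] e = trans (cong g (drop e J)) (sym (same e))
      where
      drop : ∀ e J → e + -1ℤ * J ≡ e - J
      drop = solve-∀
    shift-invariant -[1+ suc n ] e = trans (cong g (drop e (+ n) J))
      (trans (sym (same (e + -[1+ n ] * J))) (shift-invariant -[1+ n ] e))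
      where
      drop : ∀ e n J → e + (- (1ℤ + (1ℤ + n))) * J ≡ e + (- (1ℤ + n)) * J - J
      drop = solve-∀

    -- By coprimality every place is reached from 0 by `J`-steps and whole turns.
    unimodular-constant : ∀ {q} → Unimodular J q → (∀ e z → g (e + z * + q) ≡ g e) → ∀ e → g e ≡ g 0ℤ
    unimodular-constant {q} (u , w , unit) periodic e = trans
        (cong g (trans (sym (*-identityʳ e)) (trans (cong (e *_) (sym unit))
        (split e u J w (+ q)))))
      (trans (periodic _ (e * w)) (shift-invariant (e * u) 0ℤ))
      where
      split : ∀ e u J w q → e * (u * J + w * q) ≡ 0ℤ + e * u * J + e * w * q
      split = solve-∀

  -- After as many `J`-steps as there are places in a turn, `J` whole turns have been made and the
  -- value is back where it was, so no single step can have changed it.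
  monotone-periodic : ∀ {q} .{{_ : NonZero q}} (g : ℤ → ℤ) J → (∀ e z → g (e + z * + q) ≡ g e) →
                      (∀ e → g (e - J) ≤ g e) → ∀ e → g e ≤ g (e - J)
  monotone-periodic {suc q} g J periodic decreasing e =
    subst (_≤ g (e - J)) (trans (cong g (around e J (+ q))) (periodic e (- J))) (descend q (e - J))
    where
    around : ∀ e J q → e - J - q * J ≡ e + (- J) * (1ℤ + q)
    around = solve-∀
    descend : ∀ n e → g (e - + n * J) ≤ g e
    descend zero    e = ≤-reflexive (cong g (+-identityʳ e))
    descend (suc n) e = ≤-trans (≤-reflexive (cong g (one-more e (+ n) J)))
        (≤-trans (decreasing (e - + n * J)) (descend n e))
      where
      one-more : ∀ e n J → e - (1ℤ + n) * J ≡ e - n * J - J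
      one-more = solve-∀

  -- Finite sums, and nondivisibility of small multiples of `J`

  Σ[_] : ℕ → (ℕ → ℤ) → ℤ
  Σ[ zero  ] g = 0ℤ
  Σ[ suc m ] g = Σ[ m ] g + g (suc m)

  Σ-mono : ∀ m {g h} → (∀ a → 1 ℕ.≤ a → a ℕ.≤ m → g a ≤ h a) → Σ[ m ] g ≤ Σ[ m ] h
  Σ-mono zero    le = ≤-refl
  Σ-mono (suc m) le = +-mono-≤ (Σ-mono m (λ a 1≤a a≤m → le a 1≤a (ℕ.m≤n⇒m≤1+n a≤m)))
      (le (suc m) (s≤s z≤n) ℕ.≤-refl)

  Σ-cong : ∀ m {g h} → (∀ a → 1 ℕ.≤ a → a ℕ.≤ m → g a ≡ h a) → Σ[ m ] g ≡ Σ[ m ] h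
  Σ-cong zero    eq = refl
  Σ-cong (suc m) eq = cong₂ _+_ (Σ-cong m (λ a 1≤a a≤m → eq a 1≤a (ℕ.m≤n⇒m≤1+n a≤m)))
      (eq (suc m) (s≤s z≤n) ℕ.≤-refl)

  Σ-+-const : ∀ m g c → Σ[ m ] (λ a → g a + c) ≡ Σ[ m ] g + + m * c
  Σ-+-const zero    g c = refl
  Σ-+-const (suc m) g c = trans (cong (_+ (g (suc m) + c)) (Σ-+-const m g c))
      (collect (Σ[ m ] g) (+ m) (g (suc m)) c)
    where
    collect : ∀ s m x c → s + m * c + (x + c) ≡ s + x + (1ℤ + m) * c
    collect = solve-∀

  Σ-telescope : ∀ m (g h : ℕ → ℤ) → (∀ a → g (suc a) ≡ h a - h (suc a)) → Σ[ m ] g ≡ h 0 - h m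
  Σ-telescope zero    g h eq = sym (+-inverseʳ (h 0))
  Σ-telescope (suc m) g h eq = trans (cong₂ _+_ (Σ-telescope m g h eq) (eq m)) (collect (h 0) (h m) (h (suc m)))
    where
    collect : ∀ x y z → x - y + (y - z) ≡ x - z
    collect = solve-∀

  Σ-+ : ∀ m g h → Σ[ m ] (λ a → g a + h a) ≡ Σ[ m ] g + Σ[ m ] h
  Σ-+ zero    g h = refl
  Σ-+ (suc m) g h = trans (cong (_+ (g (suc m) + h (suc m))) (Σ-+ m g h))
      (swap (Σ[ m ] g) (Σ[ m ] h) (g (suc m)) (h (suc m)))
    where
    swap : ∀ s t x y → s + t + (x + y) ≡ s + x + (t + y)
    swap = solve-∀

  pred-/ℕ : ∀ x q .{{_ : NonZero q}} → x %ℕ q ≢ 0 → (-1ℤ + x) /ℕ q ≡ x /ℕ q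
  pred-/ℕ x q x%q≢0 = /ℕ-unique { -1ℤ + x} {q}
    (lower x (+ (x %ℕ q)) (x /ℕ q * + q) (a≡a%ℕn+[a/ℕn]*n x q) (+≤+ (ℕ.n≢0⇒n>0 x%q≢0)))
    (upper x (x /ℕ q * + q + + q) (/ℕ-upper x q))
    where
    lower : ∀ x r s → x ≡ r + s → 1ℤ ≤ r → s ≤ -1ℤ + x
    lower .(r + s) r s refl h = ⟨ h ⟩ ∴ solve (r ∷ s ∷ [])
    upper : ∀ x s → 1ℤ + x ≤ s → 1ℤ + (-1ℤ + x) ≤ s
    upper x s h = ⟨ h ⟩ ⊕ +≤+ {0} {1} z≤n ∴ solve (x ∷ s ∷ [])

  -- Multiplication by the inverse `u` of `J` would turn divisibility of `i J` by `q` into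
  -- divisibility of `i`.
  unimodular-%ℕ : ∀ {J q} .{{_ : NonZero q}} → Unimodular J q → ∀ i z → 1 ℕ.≤ i → i ℕ.< q →
      (+ i * J + z * + q) %ℕ q ≢ 0
  unimodular-%ℕ {J} {q} (u , w , unit) i z 1≤i i<q zero-mod = ℕ.<⇒≢ 1≤i (sym (begin
    i             ≡⟨ m<n⇒m%n≡m i<q ⟨
    + i %ℕ q      ≡⟨ cong (_%ℕ q) i≡ ⟩
    (0ℤ + c * + q) %ℕ q ≡⟨ %ℕ-shift 0ℤ c q ⟩
    0ℤ %ℕ q       ≡⟨ m<n⇒m%n≡m (ℕ.≤-<-trans z≤n i<q) ⟩
    0             ∎))
    where
    open ≡-Reasoning
    g c : ℤ
    g = (+ i * J + z * + q) /ℕ q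
    c = u * (g - z) + + i * w
    product : + i * J ≡ (g - z) * + q
    product = isolate (+ i * J) z g (+ q) (trans (a≡a%ℕn+[a/ℕn]*n (+ i * J + z * + q) q)
      (trans (cong (λ r → + r + g * + q) zero-mod) (+-identityˡ (g * + q))))
      where
      cancel : ∀ x z q → x ≡ x + z * q - z * q
      cancel = solve-∀
      factor : ∀ g z q → g * q - z * q ≡ (g - z) * q
      factor = solve-∀
      isolate : ∀ x z g q → x + z * q ≡ g * q → x ≡ (g - z) * q
      isolate x z g q eq = trans (cancel x z q) (trans (cong (_- z * q) eq) (factor g z q))
    i≡ : + i ≡ 0ℤ + c * + q
    i≡ = trans (sym (*-identityʳ (+ i))) (trans (cong (+ i *_) (sym unit)) (trans (expand (+ i) u J w (+ q))
      (trans (cong (λ x → u * x + + i * w * + q) product) (collect u (g - z) (+ i) w (+ q)))))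
      where
      expand : ∀ i u J w q → i * (u * J + w * q) ≡ u * (i * J) + i * w * q
      expand = solve-∀
      collect : ∀ u h i w q → u * (h * q) + i * w * q ≡ 0ℤ + (u * h + i * w) * q
      collect = solve-∀

  -- Uniqueness of the rotation number

  module OrbitType (k : ℕ) .{{k≢0 : NonZero k}} where

    open Dynamics k
    open Orbits k

    module _ {n q q′ J J′} .{{_ : NonZero q}} .{{_ : NonZero q′}} (O : Orbit n q J) (O′ : Orbit n q′ J′) where
      open Orbit O
      open Orbit O′ using () renaming (V to V′; lift to lift′; link to link′)

      private
        advance : ∀ i a b → V a ≤ V′ b → V (a + + i * J) ≤ V′ (b + + i * J′)
        advance zero    a b h = subst₂ (λ x y → V x ≤ V′ y) (sym (+-identityʳ a)) (sym (+-identityʳ b)) h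
        advance (suc i) a b h = X.cancel-≤ n
            (subst₂ _≤_ (pull V link a) (pull V′ link′ b) (Y.mono (advance i a b h)))
          where
          less : ∀ a i J → a + (1ℤ + i) * J - J ≡ a + i * J
          less = solve-∀
          pull : ∀ (U : ℤ → ℤ) {I} → (∀ e → X n (U e) ≡ Y (U (e - I))) → ∀ a → Y (U (a + + i * I)) ≡ X n
              (U (a + + suc i * I))
          pull U {I} ulink a = trans (cong (λ x → Y (U x)) (sym (less a (+ i) I))) (sym (ulink _))

      private
        -- Start the second orbit at its first edge not before `V 0ℤ`, which is less than one turn
        -- ahead. Edges preserve this order for `q q′` steps, in which the orbits make `J q′` and
        -- `J′ q` turns; a lead of less than one turn cannot hide a whole one.
        rotation-≤-from : ∀ {E} → Crossing V′ (V 0ℤ) E → J * + q′ ≤ J′ * + q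
        rotation-≤-from {E} cr = drop (J * + q′) (J′ * + q)
            (i<j⇒suc[i]≤j {J * + q′} {1ℤ + J′ * + q}
            (*-cancelʳ-<-nonNeg {J * + q′} {1ℤ + J′ * + q} (+ k) (suc[i]≤j⇒i<j
            (conclude (V 0ℤ) (V′ E) (J * + q′) (J′ * + q) (+ k) turned (before (V′ E) (+ k) (V 0ℤ)
              (subst (λ x → 1ℤ + x ≤ V 0ℤ) (shift′ E (- 1ℤ))
                  (below (behind E (+ q′) (+≤+ (ℕ.>-nonZero⁻¹ q′))))))))))
          where
          open Crossing cr
          open Lift lift
          shift′ = Lift.shift lift′
          behind : ∀ E q → 1ℤ ≤ q → 1ℤ + (E + (- 1ℤ) * q) ≤ E
          behind E q h = ⟨ h ⟩ ∴ solve (E ∷ q ∷ [])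
          before : ∀ v κ w → 1ℤ + (v + (- 1ℤ) * κ) ≤ w → 1ℤ + v ≤ w + κ
          before v κ w h = ⟨ h ⟩ ∴ solve (v ∷ κ ∷ w ∷ [])
          turned : V 0ℤ + (J * + q′) * + k ≤ V′ E + (J′ * + q) * + k
          turned = subst₂ _≤_
            (trans (cong V (trans (cong (λ x → 0ℤ + x * J) (pos-* q q′)) (order₁ (+ q) (+ q′) J)))
                (shift 0ℤ (J * + q′)))
            (trans (cong V′ (trans (cong (λ x → E + x * J′) (pos-* q q′)) (order₂ E (+ q) (+ q′) J′)))
                (shift′ E (J′ * + q)))
            (advance (q ℕ.* q′) 0ℤ E (above ≤-refl))
            where
            order₁ : ∀ q q′ J → 0ℤ + q * q′ * J ≡ 0ℤ + J * q′ * q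
            order₁ = solve-∀
            order₂ : ∀ E q q′ J → E + q * q′ * J ≡ E + J * q * q′
            order₂ = solve-∀
          conclude : ∀ v w x y κ → v + x * κ ≤ w + y * κ → 1ℤ + w ≤ v + κ → 1ℤ + x * κ ≤ (1ℤ + y) * κ
          conclude v w x y κ h₁ h₂ = ⟨ h₁ ⟩ ⊕ ⟨ h₂ ⟩ ∴ solve (v ∷ w ∷ x ∷ y ∷ κ ∷ [])
          drop : ∀ x y → 1ℤ + x ≤ 1ℤ + y → x ≤ y
          drop x y h = ⟨ h ⟩ ∴ solve (x ∷ y ∷ [])

      rotation-≤ : J * + q′ ≤ J′ * + q
      rotation-≤ = rotation-≤-from (proj₂ (crossing lift′ (V 0ℤ)))

    private
      divisor : ∀ {J J′ q q′} → Unimodular J q → J * + q′ ≡ J′ * + q → q ∣ q′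
      divisor {J} {J′} {q} {q′} (u , w , unit) eq = divides ∣ u * J′ + w * + q′ ∣ (trans (cong ∣_∣ (begin
        + q′                             ≡⟨ *-identityˡ (+ q′) ⟨
        1ℤ * + q′                        ≡⟨ cong (_* + q′) unit ⟨
        (u * J + w * + q) * + q′         ≡⟨ expand u J w (+ q) (+ q′) ⟩
        u * (J * + q′) + w * + q′ * + q  ≡⟨ cong (λ x → u * x + w * + q′ * + q) eq ⟩
        u * (J′ * + q) + w * + q′ * + q  ≡⟨ collect u J′ w (+ q′) (+ q) ⟩
        (u * J′ + w * + q′) * + q        ∎)) (abs-* (u * J′ + w * + q′) (+ q)))
        where
        open ≡-Reasoning
        expand : ∀ u J w q q′ → (u * J + w * q) * q′ ≡ u * (J * q′) + w * q′ * q
        expand = solve-∀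
        collect : ∀ u J w q′ q → u * (J * q) + w * q′ * q ≡ (u * J + w * q′) * q
        collect = solve-∀

      same-fraction : ∀ {q q′ J J′} .{{_ : NonZero q}} → q ≡ q′ → J * + q′ ≡ J′ * + q → q ≡ q′ × J ≡ J′
      same-fraction {q@(suc _)} {J = J} {J′} refl eq = refl , *-cancelʳ-≡ J J′ (+ q) eq

    -- The two rotation numbers agree, and both are in lowest terms.
    orbit-type-unique : ∀ {n q q′ J J′} .{{_ : NonZero q}} .{{_ : NonZero q′}} → Unimodular J q
        → Unimodular J′ q′ →
                        Orbit n q J → Orbit n q′ J′ → q ≡ q′ × J ≡ J′
    orbit-type-unique {J = J} {J′} unimod unimod′ O O′ =
      same-fraction (∣-antisym (divisor {J} {J′} unimod Jq′≡J′q)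
          (divisor {J′} {J} unimod′ (sym Jq′≡J′q))) Jq′≡J′q
      where
      Jq′≡J′q = ≤-antisym (rotation-≤ O O′) (rotation-≤ O′ O)

  -- The model sequence `D` and the classification of orbits

  module Model (k q : ℕ) .{{k≢0 : NonZero k}} .{{q≢0 : NonZero q}} (q≤k : q ℕ.≤ k) (J : ℤ) (unimodular : Unimodular J q) where

    open Dynamics k
    open Orbits k
    open Defs using () renaming (f to f′; m to m′)

    f m : ℕ
    f = f′ k q
    m = m′ k q

    1≤f : 1 ℕ.≤ f
    1≤f = m≥n⇒m/n>0 q≤k

    m<q : m ℕ.< q
    m<q = subst (ℕ._< q) (m%n≡m∸m/n*n k q) (m%n<n k q)

    k≡ : + k ≡ + f * + q + + m
    k≡ = trans (cong +_ (sym (ℕ.m+[n∸m]≡n (m/n*n≤m k q))))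
        (trans (pos-+ (f ℕ.* q) m) (cong (_+ + m) (pos-* f q)))

    abstract

      -- The model of an orbit of type (q, J).  The gap of D just before e is f,
      -- or f + 1 if e is one of J, 2J, …, mJ modulo q.
      D : ℤ → ℤ
      D e = + f * e + Σ[ m ] (λ a → (e - + a * J) /ℕ q - (- (+ a * J)) /ℕ q)

      -- Congruent to `(m + 1) J` modulo `q`, the place where the raised gaps end; this
      -- representative makes `D-step` hold exactly and not just up to turns.
      last : ℤ
      last = (1ℤ + + k) * J - + q

      D-def : ∀ e → D e ≡ + f * e + Σ[ m ] (λ a → (e - + a * J) /ℕ q - (- (+ a * J)) /ℕ q)
      D-def e = refl

      last-def : last ≡ (1ℤ + + k) * J - + q
      last-def = refl

      D-0 : D 0ℤ ≡ 0ℤ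
      D-0 = cong₂ _+_ (*-zeroʳ (+ f)) (trans (Σ-cong m {h = λ _ → 0ℤ} (λ a _ _ →
          trans (cong (λ x → x /ℕ q - (- (+ a * J)) /ℕ q) (+-identityˡ (- (+ a * J))))
              (+-inverseʳ ((- (+ a * J)) /ℕ q)))) (Σ-zero m))
        where
        Σ-zero : ∀ m → Σ[ m ] (λ _ → 0ℤ) ≡ 0ℤ
        Σ-zero zero    = refl
        Σ-zero (suc m) = trans (+-identityʳ _) (Σ-zero m)

      D-shift : ∀ e z → D (e + z * + q) ≡ D e + z * + k
      D-shift e z = trans (cong (λ s → + f * (e + z * + q) + s)
          (trans (Σ-cong m (λ a _ _ → term a)) (Σ-+-const m _ z)))
          (trans (collect (+ f) e z (+ q) (Σ[ m ] (λ a → (e - + a * J) /ℕ q - (- (+ a * J)) /ℕ q)) (+ m))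
              (cong (λ x → D e + z * x) (sym k≡)))
        where
        swap : ∀ e z y → e + z - y ≡ e - y + z
        swap = solve-∀
        swap′ : ∀ g z h → g + z - h ≡ g - h + z
        swap′ = solve-∀
        term : ∀ a → (e + z * + q - + a * J) /ℕ q - (- (+ a * J)) /ℕ q ≡ (e - + a * J) /ℕ q -
            (- (+ a * J)) /ℕ q + z
        term a = trans (cong (λ x → x /ℕ q - (- (+ a * J)) /ℕ q) (swap e (z * + q) (+ a * J)))
          (trans (cong (_- (- (+ a * J)) /ℕ q) (/ℕ-shift (e - + a * J) z q))
              (swap′ ((e - + a * J) /ℕ q) z ((- (+ a * J)) /ℕ q)))
        collect : ∀ f e z q s m → f * (e + z * q) + (s + m * z) ≡ f * e + s + z * (f * q + m)
        collect = solve-∀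

      D-gap : ∀ a b → a ≤ b → D a + + f * (b - a) ≤ D b
      D-gap a b a≤b = add (+ f) a b _ _
          (Σ-mono m (λ i _ _ → +-monoˡ-≤ (- ((- (+ i * J)) /ℕ q)) (/ℕ-mono q (+-monoˡ-≤ (- (+ i * J)) a≤b))))
        where
        add : ∀ f a b s t → s ≤ t → f * a + s + f * (b - a) ≤ f * b + t
        add f a b s t h = ⟨ h ⟩ ∴ solve (f ∷ a ∷ b ∷ s ∷ t ∷ [])

      D-gap₁ : ∀ {a b} → 1ℤ + a ≤ b → D a + + f ≤ D b
      D-gap₁ {a} {b} a<b = ≤-trans (≤-reflexive (one (D a) (+ f) a))
          (≤-trans (D-gap a (1ℤ + a) (i≤suc[i] a)) D-mono₁)
        where
        one : ∀ d f a → d + f ≡ d + f * (1ℤ + a - a)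
        one = solve-∀
        nonneg : ∀ d f x → 0ℤ ≤ f * x → d ≤ d + f * x
        nonneg d f x h = h ∴ solve (d ∷ f ∷ x ∷ [])
        D-mono₁ : D (1ℤ + a) ≤ D b
        D-mono₁ = ≤-trans (nonneg (D (1ℤ + a)) (+ f) (b - (1ℤ + a)) (f ⊛ ⟨ a<b ⟩)) (D-gap (1ℤ + a) b a<b)

      D-lift : Lift q k D
      D-lift = record { strict = λ {a} {b} a<b → ≤-trans (bump (D a) (+ f) (+≤+ 1≤f))
          (D-gap₁ {a} {b} a<b) ; shift = D-shift }
        where
        bump : ∀ d f → 1ℤ ≤ f → 1ℤ + d ≤ d + f
        bump d f h = ⟨ h ⟩ ∴ solve (d ∷ f ∷ [])

      narrow-gap : ∀ e → (∀ a → 1 ℕ.≤ a → a ℕ.≤ m → (e - + a * J) %ℕ q ≢ 0) → D (-1ℤ + e) ≡ D e - + f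
      narrow-gap e off = trans (cong (λ s → + f * (-1ℤ + e) + s) (Σ-cong m (λ a 1≤a a≤m →
          cong (_- (- (+ a * J)) /ℕ q)
              (trans (cong (_/ℕ q) (+-assoc -1ℤ e (- (+ a * J)))) (pred-/ℕ (e - + a * J) q (off a 1≤a a≤m))))))
        (collect (+ f) e _)
        where
        collect : ∀ f e s → f * (-1ℤ + e) + s ≡ f * e + s - f
        collect = solve-∀

      diff : ∀ {a b} → a ℕ.≤ b → + (b ℕ.∸ a) ≡ + b - + a
      diff {a} {b} a≤b = trans (cancel (+ (b ℕ.∸ a)) (+ a))
          (cong (_- + a) (trans (sym (pos-+ (b ℕ.∸ a) a)) (cong +_ (ℕ.m∸n+n≡m a≤b))))
        where
        cancel : ∀ x a → x ≡ x + a - a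
        cancel = solve-∀

      D-before-0 : D -1ℤ ≡ 0ℤ - + f
      D-before-0 = trans (narrow-gap 0ℤ off) (cong (_- + f) D-0)
        where
        off : ∀ a → 1 ℕ.≤ a → a ℕ.≤ m → (0ℤ - + a * J) %ℕ q ≢ 0
        off a 1≤a a≤m = subst (λ x → x %ℕ q ≢ 0)
            (trans (cong (λ x → x * J + (- J) * + q) (diff (ℕ.<⇒≤ a<q))) (collect (+ q) (+ a) J))
            (unimodular-%ℕ unimodular (q ℕ.∸ a) (- J) (ℕ.m<n⇒0<n∸m a<q) (ℕ.∸-monoʳ-< 1≤a (ℕ.<⇒≤ a<q)))
          where
          a<q : a ℕ.< q
          a<q = ℕ.≤-<-trans a≤m m<q
          collect : ∀ q a J → (q - a) * J + (- J) * q ≡ 0ℤ - a * J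
          collect = solve-∀

      -- Modulo `q`, `last − a J` is `(m + 1 − a) J` with `1 ≤ m + 1 − a < q`, so `last` is none of
      -- the places with a raised gap.
      D-before-last : D (-1ℤ + last) ≡ D last - + f
      D-before-last = narrow-gap last off
        where
        off : ∀ a → 1 ℕ.≤ a → a ℕ.≤ m → (last - + a * J) %ℕ q ≢ 0
        off a 1≤a a≤m = subst (λ x → x %ℕ q ≢ 0)
            (trans (cong (λ x → x * J + (+ f * J - 1ℤ) * + q) (diff (ℕ.m≤n⇒m≤1+n a≤m)))
              (trans (collect (+ f) (+ q) (+ m) (+ a) J) (cong (λ x → (1ℤ + x) * J - + q - + a * J) (sym k≡))))
            (unimodular-%ℕ unimodular (suc m ℕ.∸ a) (+ f * J - 1ℤ) (ℕ.m<n⇒0<n∸m (s≤s a≤m))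
              (ℕ.<-≤-trans (ℕ.∸-monoʳ-< 1≤a (ℕ.m≤n⇒m≤1+n a≤m)) m<q))
          where
          collect : ∀ f q m a J → (1ℤ + m - a) * J + (f * J - 1ℤ) * q ≡ (1ℤ + (f * q + m)) * J - q - a * J
          collect = solve-∀

      -- Shifting by `J` turns the summand for `a` into the one for `a + 1`, so the sum telescopes
      -- and only its two end terms remain. The result is the edge equation of an orbit that crosses
      -- 0 at place 0 and `n` at `last`.
      D-step : ∀ e → D e - D (e - J) ≡ 1ℤ + (e - J) /ℕ q - (e - last) /ℕ q
      D-step e = trans (split (+ f) e J (Σ[ m ] g) (Σ[ m ] g′))
          (trans (cong (λ s → + f * J + s)
              (trans (cong (λ x → x - Σ[ m ] g′) Σg≡) (cancel (Σ[ m ] g′) (h 0 - h m))))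
            (trans (cong₂ (λ x y → + f * J + (x - y)) h0 hm)
                (finish (+ f * J) ((e - J) /ℕ q) ((e - last) /ℕ q))))
        where
        h : ℕ → ℤ
        h a = (e - + suc a * J) /ℕ q
        g g′ : ℕ → ℤ
        g a = (e - + a * J) /ℕ q - (- (+ a * J)) /ℕ q
        g′ a = (e - J - + a * J) /ℕ q - (- (+ a * J)) /ℕ q
        split : ∀ f e J s t → f * e + s - (f * (e - J) + t) ≡ f * J + (s - t)
        split = solve-∀
        cancel : ∀ s x → s + x - s ≡ x
        cancel = solve-∀
        next : ∀ e J a → e - J - a * J ≡ e - (1ℤ + a) * J
        next = solve-∀
        regroup : ∀ x y z → x - y ≡ z - y + (x - z)
        regroup = solve-∀
        Σg≡ : Σ[ m ] g ≡ Σ[ m ] g′ + (h 0 - h m)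
        Σg≡ = trans (Σ-cong m {g} {λ a → g′ a + ((e - + a * J) /ℕ q - h a)} (λ a _ _ →
            trans (regroup ((e - + a * J) /ℕ q) ((- (+ a * J)) /ℕ q) (h a))
              (cong (λ x → x /ℕ q - (- (+ a * J)) /ℕ q + ((e - + a * J) /ℕ q - h a)) (sym (next e J (+ a))))))
          (trans (Σ-+ m g′ (λ a → (e - + a * J) /ℕ q - h a)) (cong (λ s → Σ[ m ] g′ + s)
            (Σ-telescope m (λ a → (e - + a * J) /ℕ q - h a) h (λ a → refl))))
        h0 : h 0 ≡ (e - J) /ℕ q
        h0 = cong (λ x → (e - x) /ℕ q) (*-identityˡ J)
        hm : h m ≡ (e - last) /ℕ q + (+ f * J - 1ℤ)
        hm = trans (cong (_/ℕ q) (trans (expand e (+ m) J (+ f) (+ q))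
            (cong (λ x → e - ((1ℤ + x) * J - + q) + (+ f * J - 1ℤ) * + q) (sym k≡))))
               (/ℕ-shift (e - last) (+ f * J - 1ℤ) q)
          where
          expand : ∀ e m J f q → e - (1ℤ + m) * J ≡ e - ((1ℤ + (f * q + m)) * J - q) + (f * J - 1ℤ) * q
          expand = solve-∀
        finish : ∀ s x y → s + (x - (y + (s - 1ℤ))) ≡ 1ℤ + x - y
        finish = solve-∀

    top : ℤ
    top = D last

    shifted-lift : ∀ y → Lift q k (λ e → D e + y)
    shifted-lift y = record
      { strict = λ {a} {b} a<b → subst (_≤ D b + y) (+-assoc 1ℤ (D a) y)
          (+-monoˡ-≤ y (Lift.strict D-lift {a} {b} a<b))
      ; shift  = λ a z → trans (cong (_+ y) (D-shift a z)) (swap (D a) (z * + k) y)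
      }
      where
      swap : ∀ d z y → d + z + y ≡ d + y + z
      swap = solve-∀

    -- The gap before place 0 is exactly `f`, so raising the sequence by less than `f` cannot make
    -- it cross 0 earlier. The same holds at `last`.
    crossing-0 : ∀ y → 0ℤ ≤ y → 1ℤ + y ≤ + f → Crossing (λ e → D e + y) 0ℤ 0ℤ
    crossing-0 y 0≤y y<f = crossing-at (shifted-lift y)
        (subst (λ d → 0ℤ ≤ d + y) (sym D-0) (subst (0ℤ ≤_) (sym (+-identityˡ y)) 0≤y))
        (subst (λ d → 1ℤ + (d + y) ≤ 0ℤ) (sym D-before-0) (below y (+ f) y<f))
      where
      below : ∀ y f → 1ℤ + y ≤ f → 1ℤ + (0ℤ - f + y) ≤ 0ℤ
      below y f h = ⟨ h ⟩ ∴ solve (y ∷ f ∷ [])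

    crossing-top : ∀ y → 0ℤ ≤ y → 1ℤ + y ≤ + f → Crossing (λ e → D e + y) top last
    crossing-top y 0≤y y<f = crossing-at (shifted-lift y) (above top y 0≤y)
        (subst (λ d → 1ℤ + (d + y) ≤ top) (sym D-before-last) (below top y (+ f) y<f))
      where
      above : ∀ t y → 0ℤ ≤ y → t ≤ t + y
      above t y h = ⟨ h ⟩ ∴ solve (t ∷ y ∷ [])
      below : ∀ t y f → 1ℤ + y ≤ f → 1ℤ + (t - f + y) ≤ t
      below t y f h = ⟨ h ⟩ ∴ solve (t ∷ y ∷ f ∷ [])

    D-/ℕ : ∀ y → 0ℤ ≤ y → 1ℤ + y ≤ + f → ∀ e → (D e + y) /ℕ k ≡ e /ℕ q
    D-/ℕ y 0≤y y<f e = trans (cong (_/ℕ k) (sym (+-identityʳ (D e + y))))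
        (trans (crossing-/ℕ (shifted-lift y) (crossing-0 y 0≤y y<f) e)
      (cong (_/ℕ q) (+-identityʳ e)))

    -- The two crossings turn `D-step` into the edge equation for `n = top`; each admissible `y`
    -- thus gives a cycle of `G(top,k)`.
    model-orbit : ∀ y → 0ℤ ≤ y → 1ℤ + y ≤ + f → Orbit top q J
    model-orbit y 0≤y y<f = record
      { V    = λ e → D e + y
      ; lift = shifted-lift y
      ; link = λ e → trans (cong (λ x → D e + y + x) (crossing-/ℕ (shifted-lift y) (crossing-top y 0≤y y<f) e))
          (trans (rearrange (D e) (D (e - J)) y ((e - J) /ℕ q) ((e - last) /ℕ q) (D-step e))
            (cong (λ x → 1ℤ + (D (e - J) + y) + x) (sym (D-/ℕ y 0≤y y<f (e - J)))))
      }
      where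
      rearrange : ∀ d d′ y g h → d - d′ ≡ 1ℤ + g - h → d + y + h ≡ 1ℤ + (d′ + y) + g
      rearrange d d′ y g h eq = trans (pull d d′ y h) (trans (cong (λ x → x + d′ + y + h) eq) (push d′ y g h))
        where
        pull : ∀ d d′ y h → d + y + h ≡ d - d′ + d′ + y + h
        pull = solve-∀
        push : ∀ d y g h → 1ℤ + g - h + d + y + h ≡ 1ℤ + (d + y) + g
        push = solve-∀

    -- The bounds on `n` say that the orbit first reaches `n` at the place `origin + last`: its
    -- value there is `top + y`, and one place earlier `top + y − f`.
    record Classified (n : ℤ) (V : ℤ → ℤ) : Set where
      field
        origin y : ℤ
        V≡       : ∀ e → V (origin + e) ≡ D e + y
        0≤y      : 0ℤ ≤ y
        y<f      : 1ℤ + y ≤ + f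
        n≤       : n ≤ top + y
        <n       : 1ℤ + (top + y) ≤ n + + f

    -- Subtracting the model from an orbit leaves a function that increases along
    -- J-steps if the orbit crosses n too late, and decreases if it does so too early.
    classify-from : ∀ {n E₀ E} (O : Orbit n q J) → Crossing (Orbit.V O) 0ℤ E₀ → Crossing (Orbit.V O) n E
        → Classified n (Orbit.V O)
    classify-from {n} {E₀} {E} O cr₀ cr = record
      { origin = E₀
      ; y      = δ 0ℤ
      ; V≡     = λ e → trans (recover (V (E₀ + e)) (D e)) (cong (λ x → D e + x) (δ-constant e))
      ; 0≤y    = subst (0ℤ ≤_) (sym y≡) (Crossing.above cr₀ (≤-reflexive (sym (+-identityʳ E₀))))
      ; y<f    = below₀ (δ 0ℤ) (+ f)
          (subst (λ x → 1ℤ + x ≤ 0ℤ) (at -1ℤ D-before-0) (Crossing.below cr₀ (≤-reflexive (back₀ E₀))))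
      ; n≤     = subst (n ≤_) (at last refl) (Crossing.above cr (≤-reflexive (sym E₀+last)))
      ; <n     = belowₙ top (δ 0ℤ) n (+ f) (subst (λ x → 1ℤ + x ≤ n) (at (-1ℤ + last) D-before-last)
                   (Crossing.below cr (≤-reflexive (trans (back₁ E₀ last) E₀+last))))
      }
      where
      open Orbit O
      open Lift lift

      E₁ : ℤ
      E₁ = E - E₀

      δ : ℤ → ℤ
      δ e = V (E₀ + e) - D e

      periodic : ∀ e z → δ (e + z * + q) ≡ δ e
      periodic e z = trans (cong₂ _-_ (trans (cong V (sym (+-assoc E₀ e (z * + q)))) (shift (E₀ + e) z))
          (D-shift e z))
                       (cancel (V (E₀ + e)) (D e) (z * + k))
        where
        cancel : ∀ v d z → v + z - (d + z) ≡ v - d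
        cancel = solve-∀

      V-step : ∀ e → V (E₀ + e) + (e - E₁) /ℕ q ≡ 1ℤ + V (E₀ + (e - J)) + (e - J) /ℕ q
      V-step e = trans (cong (λ x → V (E₀ + e) + x)
          (trans (cong (_/ℕ q) (shift₁ e E E₀)) (sym (crossing-/ℕ lift cr (E₀ + e)))))
          (trans (link (E₀ + e)) (trans (cong Y (cong V (+-assoc E₀ e (- J))))
              (cong (λ x → 1ℤ + V (E₀ + (e - J)) + x) quotient)))
        where
        shift₁ : ∀ e E E₀ → e - (E - E₀) ≡ E₀ + e - E
        shift₁ = solve-∀
        cancel : ∀ x E₀ → E₀ + x - E₀ ≡ x
        cancel = solve-∀
        quotient : V (E₀ + (e - J)) /ℕ k ≡ (e - J) /ℕ q
        quotient = trans (cong (_/ℕ k) (sym (+-identityʳ (V (E₀ + (e - J))))))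
          (trans (crossing-/ℕ lift cr₀ (E₀ + (e - J))) (cong (_/ℕ q) (cancel (e - J) E₀)))

      δ-step : ∀ e → δ e - δ (e - J) ≡ (e - last) /ℕ q - (e - E₁) /ℕ q
      δ-step e = combine (V (E₀ + e)) (V (E₀ + (e - J))) (D e) (D (e - J)) ((e - J) /ℕ q) ((e - last) /ℕ q)
          ((e - E₁) /ℕ q) (V-step e) (D-step e)
        where
        combine : ∀ v v′ d d′ g h x → v + x ≡ 1ℤ + v′ + g → d - d′ ≡ 1ℤ + g - h → v - d - (v′ - d′) ≡ h - x
        combine v v′ d d′ g h x eq₁ eq₂ = trans (expand v v′ d d′ x)
            (trans (cong₂ (λ a b → a - x - v′ - b) eq₁ eq₂) (collect v′ g h x))
          where
          expand : ∀ v v′ d d′ x → v - d - (v′ - d′) ≡ v + x - x - v′ - (d - d′)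
          expand = solve-∀
          collect : ∀ v′ g h x → 1ℤ + v′ + g - x - v′ - (1ℤ + g - h) ≡ h - x
          collect = solve-∀

      before-/ℕ : ∀ a b → 1ℤ + a ≤ b → (a - b) /ℕ q ≤ -1ℤ
      before-/ℕ a b a<b = /ℕ-≤ {a - b} (minus a b (+ q) a<b)
        where
        minus : ∀ a b q → 1ℤ + a ≤ b → 1ℤ + (a - b) ≤ -1ℤ * q + q
        minus a b q h = ⟨ h ⟩ ∴ solve (a ∷ b ∷ q ∷ [])

      self-/ℕ : ∀ a → 0ℤ ≤ (a - a) /ℕ q
      self-/ℕ a = /ℕ-≥ {a - a} {q} {0ℤ} (≤-reflexive (sym (+-inverseʳ a)))

      later : ∀ a b → 1ℤ + a ≤ b → ∀ e → (e - b) /ℕ q ≤ (e - a) /ℕ q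
      later a b a<b e = /ℕ-mono q (+-monoʳ-≤ e (neg-mono-≤ (≤-trans (i≤suc[i] a) a<b)))

      rises : ∀ {x y h g} → x - y ≡ h - g → g ≤ h → y ≤ x
      rises {x} {y} {h} {g} eq g≤h = 0≤i-j⇒j≤i (subst (0ℤ ≤_) (sym eq) ⟨ g≤h ⟩)

      clash : ∀ {x y h g} → x - y ≡ h - g → 0ℤ ≤ h → g ≤ -1ℤ → x ≤ y → ⊥
      clash {x} {y} {h} {g} eq h≥0 g<0 x≤y = bad (x - y) h g eq h≥0 g<0 (i≤j⇒i-j≤0 x≤y)
        where
        bad : ∀ d h g → d ≡ h - g → 0ℤ ≤ h → g ≤ -1ℤ → d ≤ 0ℤ → ⊥
        bad .(h - g) h g refl h₁ h₂ h₃ = linear-⊥ (⟨ h₁ ⟩ ⊕ ⟨ h₂ ⟩ ⊕ ⟨ h₃ ⟩) (solve (h ∷ g ∷ []))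

      negate : ∀ x y h g → x - y ≡ h - g → (- x) - (- y) ≡ g - h
      negate x y h g eq = trans (flip x y) (trans (cong -_ eq) (flip′ h g))
        where
        flip : ∀ x y → (- x) - (- y) ≡ - (x - y)
        flip = solve-∀
        flip′ : ∀ h g → - (h - g) ≡ g - h
        flip′ = solve-∀

      -δ-step : ∀ e → (- δ e) - (- δ (e - J)) ≡ (e - E₁) /ℕ q - (e - last) /ℕ q
      -δ-step e = negate (δ e) (δ (e - J)) ((e - last) /ℕ q) ((e - E₁) /ℕ q) (δ-step e)

      E₁≡last : E₁ ≡ last
      E₁≡last with ≤⊎> E₁ last | ≤⊎> last E₁
      ... | inj₁ le | inj₁ ge = ≤-antisym le ge
      -- At place `last` the two floors differ by at least one, so `δ` would grow strictly at a step
      -- although it closes up. The other case is symmetric, at `E₁`.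
      ... | inj₂ gt | _ = ⊥-elim (clash (δ-step last) (self-/ℕ last) (before-/ℕ last E₁ gt)
              (monotone-periodic δ J periodic (λ e → rises (δ-step e) (later last E₁ gt e)) last))
      ... | inj₁ _ | inj₂ lt = ⊥-elim (clash (-δ-step E₁) (self-/ℕ E₁) (before-/ℕ E₁ last lt)
              (monotone-periodic (λ e → - δ e) J (λ e z → cong -_ (periodic e z))
                  (λ e → rises (-δ-step e) (later E₁ last lt e)) E₁))

      δ-constant : ∀ e → δ e ≡ δ 0ℤ
      δ-constant = unimodular-constant δ J (λ e → i-j≡0⇒i≡j (δ e) (δ (e - J)) (trans (δ-step e)
          (trans (cong (λ x → (e - last) /ℕ q - (e - x) /ℕ q) E₁≡last) (+-inverseʳ ((e - last) /ℕ q)))))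
              unimodular periodic

      E₀+last : E₀ + last ≡ E
      E₀+last = trans (cong (λ x → E₀ + x) (sym E₁≡last)) (restore E E₀)
        where
        restore : ∀ E E₀ → E₀ + (E - E₀) ≡ E
        restore = solve-∀

      recover : ∀ v d → v ≡ d + (v - d)
      recover = solve-∀

      at : ∀ e {d} → D e ≡ d → V (E₀ + e) ≡ d + δ 0ℤ
      at e refl = trans (recover (V (E₀ + e)) (D e)) (cong (λ x → D e + x) (δ-constant e))

      y≡ : δ 0ℤ ≡ V (E₀ + 0ℤ)
      y≡ = trans (cong (λ d → V (E₀ + 0ℤ) - d) D-0) (+-identityʳ _)

      back₀ : ∀ E → 1ℤ + (E + -1ℤ) ≡ E
      back₀ = solve-∀
      back₁ : ∀ E x → 1ℤ + (E + (-1ℤ + x)) ≡ E + x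
      back₁ = solve-∀
      below₀ : ∀ y f → 1ℤ + (0ℤ - f + y) ≤ 0ℤ → 1ℤ + y ≤ f
      below₀ y f h = ⟨ h ⟩ ∴ solve (y ∷ f ∷ [])
      belowₙ : ∀ t y n f → 1ℤ + (t - f + y) ≤ n → 1ℤ + (t + y) ≤ n + f
      belowₙ t y n f h = ⟨ h ⟩ ∴ solve (t ∷ y ∷ n ∷ f ∷ [])

    classify : ∀ {n} (O : Orbit n q J) → Classified n (Orbit.V O)
    classify {n} O = classify-from O (proj₂ (crossing (Orbit.lift O) 0ℤ)) (proj₂ (crossing (Orbit.lift O) n))

-- Comparing dimensions of subspaces

module Dimension where

  open import Defs
  open import Algebra.Bundles using (CommutativeRing)
  open import Data.Empty using (⊥; ⊥-elim)
  open import Data.Fin.Base using (Fin; zero; suc)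
  open import Data.Fin.Properties using (any?)
  open import Data.Nat.Base as ℕ using (ℕ; zero; suc)
  import Data.Nat.Properties as ℕ
  open import Data.Product.Base using (∃-syntax; _×_; _,_; proj₁; proj₂)
  open import Data.Rational.Base using (ℚ; 0ℚ; 1ℚ; _+_; _*_; _-_; -_; 1/_; ≢-nonZero)
  open import Data.Rational.Properties
  open import Data.Rational.Solver using (module +-*-Solver)
  open import Data.Vec.Functional using (Vector)
  open import Algebra.Properties.Semiring.Sum (CommutativeRing.semiring +-*-commutativeRing)
  open import Relation.Binary.PropositionalEquality
  open import Relation.Nullary.Decidable using (yes; no; ¬?)
  open +-*-Solver using (solve; con; _:=_; _:*_; :-_)

  sum-≡0 : ∀ {n} (f : Vector ℚ n) → (∀ i → f i ≡ 0ℚ) → sum f ≡ 0ℚ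
  sum-≡0 {n} f f≡0 = trans (sum-cong-≗ f≡0) (sum-replicate-zero n)

  ·-congʳ : ∀ {n} (φ : Vector ℚ n) {u w : Vector ℚ n} → (∀ x → u x ≡ w x) → φ · u ≡ φ · w
  ·-congʳ φ u≗w = sum-cong-≗ (λ x → cong (φ x *_) (u≗w x))

  ·-+ˡ : ∀ {n} (φ ψ u : Vector ℚ n) → (λ x → φ x + ψ x) · u ≡ φ · u + ψ · u
  ·-+ˡ φ ψ u = trans (sum-cong-≗ (λ x → *-distribʳ-+ (u x) (φ x) (ψ x)))
      (∑-distrib-+ (λ x → φ x * u x) (λ x → ψ x * u x))

  ·-negˡ : ∀ {n} (φ u : Vector ℚ n) → (λ x → - φ x) · u ≡ - (φ · u)
  ·-negˡ φ u = begin
    (λ x → - φ x) · u                   ≡⟨ sum-cong-≗ (λ x → neg-one (φ x) (u x)) ⟩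
    sum (λ x → (- 1ℚ) * (φ x * u x))    ≡⟨ *-distribˡ-sum (- 1ℚ) (λ x → φ x * u x) ⟨
    (- 1ℚ) * (φ · u)                    ≡⟨ one-neg (φ · u) ⟩
    - (φ · u)                           ∎
    where
    open ≡-Reasoning
    neg-one : ∀ a b → - a * b ≡ (- 1ℚ) * (a * b)
    neg-one = solve 2 (λ a b → :- a :* b := (:- con 1ℚ) :* (a :* b)) refl
    one-neg : ∀ a → (- 1ℚ) * a ≡ - a
    one-neg = solve 1 (λ a → (:- con 1ℚ) :* a := :- a) refl

  ·-combineʳ : ∀ {d n} (φ : Vector ℚ n) (c : Vector ℚ d) (v : Fin d → Vector ℚ n) →
               φ · combine c v ≡ combine c (λ i (_ : Fin 1) → φ · v i) zero
  ·-combineʳ {d} {n} φ c v = begin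
    ∑[ x < n ] (φ x * ∑[ i < d ] (c i * v i x))   ≡⟨ sum-cong-≗
        (λ x → *-distribˡ-sum (φ x) (λ i → c i * v i x)) ⟩
    ∑[ x < n ] ∑[ i < d ] (φ x * (c i * v i x))   ≡⟨ ∑-comm (λ x i → φ x * (c i * v i x)) ⟩
    ∑[ i < d ] ∑[ x < n ] (φ x * (c i * v i x))   ≡⟨ sum-cong-≗
        (λ i → sum-cong-≗ (λ x → swap (φ x) (c i) (v i x))) ⟩
    ∑[ i < d ] ∑[ x < n ] (c i * (φ x * v i x))   ≡⟨ sum-cong-≗
        (λ i → *-distribˡ-sum (c i) (λ x → φ x * v i x)) ⟨
    ∑[ i < d ] (c i * (φ · v i))                  ∎
    where
    open ≡-Reasoning
    swap : ∀ a b c → a * (b * c) ≡ b * (a * c)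
    swap = solve 3 (λ a b c → a :* (b :* c) := b :* (a :* c)) refl

  Kernel-combine : ∀ {m n d} (B : Matrix m n) (c : Vector ℚ d) (v : Fin d → Vector ℚ n) →
                   (∀ i → Kernel B (v i)) → Kernel B (combine c v)
  Kernel-combine B c v v∈K r = trans (·-combineʳ (B r) c v)
    (sum-≡0 _ (λ i → trans (cong (c i *_) (v∈K i r)) (*-zeroʳ (c i))))

  -- Follows the elimination that computes `nullity`: each further row removes at most one basis
  -- vector.
  columns≤nullity+rows : ∀ {m n} (B : Matrix m n) → n ℕ.≤ nullity B ℕ.+ m
  columns≤nullity+rows {zero} {n} B = ℕ.≤-reflexive (sym (ℕ.+-identityʳ n))
  columns≤nullity+rows {suc m} {n} B with hasNullity (λ i → B (suc i)) | columns≤nullity+rows (λ i → B (suc i))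
  ... | d , v , basis | n≤ with any? (λ p → ¬? (B zero · v p ≟ 0ℚ))
  ... | no _ = ℕ.≤-trans n≤ (ℕ.+-monoʳ-≤ d (ℕ.n≤1+n m))
  columns≤nullity+rows {suc m} {n} B | suc d , v , basis | n≤ | yes _ = subst (n ℕ.≤_) (sym (ℕ.+-suc d m)) n≤


  nonzero-solution : ∀ {m n} (B : Matrix m n) → m ℕ.< n → ∃[ u ] Kernel B u × ((∀ x → u x ≡ 0ℚ) → ⊥)
  nonzero-solution {m} {n} B m<n with nullity B | nullity-isNullity B | columns≤nullity+rows B
  ... | zero  | _ | n≤m = ⊥-elim (ℕ.<⇒≱ m<n n≤m)
  ... | suc d | v , basis | _ = v zero , member zero ,
        λ v≡0 → 1≢0 (independent first (λ x → trans (cong₂ _+_ (trans (*-identityˡ (v zero x)) (v≡0 x))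
          (sum-≡0 _ (λ i → *-zeroˡ (v (suc i) x)))) (+-identityˡ 0ℚ)) zero)
    where
    open IsBasis basis
    first : Vector ℚ (suc d)
    first zero    = 1ℚ
    first (suc _) = 0ℚ

  Independent : ∀ {d n} → (Fin d → Vector ℚ n) → Set
  Independent v = ∀ c → (∀ x → combine c v x ≡ 0ℚ) → ∀ i → c i ≡ 0ℚ

  -- Otherwise the coordinates in the basis form a system with fewer equations than unknowns, and a
  -- nonzero solution of it is a linear dependence.
  independent⇒≤ : ∀ {d d′ n} {W : Vector ℚ n → Set} {v : Fin d → Vector ℚ n} {v′ : Fin d′ → Vector ℚ n} →
                  Independent v → (∀ i → W (v i)) → IsBasis W v′ → d ℕ.≤ d′
  independent⇒≤ {d} {d′} {n} {W} {v} {v′} independent v∈W basis with d ℕ.≤? d′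
  ... | yes d≤d′ = d≤d′
  ... | no  d≰d′ with nonzero-solution (λ j i → proj₁ (IsBasis.spanning basis (v i) (v∈W i)) j) (ℕ.≰⇒> d≰d′)
  ...   | c , c∈K , c≢0 = ⊥-elim (c≢0 (independent c dependence))
    where
    open ≡-Reasoning
    γ : Fin d → Vector ℚ d′
    γ i = proj₁ (IsBasis.spanning basis (v i) (v∈W i))
    swap : ∀ a b c → a * (b * c) ≡ (b * a) * c
    swap = solve 3 (λ a b c → a :* (b :* c) := (b :* a) :* c) refl
    dependence : ∀ x → combine c v x ≡ 0ℚ
    dependence x = begin
      ∑[ i < d ] (c i * v i x)                               ≡⟨ sum-cong-≗
          (λ i → cong (c i *_) (proj₂ (IsBasis.spanning basis (v i) (v∈W i)) x)) ⟩
      ∑[ i < d ] (c i * ∑[ j < d′ ] (γ i j * v′ j x))        ≡⟨ sum-cong-≗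
          (λ i → *-distribˡ-sum (c i) (λ j → γ i j * v′ j x)) ⟩
      ∑[ i < d ] ∑[ j < d′ ] (c i * (γ i j * v′ j x))        ≡⟨ ∑-comm (λ i j → c i * (γ i j * v′ j x)) ⟩
      ∑[ j < d′ ] ∑[ i < d ] (c i * (γ i j * v′ j x))        ≡⟨ sum-cong-≗
          (λ j → sum-cong-≗ (λ i → swap (c i) (γ i j) (v′ j x))) ⟩
      ∑[ j < d′ ] ∑[ i < d ] ((γ i j * c i) * v′ j x)        ≡⟨ sum-cong-≗
          (λ j → *-distribʳ-sum (v′ j x) (λ i → γ i j * c i)) ⟨
      ∑[ j < d′ ] ((∑[ i < d ] (γ i j * c i)) * v′ j x)      ≡⟨ sum-≡0 _
          (λ j → trans (cong (_* v′ j x) (c∈K j)) (*-zeroˡ (v′ j x))) ⟩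
      0ℚ                                                     ∎

  subspace⇒≤ : ∀ {d d′ n} {W W′ : Vector ℚ n → Set} {v : Fin d → Vector ℚ n} {v′ : Fin d′ → Vector ℚ n} →
               IsBasis W v → IsBasis W′ v′ → (∀ u → W u → W′ u) → d ℕ.≤ d′
  subspace⇒≤ basis basis′ W⊆W′ =
    independent⇒≤ (IsBasis.independent basis) (λ i → W⊆W′ _ (IsBasis.member basis i)) basis′

  *-cancel-0 : ∀ {a b} → b ≢ 0ℚ → a * b ≡ 0ℚ → a ≡ 0ℚ
  *-cancel-0 {a} {b} b≢0 ab≡0 = begin
    a                 ≡⟨ *-identityʳ a ⟨
    a * 1ℚ            ≡⟨ cong (a *_) (*-inverseʳ b) ⟨
    a * (b * 1/ b)    ≡⟨ *-assoc a b (1/ b) ⟨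
    (a * b) * 1/ b    ≡⟨ cong (_* 1/ b) ab≡0 ⟩
    0ℚ * 1/ b         ≡⟨ *-zeroˡ (1/ b) ⟩
    0ℚ                ∎
    where
    open ≡-Reasoning
    instance _ = ≢-nonZero b≢0

  -- The coordinate `p` separates `w` from the smaller space, so `w` can be added to a basis of that
  -- space without losing independence.
  proper-subspace⇒< : ∀ {d d′ n} {W W′ : Vector ℚ n → Set} {v : Fin d → Vector ℚ n} {v′ : Fin d′ → Vector ℚ n} →
                      IsBasis W v → IsBasis W′ v′ → (∀ u → W u → W′ u) →
                      ∀ p → (∀ u → W u → u p ≡ 0ℚ) → ∀ w → W′ w → w p ≢ 0ℚ → d ℕ.< d′
  proper-subspace⇒< {d} {n = n} {W} {W′} {v} basis basis′ W⊆W′ p W≡0 w w∈W′ wp≢0 =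
    independent⇒≤ {v = v⁺} independent⁺ v⁺∈W′ basis′
    where
    v⁺ : Fin (suc d) → Vector ℚ n
    v⁺ zero    = w
    v⁺ (suc i) = v i
    v⁺∈W′ : ∀ i → W′ (v⁺ i)
    v⁺∈W′ zero    = w∈W′
    v⁺∈W′ (suc i) = W⊆W′ _ (IsBasis.member basis i)
    independent⁺ : Independent v⁺
    independent⁺ c c≡0 = λ { zero → c0≡0 ; (suc i) → IsBasis.independent basis (λ i → c (suc i)) rest i }
      where
      open ≡-Reasoning
      c0≡0 : c zero ≡ 0ℚ
      c0≡0 = *-cancel-0 wp≢0 (begin
        c zero * w p                                        ≡⟨ +-identityʳ _ ⟨
        c zero * w p + 0ℚ                                   ≡⟨ cong (λ z → c zero * w p + z) (sum-≡0 _ (λ i →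
                                                                 trans (cong (c (suc i) *_)
                                                                     (W≡0 (v i) (IsBasis.member basis i)))
                                                                     (*-zeroʳ (c (suc i))))) ⟨
        c zero * w p + combine (λ i → c (suc i)) v p        ≡⟨ c≡0 p ⟩
        0ℚ                                                  ∎)
      rest : ∀ x → combine (λ i → c (suc i)) v x ≡ 0ℚ
      rest x = begin
        combine (λ i → c (suc i)) v x                       ≡⟨ +-identityˡ _ ⟨
        0ℚ + combine (λ i → c (suc i)) v x                  ≡⟨ cong (_+ combine (λ i → c (suc i)) v x)
            (trans (cong (_* w x) c0≡0) (*-zeroˡ (w x))) ⟨
        c zero * w x + combine (λ i → c (suc i)) v x        ≡⟨ c≡0 x ⟩
        0ℚ                                                  ∎

-- From the kernel of `A(n,k)` to invariant functions on the vertices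

module PrefixSums where

  open Circle
  open Dimension
  open import Defs using (_·_; Kernel; combine; IsBasis; A)
  open import Algebra.Bundles using (CommutativeRing)
  open import Data.Bool.Base using (if_then_else_)
  open import Data.Fin.Base using (Fin; zero; suc; toℕ; fromℕ<)
  import Data.Fin.Properties as Fin
  open import Data.Integer.Base as ℤ using (ℤ; +_; 0ℤ; 1ℤ)
  open import Data.Integer.DivMod using (_/ℕ_; _%ℕ_; a≡a%ℕn+[a/ℕn]*n; n%ℕd<d)
  import Data.Integer.Properties as ℤ
  import Data.Integer.Tactic.RingSolver as ℤ
  open import Data.Nat.Base as ℕ using (ℕ; zero; suc; NonZero; z≤n; s≤s)
  open import Data.Nat.DivMod using (m<n⇒m%n≡m; m<n⇒m/n≡0)
  open import Data.Nat.Induction using (<-rec)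
  import Data.Nat.Properties as ℕ
  open import Data.Product.Base using (∃-syntax; _×_; _,_; proj₁; proj₂)
  open import Data.Rational.Base using (ℚ; 0ℚ; 1ℚ; _+_; _*_; _-_; -_)
  open import Data.Rational.Properties
  open import Data.Rational.Solver using (module +-*-Solver)
  open import Data.Vec.Functional using (Vector)
  open import Algebra.Properties.Semiring.Sum (CommutativeRing.semiring +-*-commutativeRing)
  open import Relation.Binary.Definitions using (tri<; tri≈; tri>)
  open import Relation.Binary.PropositionalEquality
  open import Relation.Nullary.Decidable using (yes; no; dec-true; dec-false; does; Dec; _×-dec_)
  open +-*-Solver using (solve; con; _:=_; _:+_; _:*_; _:-_; :-_)

  step-induction : ∀ s .{{_ : NonZero s}} (P : ℕ → Set) → (∀ l → l ℕ.< s → P l) →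
      (∀ i → P i → P (s ℕ.+ i)) → ∀ l → P l
  step-induction s@(suc _) P base step = <-rec P go
    where
    go : ∀ l → (∀ {i} → i ℕ.< l → P i) → P l
    go l rec with l ℕ.<? s
    ... | yes l<s = base l l<s
    ... | no  l≮s = subst P (ℕ.m+[n∸m]≡n s≤l) (step (l ℕ.∸ s) (rec (ℕ.∸-monoʳ-< (s≤s z≤n) s≤l)))
      where s≤l = ℕ.≮⇒≥ l≮s

  -- Partial sums are dot products with these rows, hence linear. For `h` beyond `n` the row stays
  -- all ones, which lets `S` be used past the end of the vector.
  prefix : ∀ {n} → ℕ → Vector ℚ n
  prefix zero    _       = 0ℚ
  prefix (suc h) zero    = 1ℚ
  prefix (suc h) (suc x) = prefix h x

  prefix-< : ∀ {n} h (x : Fin n) → toℕ x ℕ.< h → prefix h x ≡ 1ℚ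
  prefix-< (suc h) zero    _         = refl
  prefix-< (suc h) (suc x) (s≤s x<h) = prefix-< h x x<h

  prefix-≥ : ∀ {n} h (x : Fin n) → h ℕ.≤ toℕ x → prefix h x ≡ 0ℚ
  prefix-≥ zero    x       _         = refl
  prefix-≥ (suc h) (suc x) (s≤s h≤x) = prefix-≥ h x h≤x

  S : ∀ {n} → Vector ℚ n → ℕ → ℚ
  S u h = prefix h · u

  S-0 : ∀ {n} (u : Vector ℚ n) → S u 0 ≡ 0ℚ
  S-0 u = sum-≡0 _ (λ x → *-zeroˡ (u x))

  S-suc : ∀ {n} (u : Vector ℚ n) x → S u (suc (toℕ x)) ≡ S u (toℕ x) + u x
  S-suc u zero = trans (cong₂ _+_ (*-identityˡ (u zero)) (S-0 (λ x → u (suc x))))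
    (trans (+-identityʳ (u zero)) (sym (trans (cong (_+ u zero) (S-0 u)) (+-identityˡ (u zero)))))
  S-suc u (suc x) = trans (cong (λ z → 1ℚ * u zero + z) (S-suc (λ x → u (suc x)) x))
      (sym (+-assoc (1ℚ * u zero) _ (u (suc x))))

  S-beyond : ∀ {n} (u : Vector ℚ n) {h} → n ℕ.≤ h → S u h ≡ S u n
  S-beyond {n} u {h} n≤h = sum-cong-≗ (λ x → cong (_* u x)
    (trans (prefix-< h x (ℕ.<-≤-trans (Fin.toℕ<n x) n≤h)) (sym (prefix-< n x (Fin.toℕ<n x)))))

  S-differences : ∀ n (σ : ℕ → ℚ) h → h ℕ.≤ n → S {n} (λ x → σ (suc (toℕ x)) - σ (toℕ x)) h ≡ σ h - σ 0
  S-differences n       σ zero    _         = trans (S-0 {n} (λ x → σ (suc (toℕ x)) - σ (toℕ x)))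
      (sym (+-inverseʳ (σ 0)))
  S-differences (suc n) σ (suc h) (s≤s h≤n) = trans
      (cong (λ z → 1ℚ * (σ 1 - σ 0) + z) (S-differences n (λ l → σ (suc l)) h h≤n))
    (telescope (σ 0) (σ 1) (σ (suc h)))
    where
    telescope : ∀ a b c → 1ℚ * (b - a) + (c - b) ≡ c - a
    telescope = solve 3 (λ a b c → con 1ℚ :* (b :- a) :+ (c :- b) := c :- a) refl

  module _ (n k : ℕ) where

    private
      InBand? : ∀ a b → Dec (a ℕ.< b × b ℕ.≤ a ℕ.+ k)
      InBand? a b = a ℕ.<? b ×-dec b ℕ.≤? a ℕ.+ k

      entry : ∀ {b₁ b₂} (i x : Fin n) → does (InBand? (toℕ i) (toℕ x)) ≡ b₁ → does
          (InBand? (toℕ x) (toℕ i)) ≡ b₂ →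
              A n k i x ≡ (if b₁ then 1ℚ else if b₂ then - 1ℚ else 0ℚ)
      entry i x refl refl = refl

    -- Row `i` is the indicator of the `k` columns after `i` minus that of the `k` columns before
    -- it. The matrix border needs no separate treatment: `prefix` saturates on the right, and `∸`
    -- truncates on the left.
    A-band : ∀ i x → A n k i x ≡ (prefix (suc (toℕ i ℕ.+ k)) x - prefix (suc (toℕ i)) x) -
        (prefix (toℕ i) x - prefix (toℕ i ℕ.∸ k) x)
    A-band i x with ℕ.<-cmp (toℕ i) (toℕ x)
    ... | tri≈ i≮x i≡x x≮i = trans
        (entry i x (dec-false (InBand? (toℕ i) (toℕ x)) (λ p → i≮x (proj₁ p)))
        (dec-false (InBand? (toℕ x) (toℕ i)) (λ p → x≮i (proj₁ p))))
      (sym (values (prefix-< _ x (s≤s (ℕ.≤-trans (ℕ.≤-reflexive (sym i≡x)) (ℕ.m≤m+n _ k))))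
          (prefix-< _ x (s≤s (ℕ.≤-reflexive (sym i≡x))))
        (prefix-≥ _ x (ℕ.≤-reflexive i≡x)) (prefix-≥ _ x (ℕ.≤-trans (ℕ.m∸n≤m _ k) (ℕ.≤-reflexive i≡x)))))
      where
      values : ∀ {a b c d} → a ≡ 1ℚ → b ≡ 1ℚ → c ≡ 0ℚ → d ≡ 0ℚ → (a - b) - (c - d) ≡ 0ℚ
      values refl refl refl refl = refl
    ... | tri< i<x _ x≮i with toℕ x ℕ.≤? toℕ i ℕ.+ k
    ...   | yes x≤i+k = trans
        (entry i x (dec-true (InBand? (toℕ i) (toℕ x)) (i<x , x≤i+k))
        (dec-false (InBand? (toℕ x) (toℕ i)) (λ p → x≮i (proj₁ p))))
      (sym (values (prefix-< _ x (s≤s x≤i+k)) (prefix-≥ _ x i<x) (prefix-≥ _ x (ℕ.<⇒≤ i<x))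
          (prefix-≥ _ x (ℕ.≤-trans (ℕ.m∸n≤m _ k) (ℕ.<⇒≤ i<x)))))
      where
      values : ∀ {a b c d} → a ≡ 1ℚ → b ≡ 0ℚ → c ≡ 0ℚ → d ≡ 0ℚ → (a - b) - (c - d) ≡ 1ℚ
      values refl refl refl refl = refl
    ...   | no  x≰i+k = trans
        (entry i x (dec-false (InBand? (toℕ i) (toℕ x)) (λ p → x≰i+k (proj₂ p)))
        (dec-false (InBand? (toℕ x) (toℕ i)) (λ p → x≮i (proj₁ p))))
      (sym (values (prefix-≥ _ x (ℕ.≰⇒> x≰i+k)) (prefix-≥ _ x i<x) (prefix-≥ _ x (ℕ.<⇒≤ i<x))
          (prefix-≥ _ x (ℕ.≤-trans (ℕ.m∸n≤m _ k) (ℕ.<⇒≤ i<x)))))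
      where
      values : ∀ {a b c d} → a ≡ 0ℚ → b ≡ 0ℚ → c ≡ 0ℚ → d ≡ 0ℚ → (a - b) - (c - d) ≡ 0ℚ
      values refl refl refl refl = refl
    A-band i x | tri> i≮x _ x<i with toℕ i ℕ.≤? toℕ x ℕ.+ k
    ...   | yes i≤x+k = trans
        (entry i x (dec-false (InBand? (toℕ i) (toℕ x)) (λ p → i≮x (proj₁ p)))
        (dec-true (InBand? (toℕ x) (toℕ i)) (x<i , i≤x+k)))
      (sym (values (prefix-< _ x (s≤s (ℕ.≤-trans (ℕ.<⇒≤ x<i) (ℕ.m≤m+n _ k)))) (prefix-< _ x (s≤s (ℕ.<⇒≤ x<i)))
          (prefix-< _ x x<i)
        (prefix-≥ _ x (ℕ.≤-trans (ℕ.∸-monoˡ-≤ k i≤x+k) (ℕ.≤-reflexive (ℕ.m+n∸n≡m _ k))))))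
      where
      values : ∀ {a b c d} → a ≡ 1ℚ → b ≡ 1ℚ → c ≡ 1ℚ → d ≡ 0ℚ → (a - b) - (c - d) ≡ - 1ℚ
      values refl refl refl refl = refl
    ...   | no  i≰x+k = trans
        (entry i x (dec-false (InBand? (toℕ i) (toℕ x)) (λ p → i≮x (proj₁ p)))
        (dec-false (InBand? (toℕ x) (toℕ i)) (λ p → i≰x+k (proj₂ p))))
      (sym (values (prefix-< _ x (s≤s (ℕ.≤-trans (ℕ.<⇒≤ x<i) (ℕ.m≤m+n _ k)))) (prefix-< _ x (s≤s (ℕ.<⇒≤ x<i)))
          (prefix-< _ x x<i)
        (prefix-< _ x (ℕ.m+n≤o⇒m≤o∸n _ (ℕ.≰⇒> i≰x+k)))))
      where
      values : ∀ {a b c d} → a ≡ 1ℚ → b ≡ 1ℚ → c ≡ 1ℚ → d ≡ 1ℚ → (a - b) - (c - d) ≡ 0ℚ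
      values refl refl refl refl = refl

    A-row : ∀ i u → A n k i · u ≡ (S u (suc (toℕ i ℕ.+ k)) - S u (suc (toℕ i))) -
        (S u (toℕ i) - S u (toℕ i ℕ.∸ k))
    A-row i u = begin
      A n k i · u                                   ≡⟨ sum-cong-≗ (λ x → cong (_* u x) (A-band i x)) ⟩
      (λ x → (p₁ x - p₂ x) - (p₃ x - p₄ x)) · u     ≡⟨ minus (λ x → p₁ x - p₂ x) (λ x → p₃ x - p₄ x) ⟩
      (λ x → p₁ x - p₂ x) · u - (λ x → p₃ x - p₄ x) · u    ≡⟨ cong₂ _-_ (minus p₁ p₂) (minus p₃ p₄) ⟩
      (p₁ · u - p₂ · u) - (p₃ · u - p₄ · u)         ∎
      where
      open ≡-Reasoning
      p₁ p₂ p₃ p₄ : Vector ℚ n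
      p₁ = prefix (suc (toℕ i ℕ.+ k))
      p₂ = prefix (suc (toℕ i))
      p₃ = prefix (toℕ i)
      p₄ = prefix (toℕ i ℕ.∸ k)
      minus : ∀ φ ψ → (λ x → φ x - ψ x) · u ≡ φ · u - ψ · u
      minus φ ψ = trans (·-+ˡ φ (λ x → - ψ x) u) (cong (λ z → φ · u + z) (·-negˡ ψ u))

  module Invariants (k : ℕ) .{{k≢0 : NonZero k}} where

    open Dynamics k

    at : Vector ℚ (suc k) → ℤ → ℚ
    at x P = x (fromℕ< (n%ℕd<d P (suc k)))

    at-% : ∀ x P Q → P %ℕ suc k ≡ Q %ℕ suc k → at x P ≡ at x Q
    at-% x P Q eq = cong x (Fin.fromℕ<-cong _ _ eq _ _)

    at-shift : ∀ x P z → at x (P ℤ.+ z ℤ.* + suc k) ≡ at x P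
    at-shift x P z = at-% x (P ℤ.+ z ℤ.* + suc k) P (%ℕ-shift P z (suc k))

    at-toℕ : ∀ x i → at x (+ toℕ i) ≡ x i
    at-toℕ x i = cong x (Fin.toℕ-injective (trans (Fin.toℕ-fromℕ< _) (m<n⇒m%n≡m (Fin.toℕ<n i))))

    at-start : ∀ x → at x 0ℤ ≡ x zero
    at-start x = at-toℕ x zero

    -- The functions on the vertices of G(n,k) that are constant along the edges
    -- and vanish at vertex k, which is position 0.
    record Invariant (n : ℤ) (x : Vector ℚ (suc k)) : Set where
      field
        start≡0  : x zero ≡ 0ℚ
        constant : ∀ v → at x (X n v) ≡ at x (Y v)

    private
      Y-small : ∀ {v} → v ℕ.< k → Y (+ v) ≡ + suc v
      Y-small {v} v<k = trans (cong (λ g → 1ℤ ℤ.+ + v ℤ.+ + g) (m<n⇒m/n≡0 v<k)) (ℤ.+-identityʳ _)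

      Y-next : ∀ i → Y (+ (k ℕ.+ i)) ≡ Y (+ i) ℤ.+ 1ℤ ℤ.* + suc k
      Y-next i = trans (cong Y (trans (ℤ.pos-+ k i) (swap (+ k) (+ i)))) (Y.shift (+ i) 1ℤ)
        where
        swap : ∀ κ i → κ ℤ.+ i ≡ i ℤ.+ 1ℤ ℤ.* κ
        swap = ℤ.solve-∀

      suc-next : ∀ i → + (suc k ℕ.+ i) ≡ + i ℤ.+ 1ℤ ℤ.* + suc k
      suc-next i = trans (ℤ.pos-+ (suc k) i) (swap (+ suc k) (+ i))
        where
        swap : ∀ κ i → κ ℤ.+ i ≡ i ℤ.+ 1ℤ ℤ.* κ
        swap = ℤ.solve-∀

      X-window : ∀ n r → r ℕ.< k → X (+ n) (+ (n ℕ.+ r)) ≡ + (n ℕ.+ r)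
      X-window n r r<k = trans (cong (λ d → + (n ℕ.+ r) ℤ.+ d /ℕ k)
          (trans (cong (ℤ._- + n) (ℤ.pos-+ n r)) (cancel (+ n) (+ r))))
        (trans (cong (λ g → + (n ℕ.+ r) ℤ.+ + g) (m<n⇒m/n≡0 r<k)) (ℤ.+-identityʳ _))
        where
        cancel : ∀ n r → n ℤ.+ r ℤ.- n ≡ r
        cancel = ℤ.solve-∀

      a-b≡0⇒ : ∀ {a b} → a - b ≡ 0ℚ → a ≡ b
      a-b≡0⇒ {a} {b} eq = trans (split a b) (trans (cong (_+ b) eq) (+-identityˡ b))
        where
        split : ∀ a b → a ≡ a - b + b
        split = solve 2 (λ a b → a := a :- b :+ b) refl

    sums : ∀ {n} → Vector ℚ n → Vector ℚ (suc k)
    sums u i = S u (toℕ i)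

    at-sums : ∀ {n} (u : Vector ℚ n) {l} → l ℕ.≤ k → at (sums u) (+ l) ≡ S u l
    at-sums u l≤k = cong (S u) (trans (Fin.toℕ-fromℕ< _) (m<n⇒m%n≡m (s≤s l≤k)))

    module _ {n : ℕ} (u : Vector ℚ n) (u∈K : Kernel (A n k) u) where

      private
        row : ∀ i → i ℕ.< n → S u (suc (i ℕ.+ k)) - S u (suc i) ≡ S u i - S u (i ℕ.∸ k)
        row i i<n = subst (λ a → S u (suc (a ℕ.+ k)) - S u (suc a) ≡ S u a - S u (a ℕ.∸ k)) (Fin.toℕ-fromℕ< i<n)
          (a-b≡0⇒ (trans (sym (A-row n k (fromℕ< i<n) u)) (u∈K (fromℕ< i<n))))

        zero-diff : ∀ {l} → l ℕ.≤ k → ∀ a → a - S u (l ℕ.∸ k) ≡ a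
        zero-diff l≤k a = trans (cong (λ h → a - S u h) (ℕ.m≤n⇒m∸n≡0 l≤k))
            (trans (cong (λ z → a - z) (S-0 u)) (+-identityʳ a))

      -- The sums of k, respectively k + 1, consecutive entries are periodic with
      -- period k + 1, respectively k.
      sums-k : ∀ l → l ℕ.≤ n ℕ.+ k → S u l - S u (l ℕ.∸ k) ≡ at (sums u) (+ l)
      sums-k = step-induction (suc k) _
        (λ { l (s≤s l≤k) _ → trans (zero-diff l≤k (S u l)) (sym (at-sums u l≤k)) })
        (λ i IH le → let i<n = ℕ.+-cancelʳ-< k i n (subst (ℕ._≤ n ℕ.+ k) (cong suc (ℕ.+-comm k i)) le) in begin
          S u (suc k ℕ.+ i) - S u (suc k ℕ.+ i ℕ.∸ k)    ≡⟨ cong₂ (λ a b → S u a - S u b)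
              (cong suc (ℕ.+-comm k i))
                                                              (trans (cong (ℕ._∸ k) (sym (ℕ.+-suc k i)))
                                                                  (ℕ.m+n∸m≡n k (suc i))) ⟩
          S u (suc (i ℕ.+ k)) - S u (suc i)              ≡⟨ row i i<n ⟩
          S u i - S u (i ℕ.∸ k)                          ≡⟨ IH (ℕ.≤-trans (ℕ.<⇒≤ i<n) (ℕ.m≤m+n n k)) ⟩
          at (sums u) (+ i)                              ≡⟨ at-shift (sums u) (+ i) 1ℤ ⟨
          at (sums u) (+ i ℤ.+ 1ℤ ℤ.* + suc k)           ≡⟨ cong (at (sums u)) (suc-next i) ⟨
          at (sums u) (+ (suc k ℕ.+ i))                  ∎)
        where open ≡-Reasoning

      sums-suc-k : ∀ v → v ℕ.< n ℕ.+ k → S u (suc v) - S u (v ℕ.∸ k) ≡ at (sums u) (Y (+ v))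
      sums-suc-k = step-induction k _
        (λ v v<k _ → trans (zero-diff (ℕ.<⇒≤ v<k) (S u (suc v)))
            (trans (sym (at-sums u v<k)) (cong (at (sums u)) (sym (Y-small v<k)))))
        (λ i IH lt → let i<n = ℕ.+-cancelʳ-< k i n (subst (ℕ._< n ℕ.+ k) (ℕ.+-comm k i) lt) in begin
          S u (suc (k ℕ.+ i)) - S u (k ℕ.+ i ℕ.∸ k)      ≡⟨ cong₂ (λ a b → S u a - S u b)
              (cong suc (ℕ.+-comm k i)) (ℕ.m+n∸m≡n k i) ⟩
          S u (suc (i ℕ.+ k)) - S u i                    ≡⟨ exchange (S u (suc (i ℕ.+ k))) (S u (suc i)) (S u i)
              (S u (i ℕ.∸ k)) (row i i<n) ⟩
          S u (suc i) - S u (i ℕ.∸ k)                    ≡⟨ IH (ℕ.<-≤-trans i<n (ℕ.m≤m+n n k)) ⟩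
          at (sums u) (Y (+ i))                          ≡⟨ at-shift (sums u) (Y (+ i)) 1ℤ ⟨
          at (sums u) (Y (+ i) ℤ.+ 1ℤ ℤ.* + suc k)       ≡⟨ cong (at (sums u)) (Y-next i) ⟨
          at (sums u) (Y (+ (k ℕ.+ i)))                  ∎)
        where
        open ≡-Reasoning
        exchange : ∀ a b c d → a - b ≡ c - d → a - c ≡ b - d
        exchange a b c d eq = trans (expand a b c) (trans (cong (λ z → z + b - c) eq) (collect b c d))
          where
          expand : ∀ a b c → a - c ≡ a - b + b - c
          expand = solve 3 (λ a b c → a :- c := a :- b :+ b :- c) refl
          collect : ∀ b c d → c - d + b - c ≡ b - d
          collect = solve 3 (λ b c d → c :- d :+ b :- c := b :- d) refl

      -- Past index `n` the partial sums stand still, so at the edges `n`, ..., `n + k − 1` the sum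
      -- of `k` entries and the sum of `k + 1` entries coincide. By the two periodicities these are
      -- the values at the source and at the target. Any other edge is one of these up to turns.
      sums-invariant : Invariant (+ n) (sums u)
      sums-invariant = record { start≡0 = S-0 u ; constant = constant }
        where
        open ≡-Reasoning
        constant : ∀ v → at (sums u) (X (+ n) v) ≡ at (sums u) (Y v)
        constant v = begin
          at (sums u) (X (+ n) v)                           ≡⟨ cong (λ w → at (sums u) (X (+ n) w)) v≡ ⟩
          at (sums u) (X (+ n) (+ w ℤ.+ g ℤ.* + k))         ≡⟨ cong (at (sums u)) (X.shift (+ n) (+ w) g) ⟩
          at (sums u) (X (+ n) (+ w) ℤ.+ g ℤ.* + suc k)     ≡⟨ at-shift (sums u) (X (+ n) (+ w)) g ⟩
          at (sums u) (X (+ n) (+ w))                       ≡⟨ cong (at (sums u)) (X-window n r r<k) ⟩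
          at (sums u) (+ w)                                 ≡⟨ sums-k w (ℕ.<⇒≤ w<n+k) ⟨
          S u w - S u (w ℕ.∸ k)                             ≡⟨ cong (_- S u (w ℕ.∸ k))
              (trans (S-beyond u n≤w) (sym (S-beyond u (ℕ.m≤n⇒m≤1+n n≤w)))) ⟩
          S u (suc w) - S u (w ℕ.∸ k)                       ≡⟨ sums-suc-k w w<n+k ⟩
          at (sums u) (Y (+ w))                             ≡⟨ at-shift (sums u) (Y (+ w)) g ⟨
          at (sums u) (Y (+ w) ℤ.+ g ℤ.* + suc k)           ≡⟨ cong (at (sums u)) (Y.shift (+ w) g) ⟨
          at (sums u) (Y (+ w ℤ.+ g ℤ.* + k))               ≡⟨ cong (λ w → at (sums u) (Y w)) v≡ ⟨
          at (sums u) (Y v)                                 ∎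
          where
          r w : ℕ
          r = (v ℤ.- + n) %ℕ k
          w = n ℕ.+ r
          g : ℤ
          g = (v ℤ.- + n) /ℕ k
          r<k : r ℕ.< k
          r<k = n%ℕd<d (v ℤ.- + n) k
          w<n+k : w ℕ.< n ℕ.+ k
          w<n+k = ℕ.+-monoʳ-< n r<k
          n≤w : n ℕ.≤ w
          n≤w = ℕ.m≤m+n n r
          v≡ : v ≡ + w ℤ.+ g ℤ.* + k
          v≡ = trans (split v (+ n)) (trans (cong (λ d → + n ℤ.+ d) (a≡a%ℕn+[a/ℕn]*n (v ℤ.- + n) k))
                 (trans (sym (ℤ.+-assoc (+ n) (+ r) (g ℤ.* + k))) (cong (ℤ._+ g ℤ.* + k) (sym (ℤ.pos-+ n r)))))
            where
            split : ∀ v n → v ≡ n ℤ.+ (v ℤ.- n)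
            split = ℤ.solve-∀

      -- All sums of `k` consecutive entries vanish by periodicity, so `S u` repeats with period `k`
      -- and is zero throughout.
      sums-injective : (∀ i → sums u i ≡ 0ℚ) → ∀ x → u x ≡ 0ℚ
      sums-injective sums≡0 x = trans (split (u x) (S u (toℕ x)))
          (trans (cong (_- S u (toℕ x)) (sym (S-suc u x)))
          (cong₂ _-_ (vanish (suc (toℕ x)) (ℕ.≤-trans (Fin.toℕ<n x) (ℕ.m≤m+n n k)))
              (vanish (toℕ x) (ℕ.≤-trans (ℕ.<⇒≤ (Fin.toℕ<n x)) (ℕ.m≤m+n n k)))))
        where
        split : ∀ a s → a ≡ s + a - s
        split = solve 2 (λ a s → a := s :+ a :- s) refl
        at≡0 : ∀ P → at (sums u) P ≡ 0ℚ
        at≡0 P = sums≡0 (fromℕ< (n%ℕd<d P (suc k)))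
        vanish : ∀ l → l ℕ.≤ n ℕ.+ k → S u l ≡ 0ℚ
        vanish = step-induction k _ (λ l l<k _ → trans (sym (at-sums u (ℕ.<⇒≤ l<k))) (at≡0 (+ l)))
          (λ i IH le → trans (a-b≡0⇒
              (trans (trans (cong (λ h → S u (k ℕ.+ i) - S u h) (sym (ℕ.m+n∸m≡n k i))) (sums-k (k ℕ.+ i) le))
              (at≡0 (+ (k ℕ.+ i)))))
            (IH (ℕ.≤-trans (ℕ.m≤n+m i k) le)))

    module _ {n : ℕ} (x : Vector ℚ (suc k)) (x-inv : Invariant (+ n) x) where
      open Invariant x-inv

      private
        -- The partial sums are rebuilt from the prescribed sums of `k` entries. The descent from
        -- `l` to `l ∸ k` is not structural, hence the fuel.
        σ′ : ℕ → ℕ → ℚ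
        σ′ _          zero    = 0ℚ
        σ′ zero       (suc l) = 0ℚ
        σ′ (suc fuel) (suc l) = σ′ fuel (suc l ℕ.∸ k) + at x (+ suc l)

        shrinks : ∀ {l b} → l ℕ.≤ b → suc l ℕ.∸ k ℕ.≤ b
        shrinks {l} l≤b = ℕ.≤-trans (ℕ.∸-monoʳ-≤ (suc l) (ℕ.>-nonZero⁻¹ k)) l≤b

        fuel-irrelevant : ∀ a b l → l ℕ.≤ a → l ℕ.≤ b → σ′ a l ≡ σ′ b l
        fuel-irrelevant _       _       zero    _         _         = refl
        fuel-irrelevant (suc a) (suc b) (suc l) (s≤s l≤a) (s≤s l≤b) =
          cong (_+ at x (+ suc l)) (fuel-irrelevant a b (suc l ℕ.∸ k) (shrinks l≤a) (shrinks l≤b))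

        σ : ℕ → ℚ
        σ l = σ′ l l

        σ-rec : ∀ l → σ l ≡ σ (l ℕ.∸ k) + at x (+ l)
        σ-rec zero    = sym (trans (cong₂ (λ h z → σ h + z) (ℕ.0∸n≡0 k) (trans (at-start x) start≡0))
            (+-identityˡ 0ℚ))
        σ-rec (suc l) = cong (_+ at x (+ suc l))
            (fuel-irrelevant l (suc l ℕ.∸ k) (suc l ℕ.∸ k) (shrinks {l} ℕ.≤-refl) ℕ.≤-refl)

        σ-small : ∀ l → l ℕ.≤ k → σ l ≡ at x (+ l)
        σ-small l l≤k = trans (σ-rec l)
            (trans (cong (λ h → σ h + at x (+ l)) (ℕ.m≤n⇒m∸n≡0 l≤k)) (+-identityˡ (at x (+ l))))

        σ-next : ∀ i → σ (suc k ℕ.+ i) ≡ σ (suc i) + at x (+ i)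
        σ-next i = trans (σ-rec (suc k ℕ.+ i)) (cong₂ (λ h z → σ h + z)
          (trans (cong (ℕ._∸ k) (sym (ℕ.+-suc k i))) (ℕ.m+n∸m≡n k (suc i)))
          (trans (cong (at x) (suc-next i)) (at-shift x (+ i) 1ℤ)))

        σ-Y : ∀ v → σ (suc v) ≡ σ (v ℕ.∸ k) + at x (Y (+ v))
        σ-Y = step-induction k _
          (λ v v<k → trans (σ-small (suc v) v<k) (trans (cong (at x) (sym (Y-small v<k)))
            (sym (trans (cong (λ h → σ h + at x (Y (+ v))) (ℕ.m≤n⇒m∸n≡0 (ℕ.<⇒≤ v<k))) (+-identityˡ _)))))
          (λ i IH → begin
            σ (suc (k ℕ.+ i))                              ≡⟨ σ-next i ⟩
            σ (suc i) + at x (+ i)                         ≡⟨ cong (_+ at x (+ i)) IH ⟩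
            σ (i ℕ.∸ k) + at x (Y (+ i)) + at x (+ i)      ≡⟨ swap (σ (i ℕ.∸ k)) (at x (Y (+ i))) (at x (+ i)) ⟩
            σ (i ℕ.∸ k) + at x (+ i) + at x (Y (+ i))      ≡⟨ cong (_+ at x (Y (+ i))) (σ-rec i) ⟨
            σ i + at x (Y (+ i))                           ≡⟨ cong₂ (λ h z → σ h + z) (sym (ℕ.m+n∸m≡n k i))
                                                                (sym (trans (cong (at x) (Y-next i))
                                                                    (at-shift x (Y (+ i)) 1ℤ))) ⟩
            σ (k ℕ.+ i ℕ.∸ k) + at x (Y (+ (k ℕ.+ i)))     ∎)
          where
          open ≡-Reasoning
          swap : ∀ a b c → a + b + c ≡ a + c + b
          swap = solve 3 (λ a b c → a :+ b :+ c := a :+ c :+ b) refl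

        -- Here the edge equations of `x` are used: they make `σ` constant from `n` to `n + k`, so
        -- that the finite vector of its first `n` differences has `σ` as partial sums as far as the
        -- rows of the matrix look.
        σ-flat : ∀ r → r ℕ.≤ k → σ (n ℕ.+ r) ≡ σ n
        σ-flat zero    _   = cong σ (ℕ.+-identityʳ n)
        σ-flat (suc r) r<k = trans (cong σ (ℕ.+-suc n r)) (trans (σ-Y (n ℕ.+ r))
          (trans (cong (λ z → σ (n ℕ.+ r ℕ.∸ k) + z)
              (trans (sym (constant (+ (n ℕ.+ r)))) (cong (at x) (X-window n r r<k))))
            (trans (sym (σ-rec (n ℕ.+ r))) (σ-flat r (ℕ.<⇒≤ r<k)))))

        u : Vector ℚ n
        u y = σ (suc (toℕ y)) - σ (toℕ y)

        S-u : ∀ h → h ℕ.≤ n → S u h ≡ σ h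
        S-u h h≤n = trans (S-differences n σ h h≤n) (+-identityʳ (σ h))

        S-u⁺ : ∀ h → h ℕ.≤ n ℕ.+ k → S u h ≡ σ h
        S-u⁺ h h≤n+k with h ℕ.≤? n
        ... | yes h≤n = S-u h h≤n
        ... | no  h≰n = trans (S-beyond u n≤h) (trans (S-u n ℕ.≤-refl) (trans (sym (σ-flat (h ℕ.∸ n)
              (ℕ.m≤n+o⇒m∸n≤o h n h≤n+k))) (cong σ (ℕ.m+[n∸m]≡n n≤h))))
          where n≤h = ℕ.<⇒≤ (ℕ.≰⇒> h≰n)

        u∈K : Kernel (A n k) u
        u∈K i = trans (A-row n k i u) (trans (cong₂ (λ a b → (a - S u (suc l)) - (b - S u (l ℕ.∸ k))) Sl+k Sl)
            (trans (cong₂ (λ a b → (σ (suc l) + at x (+ l) - a) - (σ (l ℕ.∸ k) + at x (+ l) - b)) Ssuc Sl∸k)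
              (cancel (σ (suc l)) (at x (+ l)) (σ (l ℕ.∸ k)))))
          where
          l : ℕ
          l = toℕ i
          l<n : l ℕ.< n
          l<n = Fin.toℕ<n i
          Sl+k : S u (suc (l ℕ.+ k)) ≡ σ (suc l) + at x (+ l)
          Sl+k = trans (S-u⁺ _ (ℕ.+-monoˡ-≤ k l<n)) (trans (cong σ (cong suc (ℕ.+-comm l k))) (σ-next l))
          Sl : S u l ≡ σ (l ℕ.∸ k) + at x (+ l)
          Sl = trans (S-u l (ℕ.<⇒≤ l<n)) (σ-rec l)
          Ssuc : S u (suc l) ≡ σ (suc l)
          Ssuc = S-u (suc l) l<n
          Sl∸k : S u (l ℕ.∸ k) ≡ σ (l ℕ.∸ k)
          Sl∸k = S-u (l ℕ.∸ k) (ℕ.≤-trans (ℕ.m∸n≤m l k) (ℕ.<⇒≤ l<n))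
          cancel : ∀ a z b → (a + z - a) - (b + z - b) ≡ 0ℚ
          cancel = solve 3 (λ a z b → (a :+ z :- a) :- (b :+ z :- b) := con 0ℚ) refl

      sums-surjective : ∃[ u ] Kernel (A n k) u × (∀ i → sums u i ≡ x i)
      sums-surjective = u , u∈K , λ i → trans (S-u⁺ (toℕ i) (ℕ.≤-trans (ℕ.≤-pred (Fin.toℕ<n i)) (ℕ.m≤n+m k n)))
        (trans (σ-small (toℕ i) (ℕ.≤-pred (Fin.toℕ<n i))) (at-toℕ x i))

    sums-basis : ∀ {n d} {v : Fin d → Vector ℚ n} → IsBasis (Kernel (A n k)) v → IsBasis (Invariant (+ n))
        (λ i → sums (v i))
    sums-basis {n} {d} {v} basis = record
      { member      = λ i → sums-invariant (v i) (member i)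
      ; independent = λ c c≡0 → independent c (sums-injective (combine c v) (Kernel-combine (A n k) c v member)
                        (λ i → trans (·-combineʳ (prefix (toℕ i)) c v) (c≡0 i)))
      ; spanning    = λ x x-inv → let u , u∈K , Tu≡x = sums-surjective x x-inv ; c , u≡ = spanning u u∈K in
                        c , λ i → trans (sym (Tu≡x i))
                            (trans (·-congʳ (prefix (toℕ i)) u≡) (·-combineʳ (prefix (toℕ i)) c v))
      }
      where open IsBasis basis

-- Nullities as dimensions of invariants, and neighbouring graphs

module Peaks where

  open Circle
  open Dimension
  open PrefixSums
  import Defs
  open import Algebra.Bundles using (CommutativeRing)
  open import Data.Bool.Base using (if_then_else_)
  open import Data.Empty using (⊥; ⊥-elim)
  open import Data.Fin.Base using (Fin; zero; suc; toℕ; fromℕ<)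
  import Data.Fin.Properties as Fin
  open import Data.Integer.Base hiding (NonZero; suc; positive; _%_; _/_)
  open import Data.Integer.DivMod using (_/ℕ_; _%ℕ_; a≡a%ℕn+[a/ℕn]*n; n%ℕd<d)
  open import Data.Integer.Properties
  open import Data.Integer.Tactic.RingSolver using (solve; solve-∀)
  open import Data.List.Base using (List; _∷_; []; length; filter; map; upTo; _++_; [_])
  open import Data.List.Properties using (upTo-∷ʳ; map-upTo; map-++; filter-accept; filter-reject; filter-++; length-++)
  open import Data.Nat.Base as ℕ using (ℕ; zero; suc; NonZero; z≤n; s≤s)
  open import Data.Nat.Divisibility using (divides; ∣1⇒≡1)
  open import Data.Nat.DivMod using (_%_; m%n<n; [m+kn]%n≡m%n; m<n⇒m%n≡m; m<n⇒m/n≡0) renaming (_/_ to _/′_)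
  open import Data.Nat.GCD using (gcd; gcd[m,n]∣m; gcd[m,n]∣n)
  import Data.Nat.Properties as ℕ
  open import Data.Product.Base using (Σ-syntax; ∃-syntax; _×_; _,_; proj₁; proj₂)
  open import Data.Rational.Base as ℚ using (ℚ; 0ℚ; 1ℚ)
  import Data.Rational.Properties as ℚ
  open import Data.Sum.Base using (_⊎_; inj₁; inj₂)
  open import Data.Vec.Functional using (Vector)
  open Defs using (combine; IsBasis; A; nullity-isNullity; period; period-nonZero; representative; N; LocalPeak; IsCycle; Edge; Vertex; SameCycle; Traverses; η)
  open import Algebra.Properties.Semiring.Sum (CommutativeRing.semiring ℚ.+-*-commutativeRing) using (sum)
  open import Function.Bundles using (Equivalence)
  open import Relation.Binary.PropositionalEquality hiding ([_])
  open import Relation.Nullary.Decidable using (Dec; yes; no; does; dec-true; dec-false)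
  open import Relation.Nullary.Negation using (¬_)
  open import Relation.Unary using (Decidable)

  module Nullities (k : ℕ) .{{k≢0 : NonZero k}} where

    open Dynamics k
    open Orbits k
    open Invariants k

    IsBasis-⇔ : ∀ {d n} {W W′ : Vector ℚ n → Set} {v : Fin d → Vector ℚ n} →
                (∀ u → W u → W′ u) → (∀ u → W′ u → W u) → IsBasis W v → IsBasis W′ v
    IsBasis-⇔ W⊆W′ W′⊆W basis = record
      { member = λ i → W⊆W′ _ (member i) ; independent = independent ; spanning = λ u u∈W′ → spanning u
          (W′⊆W u u∈W′) }
      where open IsBasis basis

    -- Moving `n` by `k (k + 1)` changes the quotient in `X` by `k + 1`, that is, moves every source
    -- by a whole turn.
    invariant-period : ∀ {n} z {x} → Invariant n x → Invariant (n + z * + period k) x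
    invariant-period {n} z {x} inv = record { start≡0 = Invariant.start≡0 inv
      ; constant = λ v → trans (trans (cong (at x) (X-period v)) (at-shift x (X n v) (- z)))
          (Invariant.constant inv v) }
      where
      reduce : ∀ v n z κ → v - (n + z * (κ * κ + κ)) ≡ v - n + (- (z * (1ℤ + κ))) * κ
      reduce = solve-∀
      collect : ∀ v g z κ → v + (g + - (z * (1ℤ + κ))) ≡ v + g + (- z) * (1ℤ + κ)
      collect = solve-∀
      X-period : ∀ v → X (n + z * + period k) v ≡ X n v + (- z) * + suc k
      X-period v = trans (cong (λ d → v + d /ℕ k)
          (trans (cong (λ π → v - (n + z * π)) (trans (pos-+ (k ℕ.* k) k) (cong (_+ + k) (pos-* k k))))
          (reduce v n z (+ k)))) (trans (cong (λ g → v + g) (/ℕ-shift (v - n) (- (z * + suc k)) k))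
              (collect v ((v - n) /ℕ k) z (+ k)))

    -- Passes from the matrix at the representative to the given integer `n`; from here on `N` is
    -- used only as the dimension of a space of invariants.
    N-basis : ∀ n → Σ[ v ∈ (Fin (N n k) → Vector ℚ (suc k)) ] IsBasis (Invariant n) v
    N-basis n = _ , IsBasis-⇔ (λ u inv → subst (λ n → Invariant n u) (sym n≡) (invariant-period (g - 1ℤ) inv))
        (λ u inv → subst (λ n → Invariant n u) rep≡ (invariant-period (1ℤ - g) inv))
        (sums-basis (proj₂ (nullity-isNullity (A (representative n k) k))))
      where
      instance _ = period-nonZero k
      g : ℤ
      g = n /ℕ period k
      rep≡ : n + (1ℤ - g) * + period k ≡ + representative n k
      rep≡ = sym (trans (pos-+ (n %ℕ period k) (period k))
          (trans (cong (_+ + period k) (%ℕ-def n (period k))) (collect n g (+ period k))))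
        where
        collect : ∀ n g π → n - g * π + π ≡ n + (1ℤ - g) * π
        collect = solve-∀
      n≡ : n ≡ + representative n k + (g - 1ℤ) * + period k
      n≡ = trans (undo n g (+ period k)) (cong (_+ (g - 1ℤ) * + period k) rep≡)
        where
        undo : ∀ n g π → n ≡ n + (1ℤ - g) * π + (g - 1ℤ) * π
        undo = solve-∀

    vanishes-on-path : ∀ {n x P} → Invariant n x → Path n P → at x P ≡ 0ℚ
    vanishes-on-path {n} {x} inv (start z)  = trans
        (trans (cong (at x) (sym (+-identityˡ (z * + suc k)))) (at-shift x 0ℤ z))
      (trans (at-start x) (Invariant.start≡0 inv))
    vanishes-on-path {n} {x} inv (step v p) = trans (sym (Invariant.constant inv v)) (vanishes-on-path inv p)

    constant-on-orbit : ∀ {n q J x} → Unimodular J q → (O : Orbit n q J) → Invariant n x →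
                        ∀ e → at x (Y (Orbit.V O e)) ≡ at x (Y (Orbit.V O 0ℤ))
    constant-on-orbit {n} {q} {J} {x} unimodular O inv = unimodular-constant (λ e → at x (Y (V e))) J
        (λ e → trans (sym (Invariant.constant inv (V e))) (cong (at x) (link e))) unimodular
        (λ e z → trans (cong (at x) (trans (cong Y (Lift.shift lift e z)) (Y.shift (V e) z)))
            (at-shift x (Y (V e)) z))
      where open Orbit O

    -- A backward cycle through the hole would, on closing up, contain an edge that leaves it.
    hole-on-path : ∀ n → Path n (-1ℤ + n)
    hole-on-path n with path-or-cycle n (-1ℤ + n)
    ... | inj₁ path = path
    ... | inj₂ C    = ⊥-elim (X-misses-hole n (edge (ℕ.pred size)) turns (begin
      X n (edge (ℕ.pred size))           ≡⟨ link (ℕ.pred size) ⟩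
      Y (edge (suc (ℕ.pred size)))       ≡⟨ cong (λ l → Y (edge l))
          (trans (ℕ.suc-pred size) (sym (ℕ.+-identityʳ size))) ⟩
      Y (edge (size ℕ.+ 0))              ≡⟨ cong Y (periodic 0) ⟩
      Y (edge 0 + turns * + k)             ≡⟨ Y.shift (edge 0) turns ⟩
      Y (edge 0) + turns * + suc k         ≡⟨ cong (_+ turns * + suc k) ends ⟩
      -1ℤ + n + turns * + suc k            ∎))
      where
      open BackwardCycle C
      open ≡-Reasoning
      instance _ = size≢0

    -- G(n,k) and G(n′,k) differ in the source of a single edge v only: it leaves
    -- the vertex that has no outgoing edge in the other graph.
    record Neighbours (n n′ v : ℤ) : Set where
      field
        agree  : ∀ w → X n w ≡ X n′ w ⊎ (∃[ z ] w ≡ v + z * + k)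
        source : X n v ≡ -1ℤ + n′
        source′ : X n′ v ≡ -1ℤ + n

    neighbours-sym : ∀ {n n′ v} → Neighbours n n′ v → Neighbours n′ n v
    neighbours-sym nb = record { agree = λ w → swap (agree w) ; source = source′ ; source′ = source }
      where
      open Neighbours nb
      swap : ∀ {a b : ℤ} {B : Set} → a ≡ b ⊎ B → b ≡ a ⊎ B
      swap (inj₁ eq) = inj₁ (sym eq)
      swap (inj₂ b)  = inj₂ b

    neighbours-suc : ∀ n → Neighbours n (n + 1ℤ) n
    neighbours-suc n = record { agree = agree ; source = trans (X-at n) (pred-suc′ n)
        ; source′ = trans (cong (X (n + 1ℤ)) (pred-suc′ n)) (trans (X-before (n + 1ℤ)) (collect n)) }
      where
      pred-suc′ : ∀ n → n ≡ -1ℤ + (n + 1ℤ)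
      pred-suc′ = solve-∀
      collect : ∀ n → - + 2 + (n + 1ℤ) ≡ -1ℤ + n
      collect = solve-∀
      regroup : ∀ n w → -1ℤ + (w - n) ≡ w - (n + 1ℤ)
      regroup = solve-∀
      undo : ∀ n w → w ≡ n + (w - n)
      undo = solve-∀
      agree : ∀ w → X n w ≡ X (n + 1ℤ) w ⊎ (∃[ z ] w ≡ n + z * + k)
      agree w with (w - n) %ℕ k ℕ.≟ 0
      ... | no  off = inj₁ (cong (λ g → w + g)
          (trans (sym (pred-/ℕ (w - n) k off)) (cong (_/ℕ k) (regroup n w))))
      ... | yes on  = inj₂ ((w - n) /ℕ k , trans (undo n w)
          (cong (λ d → n + d) (trans (a≡a%ℕn+[a/ℕn]*n (w - n) k)
                        (trans (cong (λ r → + r + (w - n) /ℕ k * + k) on) (+-identityˡ _)))))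

    neighbours-pred : ∀ n → Neighbours n (n - 1ℤ) (n - 1ℤ)
    neighbours-pred n = neighbours-sym
        (subst (λ m → Neighbours (n - 1ℤ) m (n - 1ℤ)) (undo n) (neighbours-suc (n - 1ℤ)))
      where
      undo : ∀ n → n - 1ℤ + 1ℤ ≡ n
      undo = solve-∀

    -- If the source of the moved edge is on the path, an invariant vanishes at both ends of the
    -- edge. It also vanishes at the old hole, the new source, so it respects the moved edge too.
    path⇒⊆ : ∀ {n n′ v} → Neighbours n n′ v → Path n (-1ℤ + n′) → ∀ x → Invariant n x → Invariant n′ x
    path⇒⊆ {n} {n′} {v} nb path x inv = record { start≡0 = Invariant.start≡0 inv ; constant = constant }
      where
      open Neighbours nb
      constant : ∀ w → at x (X n′ w) ≡ at x (Y w)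
      constant w with agree w
      ... | inj₁ same     = trans (cong (at x) (sym same)) (Invariant.constant inv w)
      ... | inj₂ (z , w≡) = trans
          (trans (trans (cong (λ w → at x (X n′ w)) w≡)
          (cong (at x) (trans (X.shift n′ v z) (cong (_+ z * + suc k) source′))))
            (trans (at-shift x (-1ℤ + n) z) (vanishes-on-path inv (hole-on-path n))))
                (sym (trans (sym (Invariant.constant inv w))
              (trans (trans (cong (λ w → at x (X n w)) w≡)
                  (cong (at x) (trans (X.shift n v z) (cong (_+ z * + suc k) source))))
                (trans (at-shift x (-1ℤ + n′) z) (vanishes-on-path inv path)))))

    module _ {n n′ v : ℤ} (nb : Neighbours n n′ v) where
      open Neighbours nb

      path⇒N≤ : Path n (-1ℤ + n′) → N n k ℕ.≤ N n′ k
      path⇒N≤ path = subspace⇒≤ (proj₂ (N-basis n)) (proj₂ (N-basis n′)) (path⇒⊆ nb path)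

      module _ {q J} (O : Orbit n q J) {e₀ : ℤ} (V-e₀ : Orbit.V O e₀ ≡ v) where
        open Orbit O

        private
          OnOrbit : ℤ → Set
          OnOrbit P = ∃[ e ] P ≡ X n (V e)

          onward : ∀ w e → w ≡ V e → OnOrbit (Y w)
          onward w e eq = e + J , trans (cong Y (trans eq (cong V (undo e J)))) (sym (link (e + J)))
            where
            undo : ∀ e J → e ≡ e + J - J
            undo = solve-∀

          -- Positions on the orbit lead only to positions on the orbit, so a piece of the path that
          -- ends off the orbit never met it. In particular it does not use the moved edge and
          -- survives in the other graph.
          transfer : ∀ {P} → Path n P → ¬ OnOrbit P → Path n′ P
          transfer (start z)     off = start z
          transfer (step w path) off with agree w
          ... | inj₁ same     = step w
              (subst (Path n′) same (transfer path (λ { (e , eq) → off (onward w e (X.injective n eq)) })))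
          ... | inj₂ (z , w≡) = ⊥-elim
              (off (onward w (e₀ + z * + q)
              (trans w≡ (trans (cong (_+ z * + k) (sym V-e₀)) (sym (Lift.shift lift e₀ z))))))

        -- The orbit is a cycle of G(n,k) that is cut open in G(n′,k).
        orbit⇒N< : ∀ w → Invariant n w → at w (-1ℤ + n′) ≢ 0ℚ → N n′ k ℕ.< N n k
        -- The separating coordinate is `n′ − 1`: as the hole of `G(n′,k)` it forces invariants
        -- there to vanish, while in `G(n,k)` it is a source on the cycle.
        orbit⇒N< w w-inv w≢0 = proper-subspace⇒< (proj₂ (N-basis n′)) (proj₂ (N-basis n))
            (path⇒⊆ (neighbours-sym nb) hole-path) _
                (λ x inv → vanishes-on-path inv (hole-on-path n′)) w w-inv w≢0
          where
          hole-off : ¬ OnOrbit (-1ℤ + n)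
          hole-off (e , eq) = X-misses-hole n (V e) 0ℤ (trans (sym eq) (sym (+-identityʳ (-1ℤ + n))))
          hole-path : Path n′ (-1ℤ + n)
          hole-path = transfer (hole-on-path n) hole-off

  lift-∘ : ∀ {p d l V W} → Lift p d V → Lift d l W → Lift p l (λ e → W (V e))
  lift-∘ {V = V} {W} L M = record
    { strict = λ {a} {b} h → Lift.strict M {V a} {V b} (Lift.strict L h)
    ; shift  = λ a z → trans (cong W (Lift.shift L a z)) (Lift.shift M (V a) z)
    }

  abstract

    -- If `P` is a value at all, it is the value at its own crossing, so one equality test decides.
    lift-image? : ∀ {p d V} → Lift p d V → ∀ P → Dec (∃[ e ] P ≡ V e)
    lift-image? {p} {d} {V} L P = decide (proj₂ (crossing L P))
      where
      decide : ∀ {E} → Crossing V P E → Dec (∃[ e ] P ≡ V e)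
      decide {E} cr with P ≟ V E
      ... | yes eq  = yes (E , eq)
      ... | no  P≢V = no λ { (e , P≡) → P≢V
          (≤-antisym (Crossing.above cr ≤-refl) (≤-trans (Lift.mono L (E≤e e P≡)) (≤-reflexive (sym P≡)))) }
        where
        E≤e : ∀ e → P ≡ V e → E ≤ e
        E≤e e P≡ with ≤⊎> E e
        ... | inj₁ le = le
        ... | inj₂ gt = ⊥-elim (<⇒≱ (suc[i]≤j⇒i<j (Crossing.below cr gt)) (≤-reflexive P≡))

  sum-single : ∀ {n} (g : Vector ℚ n) i → (∀ j → j ≢ i → g j ≡ 0ℚ) → sum g ≡ g i
  sum-single g zero off = trans (cong (λ z → g zero ℚ.+ z) (sum-≡0 _ (λ j → off (suc j) (λ ()))))
      (ℚ.+-identityʳ (g zero))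
  sum-single g (suc i) off = trans (cong (ℚ._+ sum (λ j → g (suc j))) (off zero (λ ())))
      (trans (ℚ.+-identityˡ _)
    (sum-single (λ j → g (suc j)) i (λ j j≢i → off (suc j) (λ eq → j≢i (Fin.suc-injective eq)))))

  orbit⇒q≤k : ∀ {k q n J} .{{k≢0 : NonZero k}} → Orbits.Orbit k n q J → q ℕ.≤ k
  orbit⇒q≤k {k} {q} O = drop‿+≤+ (strip (V 0ℤ) (+ q) (+ k) (subst (V 0ℤ + + q ≤_) turn (expanding 0ℤ q)))
    where
    open Orbits.Orbit O
    open Lift lift
    one : ∀ q → 0ℤ + q ≡ 0ℤ + 1ℤ * q
    one = solve-∀
    turn : V (0ℤ + + q) ≡ V 0ℤ + 1ℤ * + k
    turn = trans (cong V (one (+ q))) (shift 0ℤ 1ℤ)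
    strip : ∀ v q κ → v + q ≤ v + 1ℤ * κ → q ≤ κ
    strip v q κ h = ⟨ h ⟩ ∴ solve (v ∷ q ∷ κ ∷ [])

  -- The nullity at `top` and the drop on both sides

  module Peak (k q : ℕ) .{{k≢0 : NonZero k}} .{{q≢0 : NonZero q}} (q≤k : q ℕ.≤ k) (J : ℤ) (unimodular : Unimodular J q) where

    open Dynamics k
    open Orbits k
    open OrbitType k {{k≢0}}
    open Invariants k
    open Nullities k
    open Model k q q≤k J unimodular

    -- The values of `D` are at least `f` apart, so the blocks of `f` integers starting at them do
    -- not overlap.
    D-disjoint : ∀ {y y′ e e′} → 0ℤ ≤ y → 1ℤ + y ≤ + f → 0ℤ ≤ y′ → 1ℤ + y′ ≤ + f → D e + y ≡ D e′ + y′ → e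
        ≡ e′ × y ≡ y′
    D-disjoint {y} {y′} {e} {e′} 0≤y y<f 0≤y′ y′<f eq with ≤⊎> e e′ | ≤⊎> e′ e
    ... | inj₁ le | inj₁ ge with ≤-antisym le ge
    ...   | refl = refl , +-cancelˡ (D e) eq
      where
      +-cancelˡ : ∀ d {x y} → d + x ≡ d + y → x ≡ y
      +-cancelˡ d {x} {y} eq = trans (undo d x) (trans (cong (λ s → - d + s) eq) (sym (undo d y)))
        where
        undo : ∀ d x → x ≡ - d + (d + x)
        undo = solve-∀
    D-disjoint {y} {y′} {e} {e′} 0≤y y<f 0≤y′ y′<f eq | inj₂ gt | _ =
      ⊥-elim (apart (D e′) (D e) y y′ (+ f) (D-gap₁ gt) 0≤y y′<f (≤-reflexive eq))
      where
      apart : ∀ d d′ y y′ f → d + f ≤ d′ → 0ℤ ≤ y → 1ℤ + y′ ≤ f → d′ + y ≤ d + y′ → ⊥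
      apart d d′ y y′ f h₁ h₂ h₃ h₄ = linear-⊥ (⟨ h₁ ⟩ ⊕ h₂ ⊕ ⟨ h₃ ⟩ ⊕ ⟨ h₄ ⟩)
          (solve (d ∷ d′ ∷ y ∷ y′ ∷ f ∷ []))
    D-disjoint {y} {y′} {e} {e′} 0≤y y<f 0≤y′ y′<f eq | inj₁ _ | inj₂ lt =
      ⊥-elim (apart (D e) (D e′) y′ y (+ f) (D-gap₁ lt) 0≤y′ y<f (≤-reflexive (sym eq)))
      where
      apart : ∀ d d′ y y′ f → d + f ≤ d′ → 0ℤ ≤ y → 1ℤ + y′ ≤ f → d′ + y ≤ d + y′ → ⊥
      apart d d′ y y′ f h₁ h₂ h₃ h₄ = linear-⊥ (⟨ h₁ ⟩ ⊕ h₂ ⊕ ⟨ h₃ ⟩ ⊕ ⟨ h₄ ⟩)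
          (solve (d ∷ d′ ∷ y ∷ y′ ∷ f ∷ []))

    On : ℤ → ℤ → Set
    On y P = ∃[ e ] P ≡ Y (D e + y)

    On? : ∀ y P → Dec (On y P)
    On? y = lift-image? (lift-∘ (shifted-lift y) Y-lift)

    On-shift : ∀ y P z → On y P → On y (P + z * + suc k)
    On-shift y P z (e , eq) = e + z * + q , trans (cong (_+ z * + suc k) eq)
      (trans (sym (Y.shift (D e + y) z)) (cong Y (sym (Lift.shift (shifted-lift y) e z))))

    indicator : ℤ → Vector ℚ (suc k)
    indicator y i = if does (On? y (+ toℕ i)) then 1ℚ else 0ℚ

    private
      reduced : ∀ P → + toℕ (fromℕ< (n%ℕd<d P (suc k))) ≡ P + (- (P /ℕ suc k)) * + suc k
      reduced P = trans (cong +_ (Fin.toℕ-fromℕ< (n%ℕd<d P (suc k))))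
          (trans (%ℕ-def P (suc k)) (collect P (P /ℕ suc k) (+ suc k)))
        where
        collect : ∀ P g κ → P - g * κ ≡ P + (- g) * κ
        collect = solve-∀

      unreduced : ∀ P z → P + (- z) * + suc k + z * + suc k ≡ P
      unreduced P z = undo P z (+ suc k)
        where
        undo : ∀ P z κ → P + (- z) * κ + z * κ ≡ P
        undo = solve-∀

    indicator-on : ∀ y P → On y P → at (indicator y) P ≡ 1ℚ
    indicator-on y P on = cong (λ b → if b then 1ℚ else 0ℚ)
        (dec-true (On? y _) (subst (On y) (sym (reduced P)) (On-shift y P (- (P /ℕ suc k)) on)))

    indicator-off : ∀ y P → ¬ On y P → at (indicator y) P ≡ 0ℚ
    indicator-off y P off = cong (λ b → if b then 1ℚ else 0ℚ)
        (dec-false (On? y _) (λ on → off (subst (On y) (unreduced P (P /ℕ suc k))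
        (On-shift y _ (P /ℕ suc k) (subst (On y) (reduced P) on)))))

    module _ (y : ℤ) (0≤y : 0ℤ ≤ y) (y<f : 1ℤ + y ≤ + f) where

      private
        open module O = Orbit (model-orbit y 0≤y y<f)

      On-X⇒Y : ∀ v → On y (X top v) → On y (Y v)
      On-X⇒Y v (e , eq) = e + J , cong Y
          (X.injective top {v} {V (e + J)}
          (trans eq (trans (cong (λ e → Y (V e)) (undo e J)) (sym (link (e + J))))))
        where
        undo : ∀ e J → e ≡ e + J - J
        undo = solve-∀

      On-Y⇒X : ∀ v → On y (Y v) → On y (X top v)
      On-Y⇒X v (e , eq) = e - J , trans (cong (X top) (Y.injective {v} {V e} eq)) (link e)

      On-X : ∀ e → On y (X top (D e + y))
      On-X e = e - J , link e

      indicator-invariant : Invariant top (indicator y)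
      indicator-invariant = record
        { start≡0  = trans (sym (at-start (indicator y)))
            (indicator-off y 0ℤ (λ { (e , eq) → Y-misses-start (V e) 0ℤ (sym eq) }))
        ; constant = constant
        }
        where
        constant : ∀ v → at (indicator y) (X top v) ≡ at (indicator y) (Y v)
        constant v = decided (On? y (Y v))
          where
          decided : Dec (On y (Y v)) → at (indicator y) (X top v) ≡ at (indicator y) (Y v)
          decided (yes on)  = trans (indicator-on y (X top v) (On-Y⇒X v on)) (sym (indicator-on y (Y v) on))
          decided (no off) = trans (indicator-off y (X top v) (λ on → off (On-X⇒Y v on)))
              (sym (indicator-off y (Y v) off))

      neighbour-N< : ∀ {n′ v} → Neighbours top n′ v → ∀ e → D e + y ≡ v → N n′ k ℕ.< N top k
      neighbour-N< {n′} {v} nb e eq = orbit⇒N< nb (model-orbit y 0≤y y<f) {e} eq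
          (indicator y) indicator-invariant
        (λ ≡0 → ℚ.1≢0 (trans (sym
            (indicator-on y _ (subst (On y) (trans (cong (X top) eq) (Neighbours.source nb)) (On-X e)))) ≡0))


    0<f : 1ℤ + 0ℤ ≤ + f
    0<f = +≤+ 1≤f

    N-suc< : N (top + 1ℤ) k ℕ.< N top k
    N-suc< = neighbour-N< 0ℤ ≤-refl 0<f (neighbours-suc top) last (+-identityʳ top)

    -- The edge that moves is `top − 1`. Since the gap before `last` is `f`, it is edge `last − 1`
    -- of the cycle with the largest shift `f − 1`; on the other side it was edge `last` of the
    -- cycle with shift 0.
    N-pred< : N (top - 1ℤ) k ℕ.< N top k
    N-pred< = neighbour-N< (-1ℤ + + f) (nonneg (+ f) 0<f) (≤-reflexive (below (+ f))) (neighbours-pred top)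
        (-1ℤ + last)
        (trans (cong (_+ (-1ℤ + + f)) D-before-last) (collect top (+ f)))
      where
      nonneg : ∀ f → 1ℤ + 0ℤ ≤ f → 0ℤ ≤ -1ℤ + f
      nonneg f h = ⟨ h ⟩ ∴ solve (f ∷ [])
      below : ∀ f → 1ℤ + (-1ℤ + f) ≡ f
      below = solve-∀
      collect : ∀ t f → t - f + (-1ℤ + f) ≡ t - 1ℤ
      collect = solve-∀

    private
      fin-nonneg : ∀ (i : Fin f) → 0ℤ ≤ + toℕ i
      fin-nonneg i = +≤+ z≤n

      fin-bound : ∀ (i : Fin f) → 1ℤ + + toℕ i ≤ + f
      fin-bound i = +≤+ (Fin.toℕ<n i)

      origin : Fin f → ℤ
      origin i = Y (D 0ℤ + + toℕ i)

      indicators : Fin f → Vector ℚ (suc k)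
      indicators i = indicator (+ toℕ i)

      indicators-disjoint : ∀ i j e → j ≢ i → at (indicators j) (Y (D e + + toℕ i)) ≡ 0ℚ
      indicators-disjoint i j e j≢i = indicator-off (+ toℕ j) _
          (λ { (e′ , eq) → j≢i (sym (Fin.toℕ-injective (+-injective
        (proj₂ (D-disjoint {+ toℕ i} {+ toℕ j} {e} {e′} (fin-nonneg i) (fin-bound i) (fin-nonneg j)
            (fin-bound j) (Y.injective eq)))))) })

      value-on : ∀ (c : Vector ℚ f) i e → at (combine c indicators) (Y (D e + + toℕ i)) ≡ c i
      value-on c i e = trans (sum-single (λ j → c j ℚ.* at (indicators j) (Y (D e + + toℕ i))) i
          (λ j j≢i → trans (cong (c j ℚ.*_) (indicators-disjoint i j e j≢i)) (ℚ.*-zeroʳ (c j))))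
        (trans (cong (c i ℚ.*_) (indicator-on (+ toℕ i) _ (e , refl))) (ℚ.*-identityʳ (c i)))

    -- Any cycle has the type `(q, J)` of the model cycles, and by classification it is then one of
    -- them.
    path-or-model : ∀ P → Path top P ⊎ (∃[ i ] On (+ toℕ {f} i) P)
    path-or-model P with path-or-cycle top P
    ... | inj₁ path = inj₁ path
    ... | inj₂ C    = inj₂ (on-model (cycle⇒orbit C))
      where
      on-class : (O : Orbit top q J) → Y (Orbit.V O 0ℤ) ≡ P → Classified top (Orbit.V O) → ∃[ i ] On
          (+ toℕ {f} i) P
      on-class O ends cl = index , - Classified.origin cl , trans (sym ends)
          (cong Y (trans (cong (Orbit.V O) (sym (+-inverseʳ (Classified.origin cl))))
          (trans (V≡ (- Classified.origin cl)) (cong (λ y → D (- Classified.origin cl) + y) y≡))))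
        where
        open Classified cl using (y; V≡; 0≤y; y<f)
        ∣y∣≡ : + ∣ y ∣ ≡ y
        ∣y∣≡ = 0≤i⇒+∣i∣≡i 0≤y
        ∣y∣<f : ∣ y ∣ ℕ.< f
        ∣y∣<f = drop‿+≤+ (subst (λ y → 1ℤ + y ≤ + f) (sym ∣y∣≡) y<f)
        index : Fin f
        index = fromℕ< ∣y∣<f
        y≡ : y ≡ + toℕ index
        y≡ = trans (sym ∣y∣≡) (cong +_ (sym (Fin.toℕ-fromℕ< ∣y∣<f)))

      on-model : (∃[ q′ ] ∃[ J′ ] Σ[ q′≢0 ∈ NonZero q′ ] Unimodular J′ q′ × Σ[ O ∈ Orbit top q′ J′ ] Y
          (Orbit.V O 0ℤ) ≡ P) →
                 ∃[ i ] On (+ toℕ {f} i) P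
      on-model (q′ , J′ , q′≢0 , unimodular′ , O , ends)
        = typed (orbit-type-unique {{q≢0}} {{q′≢0}} unimodular unimodular′ (model-orbit 0ℤ ≤-refl 0<f) O) O ends
        where
        typed : q ≡ q′ × J ≡ J′ → (O : Orbit top q′ J′) → Y (Orbit.V O 0ℤ) ≡ P → ∃[ i ] On (+ toℕ {f} i) P
        typed (refl , refl) O ends = on-class O ends (classify O)
    -- An invariant vanishes on the path and is constant on each cycle, so one value per cycle
    -- describes it.
    indicators-basis : IsBasis (Invariant top) indicators
    indicators-basis = record
      { member      = λ i → indicator-invariant (+ toℕ i) (fin-nonneg i) (fin-bound i)
      ; independent = λ c c≡0 i → trans (sym (value-on c i 0ℤ)) (c≡0 _)
      ; spanning    = λ u inv → (λ i → at u (origin i)) , λ l → trans (sym (at-toℕ u l))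
          (trans (spans u inv (+ toℕ l)) (at-toℕ (combine (λ i → at u (origin i)) indicators) l))
      }
      where
      spans : ∀ u → Invariant top u → ∀ P → at u P ≡ at (combine (λ i → at u (origin i)) indicators) P
      spans u inv P = cases (path-or-model P)
        where
        c : Vector ℚ f
        c i = at u (origin i)
        cases : Path top P ⊎ (∃[ i ] On (+ toℕ {f} i) P) → at u P ≡ at (combine c indicators) P
        cases (inj₁ path) = trans (vanishes-on-path inv path) (sym (sum-≡0 _ (λ i → trans (cong (c i ℚ.*_)
          (vanishes-on-path (indicator-invariant (+ toℕ i) (fin-nonneg i) (fin-bound i)) path))
              (ℚ.*-zeroʳ (c i)))))
        cases (inj₂ (i , e , P≡)) = trans (cong (at u) P≡) (trans
          (constant-on-orbit unimodular (model-orbit (+ toℕ i) (fin-nonneg i) (fin-bound i)) inv e)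
          (sym (trans (cong (at (combine c indicators)) P≡) (value-on c i e))))

    N-top : N top k ≡ f
    N-top = ℕ.≤-antisym (subspace⇒≤ (proj₂ (N-basis top)) indicators-basis (λ _ inv → inv))
                        (subspace⇒≤ indicators-basis (proj₂ (N-basis top)) (λ _ inv → inv))

  -- The explicit formulas for `η` and `c`

  Σ-count : ∀ {P : ℕ → Set} (P? : Decidable P) m {g : ℕ → ℤ} →
            (∀ a → 1 ℕ.≤ a → a ℕ.≤ m → (P a → g a ≡ 1ℤ) × (¬ P a → g a ≡ 0ℤ)) →
            Σ[ m ] g ≡ + length (filter P? (map suc (upTo m)))
  Σ-count P? zero    _   = refl
  Σ-count {P} P? (suc m) {g} ind = trans
      (cong₂ _+_ (Σ-count P? m (λ a 1≤a a≤m → ind a 1≤a (ℕ.m≤n⇒m≤1+n a≤m))) (final (P? (suc m))))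
    (trans (sym (pos-+ (length (filter P? (map suc (upTo m)))) (length (filter P? [ suc m ]))))
        (cong +_ (sym (begin
      length (filter P? (map suc (upTo (suc m))))                       ≡⟨ cong
          (λ l → length (filter P? (map suc l))) (upTo-∷ʳ m) ⟨
      length (filter P? (map suc (upTo m ++ [ m ])))                    ≡⟨ cong (λ l → length (filter P? l))
          (map-++ suc (upTo m) [ m ]) ⟩
      length (filter P? (map suc (upTo m) ++ [ suc m ]))                ≡⟨ cong length
          (filter-++ P? (map suc (upTo m)) [ suc m ]) ⟩
      length (filter P? (map suc (upTo m)) ++ filter P? [ suc m ])      ≡⟨ length-++
          (filter P? (map suc (upTo m))) ⟩
      length (filter P? (map suc (upTo m))) ℕ.+ length (filter P? [ suc m ])  ∎))))
    where
    open ≡-Reasoning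
    final : Dec (P (suc m)) → g (suc m) ≡ + length (filter P? [ suc m ])
    final (yes p) = trans (proj₁ (ind (suc m) (s≤s z≤n) ℕ.≤-refl) p)
        (cong (λ l → + length l) (sym (filter-accept P? p)))
    final (no ¬p) = trans (proj₂ (ind (suc m) (s≤s z≤n) ℕ.≤-refl) ¬p)
        (cong (λ l → + length l) (sym (filter-reject P? ¬p)))

  module Formulas (k q j : ℕ) .{{k≢0 : NonZero k}} .{{q≢0 : NonZero q}} (q≤k : q ℕ.≤ k) (unimodular : Unimodular (+ j) q) where

    open Dynamics k
    open Orbits k
    open Model k q q≤k (+ j) unimodular
    open Peak k q q≤k (+ j) unimodular using (D-disjoint)

    private
      -- Here `y` is the residue of `A = a j`. As it is nonzero, subtracting `A` from `x` rather
      -- than from 0 raises the floor exactly when `y ≤ x`: the summands of `D` are indicators.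
      floor-difference : ∀ x A y g → A ≡ y + g * + q → 1ℤ ≤ y → 1ℤ + y ≤ + q → 0ℤ ≤ x → 1ℤ + x ≤ + q →
                         (y ≤ x → (x - A) /ℕ q - (- A) /ℕ q ≡ 1ℤ) ×
                             (1ℤ + x ≤ y → (x - A) /ℕ q - (- A) /ℕ q ≡ 0ℤ)
      floor-difference x .(y + g * + q) y g refl 1≤y y<q 0≤x x<q =
          (λ y≤x → trans (cong₂ _-_
              (/ℕ-unique {x - (y + g * + q)} {q} {0ℤ - g} (low₁ x y g (+ q) y≤x) (up₁ x y g (+ q) x<q 1≤y))
              floor₀) (diff₁ g))
        , (λ x<y → trans (cong₂ _-_
            (/ℕ-unique {x - (y + g * + q)} {q} { -1ℤ - g} (low₂ x y g (+ q) y<q 0≤x) (up₂ x y g (+ q) x<y))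
            floor₀) (+-inverseʳ (-1ℤ - g)))
        where
        low₀ : ∀ y g q → 1ℤ + y ≤ q → (-1ℤ - g) * q ≤ - (y + g * q)
        low₀ y g q h = ⟨ h ⟩ ⊕ +≤+ {0} {1} z≤n ∴ solve (y ∷ g ∷ q ∷ [])
        up₀ : ∀ y g q → 1ℤ ≤ y → 1ℤ + (- (y + g * q)) ≤ (-1ℤ - g) * q + q
        up₀ y g q h = ⟨ h ⟩ ∴ solve (y ∷ g ∷ q ∷ [])
        floor₀ : (- (y + g * + q)) /ℕ q ≡ -1ℤ - g
        floor₀ = /ℕ-unique { - (y + g * + q)} {q} { -1ℤ - g} (low₀ y g (+ q) y<q) (up₀ y g (+ q) 1≤y)
        low₁ : ∀ x y g q → y ≤ x → (0ℤ - g) * q ≤ x - (y + g * q)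
        low₁ x y g q h = ⟨ h ⟩ ∴ solve (x ∷ y ∷ g ∷ q ∷ [])
        up₁ : ∀ x y g q → 1ℤ + x ≤ q → 1ℤ ≤ y → 1ℤ + (x - (y + g * q)) ≤ (0ℤ - g) * q + q
        up₁ x y g q h h′ = ⟨ h ⟩ ⊕ ⟨ h′ ⟩ ⊕ +≤+ {0} {1} z≤n ∴ solve (x ∷ y ∷ g ∷ q ∷ [])
        low₂ : ∀ x y g q → 1ℤ + y ≤ q → 0ℤ ≤ x → (-1ℤ - g) * q ≤ x - (y + g * q)
        low₂ x y g q h h′ = ⟨ h ⟩ ⊕ h′ ⊕ +≤+ {0} {1} z≤n ∴ solve (x ∷ y ∷ g ∷ q ∷ [])
        up₂ : ∀ x y g q → 1ℤ + x ≤ y → 1ℤ + (x - (y + g * q)) ≤ (-1ℤ - g) * q + q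
        up₂ x y g q h = ⟨ h ⟩ ∴ solve (x ∷ y ∷ g ∷ q ∷ [])
        diff₁ : ∀ g → 0ℤ - g - (-1ℤ - g) ≡ 1ℤ
        diff₁ = solve-∀

    -- `P` is left open because `s` counts with `≤` at `x = (M j) % q`, while `t` counts with `<` at
    -- the successor of `x`.
    D-count : ∀ {x} {P : ℕ → Set} (P? : Decidable P) → x ℕ.< q → (∀ a → P a → (a ℕ.* j) % q ℕ.≤ x) →
        (∀ a → ¬ P a → x ℕ.< (a ℕ.* j) % q) →
              D (+ x) ≡ + f * + x + + length (filter P? (map suc (upTo m)))
    D-count {x} P? x<q P⇒ ¬P⇒ = trans (D-def (+ x)) (cong (λ s → + f * + x + s) (Σ-count P? m (λ a 1≤a a≤m →
        let cases = floor-difference (+ x) (+ a * + j) (+ ((a ℕ.* j) % q)) ((+ (a ℕ.* j)) /ℕ q)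
                      (trans (sym (pos-* a j)) (a≡a%ℕn+[a/ℕn]*n (+ (a ℕ.* j)) q))
                          (+≤+ (ℕ.n≢0⇒n>0 (off a 1≤a a≤m)))
                      (+≤+ (m%n<n (a ℕ.* j) q)) (+≤+ z≤n) (+≤+ x<q)
        in (λ p → proj₁ cases (+≤+ (P⇒ a p))) , (λ ¬p → proj₂ cases (+≤+ (¬P⇒ a ¬p))))))
      where
      off : ∀ a → 1 ℕ.≤ a → a ℕ.≤ m → (a ℕ.* j) % q ≢ 0
      off a 1≤a a≤m = subst (λ i → i %ℕ q ≢ 0) (trans (+-identityʳ (+ a * + j)) (sym (pos-* a j)))
        (unimodular-%ℕ unimodular a 0ℤ 1≤a (ℕ.≤-<-trans a≤m m<q))

    η≡top : Defs.η k q j ≡ top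
    η≡top = sym (begin
      D last                                              ≡⟨ cong D last≡ ⟩
      D (+ x + (+ L - 1ℤ) * + q)                          ≡⟨ D-shift (+ x) (+ L - 1ℤ) ⟩
      D (+ x) + (+ L - 1ℤ) * + k                          ≡⟨ cong (_+ (+ L - 1ℤ) * + k)
          (D-count _ x<q (λ _ p → p) (λ _ ¬p → ℕ.≰⇒> ¬p)) ⟩
      + f * + x + + Defs.s k q j + (+ L - 1ℤ) * + k       ≡⟨ collect (+ f) (+ x) (+ Defs.s k q j) (+ L) (+ k) ⟩
      + k * + L - + k + + x * + f + + Defs.s k q j        ≡⟨ cong₂ (λ a b → a - + k + b + + Defs.s k q j)
          (pos-* k L) (pos-* x f) ⟨
      Defs.η k q j                                        ∎)
      where
      open ≡-Reasoning
      L x : ℕ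
      L = (suc k ℕ.* j) /′ q
      x = (suc m ℕ.* j) % q
      x<q : x ℕ.< q
      x<q = m%n<n (suc m ℕ.* j) q
      collect : ∀ f x s L k → f * x + s + (L - 1ℤ) * k ≡ k * L - k + x * f + s
      collect = solve-∀
      product : suc k ℕ.* j ≡ suc m ℕ.* j ℕ.+ (f ℕ.* j) ℕ.* q
      product = +-injective (begin
        + (suc k ℕ.* j)                                   ≡⟨ pos-* (suc k) j ⟩
        (1ℤ + + k) * + j                                  ≡⟨ cong (λ κ → (1ℤ + κ) * + j) k≡ ⟩
        (1ℤ + (+ f * + q + + m)) * + j                    ≡⟨ expand (+ f) (+ q) (+ m) (+ j) ⟩
        (1ℤ + + m) * + j + (+ f * + j) * + q              ≡⟨ cong₂ (λ a b → a + b * + q) (pos-* (suc m) j)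
            (pos-* f j) ⟨
        + (suc m ℕ.* j) + + (f ℕ.* j) * + q               ≡⟨ cong (λ a → + (suc m ℕ.* j) + a)
            (pos-* (f ℕ.* j) q) ⟨
        + (suc m ℕ.* j) + + (f ℕ.* j ℕ.* q)               ≡⟨ pos-+ (suc m ℕ.* j) (f ℕ.* j ℕ.* q) ⟨
        + (suc m ℕ.* j ℕ.+ f ℕ.* j ℕ.* q)                 ∎)
        where
        expand : ∀ f q m j → (1ℤ + (f * q + m)) * j ≡ (1ℤ + m) * j + (f * j) * q
        expand = solve-∀
      x≡ : (suc k ℕ.* j) % q ≡ x
      x≡ = trans (cong (_% q) product) ([m+kn]%n≡m%n (suc m ℕ.* j) (f ℕ.* j) q)
      -- `last` is `L − 1` whole turns past `x`. The turns contribute `k L − k` to `η`, and `D` at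
      -- `x` contributes the rest.
      last≡ : last ≡ + x + (+ L - 1ℤ) * + q
      last≡ = trans last-def (trans
          (cong (_- + q) (trans (sym (pos-* (suc k) j)) (trans (a≡a%ℕn+[a/ℕn]*n (+ (suc k ℕ.* j)) q)
        (cong (λ r → + r + + L * + q) x≡)))) (regroup (+ x) (+ L) (+ q)))
        where
        regroup : ∀ x L q → x + L * q - q ≡ x + (L - 1ℤ) * q
        regroup = solve-∀

    vertex : ℤ → ℤ → ℤ
    vertex y e = + ((Y (D e + y) - 1ℤ) %ℕ suc k)

    vertex-shift : ∀ y e z → vertex y (e + z * + q) ≡ vertex y e
    vertex-shift y e z = cong +_
        (trans (cong (_%ℕ suc k) (trans
        (cong (_- 1ℤ) (trans (cong Y (Lift.shift (shifted-lift y) e z)) (Y.shift (D e + y) z)))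
        (swap (Y (D e + y)) (z * + suc k)))) (%ℕ-shift (Y (D e + y) - 1ℤ) z (suc k)))
      where
      swap : ∀ a b → a + b - 1ℤ ≡ a - 1ℤ + b
      swap = solve-∀

    module _ (w : ℕ) (1≤w : 1 ℕ.≤ w) (w≤f : w ℕ.≤ f) where

      -- The cycles `c` are numbered from the top: `w = 1` is the largest shift `f − 1`.
      y : ℤ
      y = + f - + w

      0≤y : 0ℤ ≤ y
      0≤y = ⟨ +≤+ w≤f ⟩

      y<f : 1ℤ + y ≤ + f
      y<f = below (+ f) (+ w) (+≤+ 1≤w)
        where
        below : ∀ f w → 1ℤ ≤ w → 1ℤ + (f - w) ≤ f
        below f w h = ⟨ h ⟩ ∴ solve (f ∷ w ∷ [])

      private
        vertex-value : ∀ e v z → D e + y + e /ℕ q ≡ v + z * + suc k → 0ℤ ≤ v → v ≤ + k → vertex y e ≡ v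
        vertex-value e (+ n) z eq _ n≤k = cong +_
            (trans (cong (_%ℕ suc k) (trans (cancel (D e + y) ((D e + y) /ℕ k))
            (trans (cong (λ g → D e + y + g) (D-/ℕ y 0≤y y<f e)) eq)))
            (trans (%ℕ-shift (+ n) z (suc k)) (m<n⇒m%n≡m (s≤s (drop‿+≤+ n≤k)))))
          where
          cancel : ∀ a g → 1ℤ + a + g - 1ℤ ≡ a + g
          cancel = solve-∀

        -1/ℕq : -1ℤ /ℕ q ≡ -1ℤ
        -1/ℕq = /ℕ-unique { -1ℤ} {q} { -1ℤ} (lower (+ q) (+≤+ (ℕ.>-nonZero⁻¹ q))) (≤-reflexive (upper (+ q)))
          where
          lower : ∀ κ → 1ℤ ≤ κ → -1ℤ * κ ≤ -1ℤ
          lower κ h = ⟨ h ⟩ ∴ solve (κ ∷ [])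
          upper : ∀ κ → 0ℤ ≡ -1ℤ * κ + κ
          upper = solve-∀

        w≤k : w ℕ.≤ k
        w≤k = ℕ.≤-trans w≤f (drop‿+≤+ (subst (λ κ → + f ≤ κ) (sym k≡) (≤-trans (+≤+ (ℕ.m≤m*n f q))
                (≤-trans (≤-reflexive (pos-* f q)) (i≤i+j (+ f * + q) (+ m))))))

        -- The sequence `c` starts at place -1, whose edge is `D -1ℤ + f − w = −w`. Its target is
        -- position `−w`, that is, vertex `−w − 1 ≡ k − w` modulo `k + 1`.
        endpoint : vertex y -1ℤ ≡ + k - + w
        endpoint = vertex-value -1ℤ (+ k - + w) -1ℤ
            (trans (cong₂ (λ d g → d + y + g) D-before-0 -1/ℕq) (collect (+ f) (+ w) (+ k))) ⟨ +≤+ w≤k ⟩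
                (below (+ k) (+ w) (+≤+ z≤n))
          where
          collect : ∀ f w k → 0ℤ - f + (f - w) + -1ℤ ≡ k - w + -1ℤ * (1ℤ + k)
          collect = solve-∀
          below : ∀ k w → 0ℤ ≤ w → k - w ≤ k
          below k w h = ⟨ h ⟩ ∴ solve (k ∷ w ∷ [])

        interior : ∀ r x → (r ℕ.* j) % q ≡ suc x →
                   vertex y (+ r * + j - 1ℤ) ≡ - + 1 - + w + + ((r ℕ.* j) % q ℕ.* f) + + Defs.t k q r j
        interior r x rj%q = trans (vertex-value e (D (+ x) + y) (+ g) e-value nonneg bounded)
            (trans (cong (_+ y) (D-count P? x<q (λ _ p → ℕ.≤-pred (subst (_ ℕ.<_) rj%q p))
            (λ _ ¬p → subst (ℕ._≤ _) rj%q (ℕ.≮⇒≥ ¬p)))) (trans (collect (+ f) (+ x) (+ n) (+ w))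
            (cong₂ (λ a b → - + 1 - + w + a + b)
                (trans (sym (pos-* (suc x) f)) (cong (λ x → + (x ℕ.* f)) (sym rj%q))) (cong +_ (sym t≡)))))
          where
          P? : Decidable (λ a → (a ℕ.* j) % q ℕ.< (r ℕ.* j) % q)
          P? a = (a ℕ.* j) % q ℕ.<? (r ℕ.* j) % q
          n g : ℕ
          n = length (filter P? (map suc (upTo m)))
          g = (r ℕ.* j) /′ q
          e : ℤ
          e = + r * + j - 1ℤ
          x<q : x ℕ.< q
          x<q = ℕ.<-trans (ℕ.n<1+n x) (subst (ℕ._< q) rj%q (m%n<n (r ℕ.* j) q))
          e≡ : e ≡ + x + + g * + q
          e≡ = trans (cong (_- 1ℤ) (trans (sym (pos-* r j))
              (trans (a≡a%ℕn+[a/ℕn]*n (+ (r ℕ.* j)) q) (cong (λ r → + r + + g * + q) rj%q))))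
                 (drop (+ x) (+ g * + q))
            where
            drop : ∀ x z → 1ℤ + x + z - 1ℤ ≡ x + z
            drop = solve-∀
          e-value : D e + y + e /ℕ q ≡ D (+ x) + y + + g * + suc k
          e-value = trans (cong (λ e → D e + y + e /ℕ q) e≡)
              (trans (cong₂ (λ d h → d + y + h) (D-shift (+ x) (+ g))
              (trans (/ℕ-shift (+ x) (+ g) q) (cong (λ z → + z + + g) (m<n⇒m/n≡0 x<q))))
                  (regroup (D (+ x)) (+ g) (+ k) y))
            where
            regroup : ∀ d g k y → d + g * k + y + (0ℤ + g) ≡ d + y + g * (1ℤ + k)
            regroup = solve-∀
          nonneg : 0ℤ ≤ D (+ x) + y
          nonneg = Crossing.above (crossing-0 y 0≤y y<f) (+≤+ z≤n)
          bounded : D (+ x) + y ≤ + k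
          bounded = fit (D (+ x)) y (+ f) (+ k) y<f
              (≤-trans (D-gap₁ {+ x} {+ q} (+≤+ x<q)) (≤-reflexive (trans (cong D (one (+ q)))
                      (trans (D-shift 0ℤ 1ℤ) (trans (cong (_+ 1ℤ * + k) D-0) (one′ (+ k)))))))
            where
            one : ∀ q → q ≡ 0ℤ + 1ℤ * q
            one = solve-∀
            one′ : ∀ k → 0ℤ + 1ℤ * k ≡ k
            one′ = solve-∀
            fit : ∀ d y f k → 1ℤ + y ≤ f → d + f ≤ k → d + y ≤ k
            fit d y f k h₁ h₂ = ⟨ h₁ ⟩ ⊕ ⟨ h₂ ⟩ ⊕ +≤+ {0} {1} z≤n ∴ solve (d ∷ y ∷ f ∷ k ∷ [])
          collect : ∀ f x n w → f * x + n + (f - w) ≡ - + 1 - w + (1ℤ + x) * f + (1ℤ + n)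
          collect = solve-∀
          0%q : (0 ℕ.* j) % q ℕ.< (r ℕ.* j) % q
          0%q = subst₂ ℕ._<_ (sym (m<n⇒m%n≡m (ℕ.≤-<-trans z≤n x<q))) (sym rj%q) (s≤s z≤n)
          -- `t` also counts `a = 0`, which is absent from the sum in `D`; this compensates the -1
          -- in the formula for `c`.
          t≡ : Defs.t k q r j ≡ suc n
          t≡ = trans (cong length (filter-accept P? 0%q))
              (cong (λ l → suc (length (filter P? l))) (sym (map-upTo suc m)))

      c≡vertex : ∀ r → r ℕ.≤ q → Defs.c k q j w r ≡ vertex y (+ r * + j - 1ℤ)
      c≡vertex zero _ = sym endpoint
      c≡vertex (suc r) r≤q with suc r ℕ.≟ q
      ... | yes refl = sym (trans (cong (vertex y) (swap (+ suc r) (+ j)))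
          (trans (vertex-shift y -1ℤ (+ j)) endpoint))
        where
        swap : ∀ r j → r * j - 1ℤ ≡ -1ℤ + j * r
        swap = solve-∀
      ... | no r≢q = sym (interior (suc r) _ (sym (ℕ.suc-pred ((suc r ℕ.* j) % q) {{ℕ.≢-nonZero off}})))
        where
        off : (suc r ℕ.* j) % q ≢ 0
        off = subst (λ i → i %ℕ q ≢ 0) (trans (+-identityʳ (+ suc r * + j)) (sym (pos-* (suc r) j)))
                (unimodular-%ℕ unimodular (suc r) 0ℤ (s≤s z≤n) (ℕ.≤∧≢⇒< r≤q r≢q))

    vertex-injective : ∀ {y y′ e e′} → 0ℤ ≤ y → 1ℤ + y ≤ + f → 0ℤ ≤ y′ → 1ℤ + y′ ≤ + f → vertex y e
        ≡ vertex y′ e′ →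
                       (∃[ z ] e ≡ e′ + z * + q) × y ≡ y′
    vertex-injective {y} {y′} {e} {e′} 0≤y y<f 0≤y′ y′<f eq = (z , proj₁ same) , proj₂ same
      where
      mod = %ℕ-≡⇒ (Y (D e + y) - 1ℤ) (Y (D e′ + y′) - 1ℤ) (suc k) (+-injective eq)
      z : ℤ
      z = proj₁ mod
      lower : ∀ a b c → a - 1ℤ ≡ b - 1ℤ + c → a ≡ b + c
      lower a b c eq = trans (undo a) (trans (cong (_+ 1ℤ) eq) (collect b c))
        where
        undo : ∀ a → a ≡ a - 1ℤ + 1ℤ
        undo = solve-∀
        collect : ∀ b c → b - 1ℤ + c + 1ℤ ≡ b + c
        collect = solve-∀
      same : e ≡ e′ + z * + q × y ≡ y′
      same = D-disjoint {y} {y′} {e} {e′ + z * + q} 0≤y y<f 0≤y′ y′<f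
          (Y.injective {D e + y} {D (e′ + z * + q) + y′}
        (trans (lower (Y (D e + y)) (Y (D e′ + y′)) (z * + suc k) (proj₂ mod))
          (trans (sym (Y.shift (D e′ + y′) z)) (cong Y (sym (Lift.shift (shifted-lift y′) e′ z))))))

    edge-at : ∀ n v → Edge n k (+ ((X n v - 1ℤ) %ℕ suc k)) (+ ((Y v - 1ℤ) %ℕ suc k))
    -- The edge `v` is the same as `n + r`, and the numbering of `Edge` starts at 1 where `r` starts
    -- at 0.
    edge-at n v = suc r , s≤s z≤n , n%ℕd<d (v - n) k , cong +_
        (trans (cong (_%ℕ suc k) source) (%ℕ-shift (+ suc r + n - + 2) g (suc k)))
        , cong +_ (trans (cong (_%ℕ suc k) target)
            (trans (%ℕ-shift (+ (v %ℕ k)) (v /ℕ k) (suc k)) (trans (m<n⇒m%n≡m (ℕ.m≤n⇒m≤1+n (n%ℕd<d v k)))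
            (trans (cong (_%ℕ k) v≡) (%ℕ-shift (+ suc r + n - + 1) g k)))))
      where
      r : ℕ
      r = (v - n) %ℕ k
      g : ℤ
      g = (v - n) /ℕ k
      split : v - n ≡ + r + g * + k
      split = a≡a%ℕn+[a/ℕn]*n (v - n) k
      v≡ : v ≡ + suc r + n - + 1 + g * + k
      v≡ = trans (undo v n) (trans (cong (_+ n) split) (collect (+ r) g (+ k) n))
        where
        undo : ∀ v n → v ≡ v - n + n
        undo = solve-∀
        collect : ∀ r g k n → r + g * k + n ≡ 1ℤ + r + n - + 1 + g * k
        collect = solve-∀
      source : X n v - 1ℤ ≡ + suc r + n - + 2 + g * + suc k
      source = trans (cong (λ x → x + g - 1ℤ) v≡) (collect (+ suc r + n) g (+ k))
        where
        collect : ∀ a g k → a - + 1 + g * k + g - 1ℤ ≡ a - + 2 + g * (1ℤ + k)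
        collect = solve-∀
      target : Y v - 1ℤ ≡ + (v %ℕ k) + (v /ℕ k) * + suc k
      target = trans (cong (λ x → 1ℤ + x + v /ℕ k - 1ℤ) (a≡a%ℕn+[a/ℕn]*n v k))
          (collect (+ (v %ℕ k)) (v /ℕ k) (+ k))
        where
        collect : ∀ r g k → 1ℤ + (r + g * k) + g - 1ℤ ≡ r + g * (1ℤ + k)
        collect = solve-∀

    module _ (w : ℕ) (1≤w : 1 ℕ.≤ w) (w≤f : w ℕ.≤ f) where

      c-isCycle : IsCycle (Defs.η k q j) k q (Defs.c k q j w)
      c-isCycle = record
        { nonempty = ℕ.>-nonZero⁻¹ q
        ; vertices = λ r r≤q → subst (Vertex k) (sym (c≡ r r≤q))
            (+≤+ z≤n , +≤+ (ℕ.≤-pred (n%ℕd<d (Y (D (at r) + y′) - 1ℤ) (suc k))))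
        ; edges    = λ r r<q → subst₂ (Edge (Defs.η k q j) k) (sym (c≡ r (ℕ.<⇒≤ r<q)))
            (sym (c≡ (suc r) r<q)) (edge r)
        ; closed   = trans (c≡ q ℕ.≤-refl)
            (trans (cong (vertex y′) (swap (+ q) (+ j)))
            (trans (vertex-shift y′ (at 0) (+ j)) (sym (c≡ 0 z≤n))))
        ; simple   = λ r s r<q s<q eq → simple r s r<q s<q (proj₁ (proj₁ (same r s r<q s<q eq)))
            (proj₂ (proj₁ (same r s r<q s<q eq)))
        }
        where
        y′ : ℤ
        y′ = y w 1≤w w≤f
        c≡ = c≡vertex w 1≤w w≤f
        0≤y′ = 0≤y w 1≤w w≤f
        y′<f = y<f w 1≤w w≤f
        at : ℕ → ℤ
        at r = + r * + j - 1ℤ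
        swap : ∀ q j → q * j - 1ℤ ≡ 0ℤ * j - 1ℤ + j * q
        swap = solve-∀
        back-by-j : ∀ r → at (suc r) - + j ≡ at r
        back-by-j r = drop (+ r) (+ j)
          where
          drop : ∀ r j → (1ℤ + r) * j - 1ℤ - j ≡ r * j - 1ℤ
          drop = solve-∀
        edge : ∀ r → Edge (Defs.η k q j) k (vertex y′ (at r)) (vertex y′ (at (suc r)))
        edge r = subst₂ (λ n a → Edge n k a (vertex y′ (at (suc r)))) (sym η≡top)
          (cong (λ P → + ((P - 1ℤ) %ℕ suc k))
              (trans (Orbit.link (model-orbit y′ 0≤y′ y′<f) (at (suc r)))
              (cong (λ e → Y (D e + y′)) (back-by-j r))))
          (edge-at top (D (at (suc r)) + y′))
        same : ∀ r s → r ℕ.< q → s ℕ.< q → Defs.c k q j w r ≡ Defs.c k q j w s →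
            (∃[ z ] at r ≡ at s + z * + q) × y′ ≡ y′
        same r s r<q s<q eq = vertex-injective 0≤y′ y′<f 0≤y′ y′<f
            (trans (sym (c≡ r (ℕ.<⇒≤ r<q))) (trans eq (c≡ s (ℕ.<⇒≤ s<q))))
        simple : ∀ r s → r ℕ.< q → s ℕ.< q → ∀ z → at r ≡ at s + z * + q → r ≡ s
        simple r s r<q s<q z eq = begin
          r                          ≡⟨ m<n⇒m%n≡m r<q ⟨
          + r %ℕ q                   ≡⟨ cong (_%ℕ q) r≡ ⟩
          (+ s + c * + q) %ℕ q       ≡⟨ %ℕ-shift (+ s) c q ⟩
          + s %ℕ q                   ≡⟨ m<n⇒m%n≡m s<q ⟩
          s                          ∎
          where
          open ≡-Reasoning
          u v c : ℤ
          u = proj₁ unimodular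
          v = proj₁ (proj₂ unimodular)
          c = u * z + (+ r - + s) * v
          product : + r * + j ≡ + s * + j + z * + q
          product = trans (undo (+ r * + j)) (trans (cong (_+ 1ℤ) eq) (collect (+ s * + j) (z * + q)))
            where
            undo : ∀ a → a ≡ a - 1ℤ + 1ℤ
            undo = solve-∀
            collect : ∀ b c → b - 1ℤ + c + 1ℤ ≡ b + c
            collect = solve-∀
          r≡ : + r ≡ + s + c * + q
          r≡ = trans (split (+ r) (+ s))
              (trans (cong (λ i → + s + (+ r - + s) * i) (sym (proj₂ (proj₂ unimodular))))
              (trans (expand (+ r) (+ s) u v (+ j) (+ q))
                  (trans (cong (λ rj → + s + (u * (rj - + s * + j) + (+ r - + s) * v * + q)) product)
                (collect (+ r) (+ s) u v (+ j) (+ q) z))))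
            where
            split : ∀ r s → r ≡ s + (r - s) * 1ℤ
            split = solve-∀
            expand : ∀ r s u v j q → s + (r - s) * (u * j + v * q) ≡ s + (u * (r * j - s * j) + (r - s) * v * q)
            expand = solve-∀
            collect : ∀ r s u v j q z → s + (u * (s * j + z * q - s * j) + (r - s) * v * q) ≡ s +
                (u * z + (r - s) * v) * q
            collect = solve-∀

      -- Model cycles with different shifts have no vertex in common, so one cycle cannot even
      -- traverse the first edge of the other.
      c-distinct : ∀ w′ (1≤w′ : 1 ℕ.≤ w′) (w′≤f : w′ ℕ.≤ f) → w ≢ w′ → ¬ SameCycle q (Defs.c k q j w)
          (Defs.c k q j w′)
      c-distinct w′ 1≤w′ w′≤f w≢w′ same = contradict
          (Equivalence.to (same _ _) (0 , ℕ.>-nonZero⁻¹ q , refl , refl))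
        where
        contradict : Traverses q (Defs.c k q j w′) (Defs.c k q j w 0) (Defs.c k q j w 1) → ⊥
        contradict (r , r<q , eq , _) = w≢w′
            (sym (+-injective (cancel (+ f) (+ w) (+ w′) (proj₂ (vertex-injective
          {e = + 0 * + j - 1ℤ} {+ r * + j - 1ℤ} (0≤y w 1≤w w≤f) (y<f w 1≤w w≤f) (0≤y w′ 1≤w′ w′≤f)
              (y<f w′ 1≤w′ w′≤f)
          (trans (sym (c≡vertex w 1≤w w≤f 0 z≤n)) (trans (sym eq) (c≡vertex w′ 1≤w′ w′≤f r (ℕ.<⇒≤ r<q)))))))))
          where
          cancel : ∀ f w w′ → f - w ≡ f - w′ → w′ ≡ w
          cancel f w w′ eq = trans (undo f w′) (trans (cong (λ d → f - d) (sym eq)) (sym (undo f w)))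
            where
            undo : ∀ f w → w ≡ f - (f - w)
            undo = solve-∀

  -- Every local peak is some `η`

  gcd≡1⇒unimodular : ∀ j q → gcd j q ≡ 1 → Unimodular (+ j) q
  gcd≡1⇒unimodular j q eq with bézout j q
  ... | u , w , unit = u , w , trans unit (cong +_ eq)

  unimodular⇒gcd≡1 : ∀ j q → Unimodular (+ j) q → gcd j q ≡ 1
  unimodular⇒gcd≡1 j q (u , w , unit) with gcd[m,n]∣m j q | gcd[m,n]∣n j q
  ... | divides a j≡ | divides b q≡ = ∣1⇒≡1 (divides ∣ u * + a + w * + b ∣ (trans (cong ∣_∣ (begin
    1ℤ                                       ≡⟨ unit ⟨
    u * + j + w * + q                        ≡⟨ cong₂ (λ x y → u * + x + w * + y) j≡ q≡ ⟩
    u * + (a ℕ.* d) + w * + (b ℕ.* d)        ≡⟨ cong₂ (λ x y → u * x + w * y) (pos-* a d) (pos-* b d) ⟩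
    u * (+ a * + d) + w * (+ b * + d)        ≡⟨ collect u (+ a) w (+ b) (+ d) ⟩
    (u * + a + w * + b) * + d                ∎)) (abs-* (u * + a + w * + b) (+ d))))
    where
    open ≡-Reasoning
    d : ℕ
    d = gcd j q
    collect : ∀ u a w b d → u * (a * d) + w * (b * d) ≡ (u * a + w * b) * d
    collect = solve-∀

  module _ (k : ℕ) .{{k≢0 : NonZero k}} where

    open Dynamics k
    open Orbits k
    open OrbitType k {{k≢0}}
    open Nullities k

    private
      period≡ : + period k ≡ (1ℤ + + k) * + k
      period≡ = trans (pos-+ (k ℕ.* k) k) (trans (cong (_+ + k) (pos-* k k)) (factor (+ k)))
        where
        factor : ∀ κ → κ * κ + κ ≡ (1ℤ + κ) * κ
        factor = solve-∀

    module _ (q : ℕ) .{{q≢0 : NonZero q}} (q≤k : q ℕ.≤ k) (J : ℤ) (unimodular : Unimodular J q) where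

      open Model k q q≤k J unimodular

      private
        D-turns : D (0ℤ + (1ℤ + + k) * + q) ≡ + period k
        D-turns = trans (D-shift 0ℤ (1ℤ + + k))
            (trans (cong (_+ (1ℤ + + k) * + k) D-0) (trans (+-identityˡ _) (sym period≡)))

      -- `D` takes the values 0 and `k² + k` at the places 0 and `(k + 1) q`, so
      -- `last = (k + 1) J − q` lies strictly between these. As `q ≤ k`, this leaves just
      -- `1 ≤ J ≤ q`.
      top-range⇒ : 1ℤ + 0ℤ ≤ top → 1ℤ + top ≤ + period k → 1ℤ ≤ J × J ≤ + q
      top-range⇒ 0<top top<period = lower , upper
        where
        0<last : 1ℤ + 0ℤ ≤ last
        0<last = Lift.cancel-< D-lift {0ℤ} {last} (subst (λ d → 1ℤ + d ≤ top) (sym D-0) 0<top)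
        last< : 1ℤ + last ≤ 0ℤ + (1ℤ + + k) * + q
        last< = Lift.cancel-< D-lift {last} (subst (λ d → 1ℤ + top ≤ d) (sym D-turns) top<period)
        lower : 1ℤ ≤ J
        lower with ≤⊎> 1ℤ J
        ... | inj₁ le = le
        ... | inj₂ J<1 = ⊥-elim (impossible (+ k) J (+ q) (+≤+ z≤n) (subst (λ l → 1ℤ + 0ℤ ≤ l) last-def 0<last)
            (suc k ⊛ ⟨ J<1 ⟩))
          where
          impossible : ∀ κ J q → 0ℤ ≤ q → 1ℤ + 0ℤ ≤ (1ℤ + κ) * J - q → 0ℤ ≤ (1ℤ + κ) * (1ℤ - (1ℤ + J)) → ⊥
          impossible κ J q h₀ h₁ h₂ = linear-⊥ (h₀ ⊕ ⟨ h₁ ⟩ ⊕ h₂) (solve (κ ∷ J ∷ q ∷ []))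
        upper : J ≤ + q
        upper with ≤⊎> J (+ q)
        ... | inj₁ le = le
        ... | inj₂ q<J = ⊥-elim (impossible (+ k) J (+ q) (+≤+ q≤k)
            (subst (λ l → 1ℤ + l ≤ 0ℤ + (1ℤ + + k) * + q) last-def last<) (suc k ⊛ ⟨ q<J ⟩))
          where
          impossible : ∀ κ J q → q ≤ κ → 1ℤ + ((1ℤ + κ) * J - q) ≤ 0ℤ + (1ℤ + κ) * q → 0ℤ ≤ (1ℤ + κ) *
              (J - (1ℤ + q)) → ⊥
          impossible κ J q h₀ h₁ h₂ = linear-⊥ (⟨ h₀ ⟩ ⊕ ⟨ h₁ ⟩ ⊕ h₂ ⊕ +≤+ {0} {1} z≤n) (solve (κ ∷ J ∷ q ∷ []))

      top-range⇐ : 1ℤ ≤ J → J ≤ + q → 1ℤ + 0ℤ ≤ top × 1ℤ + top ≤ + period k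
      top-range⇐ 1≤J J≤q =
          subst (λ d → 1ℤ + d ≤ top) D-0
              (Lift.strict D-lift {0ℤ} {last} (subst (λ l → 1ℤ + 0ℤ ≤ l) (sym last-def)
            (lower (+ k) J (+ q) (+≤+ q≤k) (suc k ⊛ ⟨ 1≤J ⟩))))
        , subst (λ d → 1ℤ + top ≤ d) D-turns
            (Lift.strict D-lift {last} (subst (λ l → 1ℤ + l ≤ 0ℤ + (1ℤ + + k) * + q) (sym last-def)
            (upper (+ k) J (+ q) (+≤+ (ℕ.>-nonZero⁻¹ q)) (suc k ⊛ ⟨ J≤q ⟩))))
        where
        lower : ∀ κ J q → q ≤ κ → 0ℤ ≤ (1ℤ + κ) * (J - 1ℤ) → 1ℤ + 0ℤ ≤ (1ℤ + κ) * J - q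
        lower κ J q h₀ h₁ = ⟨ h₀ ⟩ ⊕ h₁ ∴ solve (κ ∷ J ∷ q ∷ [])
        upper : ∀ κ J q → 1ℤ ≤ q → 0ℤ ≤ (1ℤ + κ) * (q - J) → 1ℤ + ((1ℤ + κ) * J - q) ≤ 0ℤ + (1ℤ + κ) * q
        upper κ J q h₀ h₁ = ⟨ h₀ ⟩ ⊕ h₁ ∴ solve (κ ∷ J ∷ q ∷ [])

      -- The orbit through edge n bounds n from below by top, the one through
      -- edge n − 1 bounds it from above.
      squeezed : ∀ {n} (O O′ : Orbit n q J) → Orbit.V O J ≡ n → Orbit.V O′ J ≡ -1ℤ + n → n ≡ top
      squeezed {n} O O′ V≡n V′≡n-1 = ≤-antisym (upper (classify O′)) (lower (classify O))
        where
        F : ℤ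
        F = + f
        place : ∀ {U} (cl : Classified n U) → U J ≡ D (J - Classified.origin cl) + Classified.y cl
        place {U} cl = trans (cong U (split J (Classified.origin cl)))
            (Classified.V≡ cl (J - Classified.origin cl))
          where
          split : ∀ J o → J ≡ o + (J - o)
          split = solve-∀
        lower : Classified n (Orbit.V O) → top ≤ n
        lower cl with ≤⊎> last (J - Classified.origin cl)
        ... | inj₁ le = bound n (D (J - origin)) top y (trans (sym V≡n) (place cl)) 0≤y (Lift.mono D-lift le)
          where
          open Classified cl
          bound : ∀ n d t y → n ≡ d + y → 0ℤ ≤ y → t ≤ d → t ≤ n
          bound n d t y eq h₁ h₂ = ⟨ ≤-reflexive (sym eq) ⟩ ⊕ h₁ ⊕ ⟨ h₂ ⟩ ∴ solve (n ∷ d ∷ t ∷ y ∷ [])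
        ... | inj₂ gt = ⊥-elim (impossible n (D (J - origin)) top y F (trans (sym V≡n) (place cl)) <n
            (D-gap₁ gt))
          where
          open Classified cl
          impossible : ∀ n d t y f → n ≡ d + y → 1ℤ + (t + y) ≤ n + f → d + f ≤ t → ⊥
          impossible n d t y f eq h₁ h₂ = linear-⊥ (⟨ ≤-reflexive eq ⟩ ⊕ ⟨ h₁ ⟩ ⊕ ⟨ h₂ ⟩)
              (solve (n ∷ d ∷ t ∷ y ∷ f ∷ []))
        upper : Classified n (Orbit.V O′) → n ≤ top
        upper cl with ≤⊎> last (J - Classified.origin cl)
        ... | inj₁ le = ⊥-elim (impossible n (D (J - origin)) top y (trans (sym V′≡n-1) (place cl)) n≤
            (Lift.mono D-lift le))
          where
          open Classified cl
          impossible : ∀ n d t y → -1ℤ + n ≡ d + y → n ≤ t + y → t ≤ d → ⊥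
          impossible n d t y eq h₁ h₂ = linear-⊥ (⟨ ≤-reflexive (sym eq) ⟩ ⊕ ⟨ h₁ ⟩ ⊕ ⟨ h₂ ⟩)
              (solve (n ∷ d ∷ t ∷ y ∷ []))
        ... | inj₂ gt = bound n (D (J - origin)) top y F (trans (sym V′≡n-1) (place cl)) y<f (D-gap₁ gt)
          where
          open Classified cl
          bound : ∀ n d t y f → -1ℤ + n ≡ d + y → 1ℤ + y ≤ f → d + f ≤ t → n ≤ t
          bound n d t y f eq h₁ h₂ = ⟨ ≤-reflexive eq ⟩ ⊕ ⟨ h₁ ⟩ ⊕ ⟨ h₂ ⟩ ∴ solve (n ∷ d ∷ t ∷ y ∷ f ∷ [])

    module _ (q j : ℕ) .{{q≢0 : NonZero q}} (q≤k : q ℕ.≤ k) (1≤j : 1 ℕ.≤ j) (j≤q : j ℕ.≤ q) (gcd≡1 : gcd j q ≡ 1) where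

      private
        unimodular : Unimodular (+ j) q
        unimodular = gcd≡1⇒unimodular j q gcd≡1

        open Formulas k q j q≤k unimodular using (η≡top)
        open Peak k q q≤k (+ j) unimodular using (N-top; N-suc<; N-pred<)
        open Model k q q≤k (+ j) unimodular using (top)

      N-η : N (η k q j) k ≡ Defs.f k q
      N-η = trans (cong (λ n → N n k) η≡top) N-top

      η-localPeak : LocalPeak k (η k q j)
      η-localPeak = subst (LocalPeak k) (sym η≡top) (record
        { positive    = suc[i]≤j⇒i<j (proj₁ range)
        ; belowPeriod = suc[i]≤j⇒i<j (proj₂ range)
        ; left        = N-pred<
        ; right       = N-suc<
        })
        where
        range : 1ℤ + 0ℤ ≤ top × 1ℤ + top ≤ + period k
        range = top-range⇐ q q≤k (+ j) unimodular (+≤+ 1≤j) (+≤+ j≤q)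

    IsPeakPoint : ℤ → Set
    IsPeakPoint n = ∃[ q ] ∃[ j ] Σ[ q≢0 ∈ NonZero q ]
        (q ℕ.≤ k × 1 ℕ.≤ j × j ℕ.≤ q × gcd j q ≡ 1 × n ≡ η k q {{q≢0}} j)

    top-peakPoint : ∀ n q .{{_ : NonZero q}} J (unimodular : Unimodular J q) (q≤k : q ℕ.≤ k)
        → 1ℤ ≤ J → J ≤ + q →
                    n ≡ Model.top k q q≤k J unimodular → IsPeakPoint n
    top-peakPoint n q@(suc _) (+ j) unimodular q≤k 1≤J J≤q n≡ =
      q , j , _ , q≤k , drop‿+≤+ 1≤J , drop‿+≤+ J≤q , unimodular⇒gcd≡1 j q unimodular , trans n≡
          (sym (Formulas.η≡top k q j q≤k unimodular))

    localPeak⇒peakPoint : ∀ n → LocalPeak k n → IsPeakPoint n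
    localPeak⇒peakPoint n peak = from-cycles (cycle-at n (on-cycle (neighbours-suc n) right))
        (cycle-at (-1ℤ + n) (subst (λ v → BackwardCycle n (X n v)) (+-comm n -1ℤ)
        (on-cycle (neighbours-pred n) left)))
      where
      open LocalPeak peak

      -- Were the source of the moved edge on the path, all invariants would persist in the
      -- neighbouring graph and `N` could not drop.
      on-cycle : ∀ {n′ v} → Neighbours n n′ v → N n′ k ℕ.< N n k → BackwardCycle n (X n v)
      on-cycle {n′} {v} nb drop with path-or-cycle n (X n v)
      ... | inj₂ C    = C
      ... | inj₁ path = ⊥-elim (ℕ.<⇒≱ drop (path⇒N≤ nb (subst (Path n) (Neighbours.source nb) path)))

      CycleAt : ℤ → Set
      CycleAt v = ∃[ q ] ∃[ J ] Σ[ q≢0 ∈ NonZero q ] Unimodular J q × Σ[ O ∈ Orbit n q J ] Orbit.V O J ≡ v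

      cycle-at : ∀ v → BackwardCycle n (X n v) → CycleAt v
      cycle-at v C = convert (cycle⇒orbit C)
        where
        convert : (∃[ q ] ∃[ J ] Σ[ q≢0 ∈ NonZero q ] Unimodular J q × Σ[ O ∈ Orbit n q J ] Y (Orbit.V O 0ℤ)
            ≡ X n v) → CycleAt v
        -- The edge into the position has place 0, so the edge `v` out of it has place `J`.
        convert (q , J , q≢0 , unimodular , O , ends) = q , J , q≢0 , unimodular , O ,
          X.injective n {Orbit.V O J} {v}
              (trans (Orbit.link O J) (trans (cong (λ e → Y (Orbit.V O e)) (+-inverseʳ J)) ends))

      from-cycles : CycleAt n → CycleAt (-1ℤ + n) → IsPeakPoint n
      from-cycles (q , J , q≢0 , unimodular , O , V≡n) (q′ , J′ , q′≢0 , unimodular′ , O′ , V′≡n-1) =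
        same-type (orbit-type-unique {{q≢0}} {{q′≢0}} unimodular unimodular′ O O′) O′ V′≡n-1
        where
        instance _ = q≢0
        q≤k : q ℕ.≤ k
        q≤k = orbit⇒q≤k O
        same-type : q ≡ q′ × J ≡ J′ → (O′ : Orbit n q′ J′) → Orbit.V O′ J′ ≡ -1ℤ + n → IsPeakPoint n
        same-type (refl , refl) O′ V′≡n-1 = top-peakPoint n q J unimodular q≤k (proj₁ range) (proj₂ range) n≡top
          where
          open Model k q q≤k J unimodular using (top)
          n≡top : n ≡ top
          n≡top = squeezed q q≤k J unimodular O O′ V≡n V′≡n-1
          range : 1ℤ ≤ J × J ≤ + q
          range = top-range⇒ q q≤k J unimodular (subst (1ℤ + 0ℤ ≤_) n≡top (i<j⇒suc[i]≤j positive))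
                    (subst (λ n → 1ℤ + n ≤ + period k) n≡top (i<j⇒suc[i]≤j belowPeriod))

open import Defs
open import Data.Integer.Base using (ℤ)
open import Data.Nat.Base using (ℕ; NonZero; _≤_)
open import Data.Nat.GCD using (gcd)
open import Data.Product.Base using (Σ-syntax; ∃-syntax; _×_; _,_)
open import Function.Bundles using (_⇔_; mk⇔)
open import Relation.Binary.PropositionalEquality using (_≡_; _≢_; sym; trans; cong; subst)
open import Relation.Nullary.Negation using (¬_)
open Peaks

theorem7p5 : (k : ℕ) .{{_ : NonZero k}} →
    ( (q j : ℕ) .{{_ : NonZero q}} → q ≤ k → 1 ≤ j → j ≤ q → gcd j q ≡ 1 →
    ( (w : ℕ) → 1 ≤ w → w ≤ f k q → IsCycle (η k q j) k q (c k q j w) )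
    × ( (w w′ : ℕ) → 1 ≤ w → w ≤ f k q → 1 ≤ w′ → w′ ≤ f k q → w ≢ w′ →
    ¬ SameCycle q (c k q j w) (c k q j w′) )
    × N (η k q j) k ≡ f k q
    × LocalPeak k (η k q j) )
    × ( (n : ℤ) → LocalPeak k n ⇔
    (∃[ q ] ∃[ j ] Σ[ q≢0 ∈ NonZero q ]
    (q ≤ k × 1 ≤ j × j ≤ q × gcd j q ≡ 1 × n ≡ η k q {{q≢0}} j)) )
    × ( (n : ℤ) (h : ℕ) → (LocalPeak k n × h ≡ N n k) ⇔
    (∃[ q ] ∃[ j ] Σ[ q≢0 ∈ NonZero q ]
    (q ≤ k × 1 ≤ j × j ≤ q × gcd j q ≡ 1 × n ≡ η k q {{q≢0}} j × h ≡ f k q {{q≢0}})) )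
theorem7p5 k =
    (λ q j q≤k 1≤j j≤q gcd≡1 → let unimodular = gcd≡1⇒unimodular j q gcd≡1 in
        (λ w 1≤w w≤f → Formulas.c-isCycle k q j q≤k unimodular w 1≤w w≤f)
      , (λ w w′ 1≤w w≤f 1≤w′ w′≤f → Formulas.c-distinct k q j q≤k unimodular w 1≤w w≤f w′ 1≤w′ w′≤f)
      , N-η k q j q≤k 1≤j j≤q gcd≡1
      , η-localPeak k q j q≤k 1≤j j≤q gcd≡1)
  , (λ n → mk⇔ (localPeak⇒peakPoint k n) peakPoint⇒localPeak)
  , (λ n h → mk⇔
        (λ { (peak , h≡) → with-height (localPeak⇒peakPoint k n peak) h≡ })
        (λ { (q , j , q≢0 , q≤k , 1≤j , j≤q , gcd≡1 , n≡ , h≡) →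
               peakPoint⇒localPeak (q , j , q≢0 , q≤k , 1≤j , j≤q , gcd≡1 , n≡)
             , trans h≡ (sym (height q≢0 q≤k 1≤j j≤q gcd≡1 n≡)) }))
  where
  peakPoint⇒localPeak : ∀ {n} → IsPeakPoint k n → LocalPeak k n
  peakPoint⇒localPeak (q , j , q≢0 , q≤k , 1≤j , j≤q , gcd≡1 , n≡) =
    subst (LocalPeak k) (sym n≡) (η-localPeak k q j {{q≢0}} q≤k 1≤j j≤q gcd≡1)
  height : ∀ {n q j} (q≢0 : NonZero q) → q ≤ k → 1 ≤ j → j ≤ q → gcd j q ≡ 1 → n ≡ η k q {{q≢0}} j → N n k
      ≡ f k q {{q≢0}}
  height {q = q} {j} q≢0 q≤k 1≤j j≤q gcd≡1 n≡ = trans (cong (λ n → N n k) n≡)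
      (N-η k q j {{q≢0}} q≤k 1≤j j≤q gcd≡1)
  with-height : ∀ {n h} → IsPeakPoint k n → h ≡ N n k → ∃[ q ] ∃[ j ] Σ[ q≢0 ∈ NonZero q ]
                (q ≤ k × 1 ≤ j × j ≤ q × gcd j q ≡ 1 × n ≡ η k q {{q≢0}} j × h ≡ f k q {{q≢0}})
  with-height (q , j , q≢0 , q≤k , 1≤j , j≤q , gcd≡1 , n≡) h≡ =
    q , j , q≢0 , q≤k , 1≤j , j≤q , gcd≡1 , n≡ , trans h≡ (height q≢0 q≤k 1≤j j≤q gcd≡1 n≡)
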